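{- Let $n\ge 1$. For a real $n\times n$ matrix $M$ let $\sigma(M)\in Gr(n,2n)$ be the row span of the $n\times 2n$ matrix $(I\mid M')$, where $I$ is the identity matrix and $M'_{ij}=(-1)^{n-i}M_{(n+1-i)\,j}$. (1) $\sigma(M)\in LG^R(n,2n)$ if and only if $M$ is symmetric with respect to the antidiagonal. (2) $\sigma(M)\in Gr_{\ge0}(n,2n)$ if and only if $M$ is totally nonnegative. In other words, the restriction of $\sigma$ to the set of real $n\times n$ matrices that are totally nonnegative and symmetric with respect to the antidiagonal is an embedding into $LG^R_{\ge0}(n,2n)$ with dense image.
   Context: $Gr(n,2n)$ is the real Grassmannian of $n$-dimensional subspaces of $\mathbb R^{2n}$; $Gr_{\ge0}(n,2n)$ is the set of those $X$ that have a representing $n\times 2n$ matrix (rows a basis of $X$) with all maximal minors nonnegative. $R(x,y)=\sum_{i=1}^n(-1)^{i-1}(x_iy_{n+i}-x_{n+i}y_i)$; $LG^R(n,2n)=\{X\in Gr(n,2n):R(x,y)=0\ \forall x,y\in X\}$; $LG^R_{\ge0}(n,2n)=LG^R(n,2n)\cap Gr_{\ge0}(n,2n)$ (subspace topology). A matrix is totally nonnegative if all its minors (of all sizes) are nonnegative. $M$ is symmetric with respect to the antidiagonal if $M_{ij}=M_{(n+1-j)(n+1-i)}$ for all $i,j$. -}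

module Defs where

open import Algebra.Bundles using (CommutativeRing)
open import Data.Bool.Base using (if_then_else_)
open import Data.Fin.Base as Fin using (Fin; zero; suc; toℕ; opposite; _↑ˡ_; _↑ʳ_)
open import Data.Fin.Properties using (_≟_; splitAt-↑ˡ)
open import Data.Nat.Base using (ℕ; zero; suc; _∸_)
import Data.Nat.Base as ℕ
open import Data.Product using (Σ; ∃-syntax; _×_; _,_; proj₁; proj₂)
open import Data.Sum.Base using ([_,_]; inj₁; inj₂)
open import Data.Vec.Functional using (Vector; removeAt; _++_)
open import Function.Base using (_∘_; _on_)
open import Function.Structures using (IsInjection)
open import Level using (Level; 0ℓ; _⊔_) renaming (suc to lsuc)
open import Relation.Binary.Bundles using (Setoid)
open import Relation.Binary.Core using (_Preserves_⟶_)
open import Relation.Binary.Definitions using (_Respects_)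
import Relation.Binary.Construct.NonStrictToStrict as ToStrict
import Relation.Binary.Construct.On as On
open import Relation.Binary.PropositionalEquality.Core as ≡ using ()
open import Relation.Binary.Structures using (IsDecTotalOrder)
open import Relation.Nullary using (¬_; yes; no; does)
open import Relation.Unary using (Pred; Satisfiable; _∈_; _≐_; _∩_; ⋃)
  renaming (U to Whole)

private
  variable
    p q p′ q′ : Level
    k m n : ℕ

-- Open sets are taken among the Set₀-valued predicates.
record TopologicalSpace (p q : Level) : Set (lsuc (p ⊔ q ⊔ lsuc 0ℓ)) where
  field
    points : Setoid p 0ℓ

  open Setoid points public using (_≈_) renaming (Carrier to Point)

  field
    IsOpen      : Pred (Pred Point 0ℓ) q
    open-resp-≈ : ∀ {U} → IsOpen U → U Respects _≈_
    open-resp-≐ : ∀ {U V} → U ≐ V → IsOpen U → IsOpen V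
    open-whole  : IsOpen Whole
    open-∩      : ∀ {U V} → IsOpen U → IsOpen V → IsOpen (U ∩ V)
    open-⋃      : ∀ (I : Set) (U : I → Pred Point 0ℓ) →
                  (∀ i → IsOpen (U i)) → IsOpen (⋃ I U)

module _ where
  open TopologicalSpace

  subspace : (X : TopologicalSpace p q) → Pred (Point X) 0ℓ →
             TopologicalSpace p (lsuc 0ℓ ⊔ p ⊔ q)
  subspace X P = record
    { points      = record
      { Carrier       = Σ (Point X) P
      ; _≈_           = _≈_ X on proj₁
      ; isEquivalence = On.isEquivalence proj₁ (Setoid.isEquivalence (points X))
      }
    ; IsOpen      = λ U → ∃[ V ] IsOpen X V × U ≐ (V ∘ proj₁)
    ; open-resp-≈ = λ (_ , oV , U⊆V , V⊆U) x≈y u → V⊆U (open-resp-≈ X oV x≈y (U⊆V u))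
    ; open-resp-≐ = λ (U⊆U′ , U′⊆U) (V , oV , U⊆V , V⊆U) →
                      V , oV , (λ u → U⊆V (U′⊆U u)) , (λ v → U⊆U′ (V⊆U v))
    ; open-whole  = Whole , open-whole X , (λ u → u) , (λ u → u)
    ; open-∩      = λ (V , oV , f , g) (V′ , oV′ , f′ , g′) →
                      V ∩ V′ , open-∩ X oV oV′ ,
                      (λ (u , u′) → f u , f′ u′) , (λ (v , v′) → g v , g′ v′)
    ; open-⋃      = λ I U o →
                      ⋃ I (λ i → proj₁ (o i)) ,
                      open-⋃ X I (λ i → proj₁ (o i)) (λ i → proj₁ (proj₂ (o i))) ,
                      (λ (i , u) → i , proj₁ (proj₂ (proj₂ (o i))) u) ,
                      (λ (i , v) → i , proj₂ (proj₂ (proj₂ (o i))) v)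
    }

  -- For f surjective up to _≈_ this is the quotient topology.
  quotient : (X : TopologicalSpace p q) (S : Setoid p′ 0ℓ) →
             (Point X → Setoid.Carrier S) →
             TopologicalSpace p′ (p′ ⊔ q)
  quotient X S f = record
    { points      = S
    ; IsOpen      = λ U → U Respects S._≈_ × IsOpen X (U ∘ f)
    ; open-resp-≈ = λ (r , _) → r
    ; open-resp-≐ = λ (U⊆V , V⊆U) (r , o) →
                      (λ x≈y v → U⊆V (r x≈y (V⊆U v))) ,
                      open-resp-≐ X (U⊆V , V⊆U) o
    ; open-whole  = (λ _ u → u) , open-whole X
    ; open-∩      = λ (r , o) (r′ , o′) →
                      (λ x≈y (u , v) → r x≈y u , r′ x≈y v) , open-∩ X o o′
    ; open-⋃      = λ I U o →
                      (λ x≈y (i , u) → i , proj₁ (o i) x≈y u) ,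
                      open-⋃ X I (λ i → U i ∘ f) (λ i → proj₂ (o i))
    }
    where module S = Setoid S

  module _ (X : TopologicalSpace p q) (Y : TopologicalSpace p′ q′)
           (f : Point X → Point Y) where

    Image : Pred (Point X) 0ℓ → Pred (Point Y) p
    Image U y = ∃[ x ] U x × _≈_ Y (f x) y

    IsContinuous : Set _
    IsContinuous = ∀ V → IsOpen Y V → IsOpen X (V ∘ f)

      -- Continuous, injective, and open as a map onto its image.
    record IsEmbedding : Set (lsuc 0ℓ ⊔ p ⊔ q ⊔ p′ ⊔ q′) where
      field
        isInjection   : IsInjection (_≈_ X) (_≈_ Y) f
        isContinuous  : IsContinuous
        openOntoImage : ∀ U → IsOpen X U →
                        ∃[ V ] IsOpen Y V × Image U ≐ (V ∩ Image Whole)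

  IsDense : (Y : TopologicalSpace p q) → Pred (Point Y) p′ → Set _
  IsDense Y P = ∀ U → IsOpen Y U → Satisfiable U → Satisfiable (U ∩ P)

-- The axioms of a Dedekind-complete ordered field, which determine ℝ up to
-- isomorphism.  Decidability of the order expresses classical trichotomy.
record RealNumbers : Set₁ where
  field
    commutativeRing : CommutativeRing 0ℓ 0ℓ

  open CommutativeRing commutativeRing public

  infix 4 _≤_
  field
    _≤_             : Carrier → Carrier → Set
    isDecTotalOrder : IsDecTotalOrder _≈_ _≤_
    0≉1             : ¬ 0# ≈ 1#
    inverse         : ∀ x → ¬ x ≈ 0# → ∃[ y ] x * y ≈ 1#
    +-monoˡ-≤       : ∀ z {x y} → x ≤ y → x + z ≤ y + z
    *-nonNeg        : ∀ {x y} → 0# ≤ x → 0# ≤ y → 0# ≤ x * y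
    supremum        : ∀ (P : Pred Carrier 0ℓ) → Satisfiable P →
                      (∃[ b ] ∀ x → P x → x ≤ b) →
                      ∃[ s ] (∀ x → P x → x ≤ s) ×
                             (∀ b → (∀ x → P x → x ≤ b) → s ≤ b)

  open IsDecTotalOrder isDecTotalOrder public
    using (_≤?_; antisym; total; ≤-resp-≈)
    renaming (refl to ≤-refl; reflexive to ≤-reflexive; trans to ≤-trans)

  open ToStrict _≈_ _≤_ public using (_<_)

module Real (ℝ : RealNumbers) where

  open RealNumbers ℝ hiding (zero)
  open import Algebra.Properties.Semiring.Exp semiring using (_^_)
  open import Algebra.Properties.Semiring.Sum semiring
  open import Algebra.Properties.Ring ring using (-‿distribˡ-*)
  open import Data.Vec.Functional.Relation.Binary.Equality.Setoid setoid
    using (_≋_; ≋-isEquivalence)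
  open import Relation.Binary.Reasoning.Setoid setoid

  Matrix : ℕ → ℕ → Set
  Matrix m n = Vector (Vector Carrier n) m

  identity : Matrix n n
  identity i j = if does (i ≟ j) then 1# else 0#

  -- Expansion along the first row.
  det : Matrix n n → Carrier
  det {zero}  A = 1#
  det {suc n} A =
    ∑[ j < suc n ] ((- 1#) ^ toℕ j * A zero j * det (λ i → removeAt (A (suc i)) j))

  StrictlyIncreasing : (Fin k → Fin n) → Set
  StrictlyIncreasing I = I Preserves Fin._<_ ⟶ Fin._<_

  TotallyNonnegative : Pred (Matrix m n) 0ℓ
  TotallyNonnegative {m} {n} A =
    ∀ k (I : Fin k → Fin m) (J : Fin k → Fin n) →
    StrictlyIncreasing I → StrictlyIncreasing J →
    0# ≤ det (λ a b → A (I a) (J b))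

  MaximalMinorsNonnegative : Pred (Matrix m n) 0ℓ
  MaximalMinorsNonnegative {m} {n} A =
    ∀ (J : Fin m → Fin n) → StrictlyIncreasing J → 0# ≤ det (λ a b → A a (J b))

  -- With 1-based indices, opposite is i ↦ n + 1 - i.
  AntidiagonalSymmetric : Pred (Matrix n n) 0ℓ
  AntidiagonalSymmetric M = ∀ i j → M i j ≈ M (opposite j) (opposite i)

  combination : Vector Carrier m → Matrix m n → Vector Carrier n
  combination {m} c A j = ∑[ i < m ] (c i * A i j)

  LinearlyIndependent : Pred (Matrix m n) 0ℓ
  LinearlyIndependent A =
    ∀ c → (∀ j → combination c A j ≈ 0#) → ∀ i → c i ≈ 0#

  record IsSubspace (V : Pred (Vector Carrier n) 0ℓ) : Set where
    field
      resp     : V Respects _≋_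
      zero-mem : V (λ _ → 0#)
      +-closed : ∀ {v w} → V v → V w → V (λ j → v j + w j)
      *-closed : ∀ a {v} → V v → V (λ j → a * v j)

  record IsBasis (A : Matrix m n) (V : Pred (Vector Carrier n) 0ℓ) : Set where
    field
      members     : ∀ i → A i ∈ V
      independent : LinearlyIndependent A
      spanning    : ∀ {v} → v ∈ V → ∃[ c ] v ≋ combination c A

  record Gr (m n : ℕ) : Set₁ where
    field
      members    : Pred (Vector Carrier n) 0ℓ
      isSubspace : IsSubspace members
      hasBasis   : ∃[ A ] IsBasis {m} A members

  Gr-setoid : ℕ → ℕ → Setoid (lsuc 0ℓ) 0ℓ
  Gr-setoid m n = record
    { Carrier       = Gr m n
    ; _≈_           = λ X Y → Gr.members X ≐ Gr.members Y
    ; isEquivalence = record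
      { refl  = (λ v → v) , (λ v → v)
      ; sym   = λ (f , g) → g , f
      ; trans = λ (f , g) (f′ , g′) → (λ v → f′ (f v)) , (λ v → g (g′ v))
      }
    }

  sum-zero : (f : Vector Carrier n) → (∀ i → f i ≈ 0#) → sum f ≈ 0#
  sum-zero {n} f f≈0 = trans (sum-cong-≋ f≈0) (sum-replicate-zero n)

  combination-identity : (c : Vector Carrier n) (A : Matrix n m) (j : Fin n) (l : Fin m) →
                         (∀ i → A i l ≈ identity i j) → combination c A l ≈ c j
  combination-identity c A zero l h = begin
    c zero * A zero l + sum (λ i → c (suc i) * A (suc i) l)
      ≈⟨ +-cong (trans (*-congˡ (h zero)) (*-identityʳ _))
                (sum-zero _ (λ i → trans (*-congˡ (h (suc i))) (zeroʳ _))) ⟩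
    c zero + 0#
      ≈⟨ +-identityʳ _ ⟩
    c zero ∎
  combination-identity c A (suc j) l h = begin
    c zero * A zero l + sum (λ i → c (suc i) * A (suc i) l)
      ≈⟨ +-cong (trans (*-congˡ (h zero)) (zeroʳ _))
                (combination-identity (c ∘ suc) (A ∘ suc) j l (λ i → h (suc i))) ⟩
    0# + c (suc j)
      ≈⟨ +-identityˡ _ ⟩
    c (suc j) ∎

  row-combination : (A : Matrix m n) (i : Fin m) → A i ≋ combination (identity i) A
  row-combination {suc m} A zero j = sym (begin
    1# * A zero j + sum (λ i → 0# * A (suc i) j)
      ≈⟨ +-cong (*-identityˡ _) (sum-zero {m} _ (λ i → zeroˡ _)) ⟩
    A zero j + 0#
      ≈⟨ +-identityʳ _ ⟩
    A zero j ∎)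
  row-combination A (suc i) j = sym (begin
    0# * A zero j + combination (identity i) (A ∘ suc) j
      ≈⟨ +-cong (zeroˡ _) (sym (row-combination (A ∘ suc) i j)) ⟩
    0# + A (suc i) j
      ≈⟨ +-identityˡ _ ⟩
    A (suc i) j ∎)

  rowSpan : (A : Matrix m n) → LinearlyIndependent A → Gr m n
  rowSpan {m} A ind = record
    { members    = λ v → ∃[ c ] v ≋ combination c A
    ; isSubspace = record
      { resp     = λ v≋w (c , e) → c , λ j → trans (sym (v≋w j)) (e j)
      ; zero-mem = (λ _ → 0#) , λ j → sym (sum-zero {m} _ (λ i → zeroˡ _))
      ; +-closed = λ (c , e) (d , f) → (λ i → c i + d i) , λ j →
          trans (+-cong (e j) (f j))
            (trans (sym (∑-distrib-+ (λ i → c i * A i j) (λ i → d i * A i j)))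
                   (sum-cong-≋ {m} (λ i → sym (distribʳ _ _ _))))
      ; *-closed = λ a (c , e) → (λ i → a * c i) , λ j →
          trans (*-congˡ (e j))
            (trans (*-distribˡ-sum a (λ i → c i * A i j))
                   (sum-cong-≋ {m} (λ i → sym (*-assoc _ _ _))))
      }
    ; hasBasis   = A , record
      { members     = λ i → identity i , row-combination A i
      ; independent = ind
      ; spanning    = λ v → v
      }
    }

  Gr≥0 : Pred (Gr m n) 0ℓ
  Gr≥0 {m} X = ∃[ A ] IsBasis {m} A (Gr.members X) × MaximalMinorsNonnegative A

  R : ∀ n (x y : Vector Carrier (n ℕ.+ n)) → Carrier
  R n x y =
    ∑[ i < n ] ((- 1#) ^ toℕ i * (x (i ↑ˡ n) * y (n ↑ʳ i) - x (n ↑ʳ i) * y (i ↑ˡ n)))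

  LG : Pred (Gr n (n ℕ.+ n)) 0ℓ
  LG {n} X = ∀ x y → x ∈ Gr.members X → y ∈ Gr.members X → R n x y ≈ 0#

  LG≥0 : Pred (Gr n (n ℕ.+ n)) 0ℓ
  LG≥0 = LG ∩ Gr≥0

  -- The index i : Fin n stands for the 1-based row index toℕ i + 1.
  twist : Matrix n n → Matrix n n
  twist {n} M i j = (- 1#) ^ (n ∸ suc (toℕ i)) * M (opposite i) j

  [I∣_′] : Matrix n n → Matrix n (n ℕ.+ n)
  [I∣ M ′] i = identity i ++ twist M i

  [I∣′]-independent : (M : Matrix n n) → LinearlyIndependent [I∣ M ′]
  [I∣′]-independent {n} M c c·A≈0 j =
    trans (sym (combination-identity c [I∣ M ′] j (j ↑ˡ n) left)) (c·A≈0 (j ↑ˡ n))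
    where
    left : ∀ i → [I∣ M ′] i (j ↑ˡ n) ≈ identity i j
    left i = reflexive (≡.cong [ identity i , twist M i ] (splitAt-↑ˡ n j n))

  σ : Matrix n n → Gr n (n ℕ.+ n)
  σ M = rowSpan [I∣ M ′] ([I∣′]-independent M)

  Close : Carrier → Matrix m n → Matrix m n → Set
  Close ε A B = ∀ i j → (A i j - B i j < ε) × (B i j - A i j < ε)

  min-positive : ∀ {x y} → 0# < x → 0# < y →
                 ∃[ z ] 0# < z × z ≤ x × z ≤ y
  min-positive {x} {y} 0<x 0<y with x ≤? y
  ... | yes x≤y = x , 0<x , ≤-refl , x≤y
  ... | no  x≰y with total x y
  ...   | inj₁ x≤y = x , 0<x , ≤-refl , x≤y
  ...   | inj₂ y≤x = y , 0<y , y≤x , ≤-refl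

  <-≤-trans : ∀ {x y z} → x < y → y ≤ z → x < z
  <-≤-trans = ToStrict.<-≤-trans _≈_ _≤_ sym ≤-trans antisym (proj₁ ≤-resp-≈)

  Close-weaken : ∀ {δ ε} {A B : Matrix m n} → δ ≤ ε → Close δ A B → Close ε A B
  Close-weaken δ≤ε c i j = <-≤-trans (proj₁ (c i j)) δ≤ε , <-≤-trans (proj₂ (c i j)) δ≤ε

  ≈-diff : ∀ {x y ε} → 0# < ε → x ≈ y → x - y < ε
  ≈-diff (0≤ε , 0≉ε) x≈y =
    ≤-trans (≤-reflexive x-y≈0) 0≤ε , λ e → 0≉ε (trans (sym x-y≈0) e)
    where x-y≈0 = trans (+-congʳ x≈y) (-‿inverseʳ _)

  -- The Euclidean topology, by balls in the maximum norm.
  matrixSpace : ℕ → ℕ → TopologicalSpace 0ℓ 0ℓ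
  matrixSpace m n = record
    { points      = record
      { Carrier       = Matrix m n
      ; _≈_           = λ A B → ∀ i j → A i j ≈ B i j
      ; isEquivalence = record
        { refl  = λ i j → refl
        ; sym   = λ e i j → sym (e i j)
        ; trans = λ e f i j → trans (e i j) (f i j)
        }
      }
    ; IsOpen      = λ U → ∀ A → U A → ∃[ ε ] 0# < ε × (∀ B → Close ε A B → U B)
    ; open-resp-≈ = λ o {A} {B} e u →
        let (ε , 0<ε , h) = o A u
        in h B (λ i j → ≈-diff 0<ε (e i j) , ≈-diff 0<ε (sym (e i j)))
    ; open-resp-≐ = λ (U⊆V , V⊆U) o A v →
        let (ε , 0<ε , h) = o A (V⊆U v) in ε , 0<ε , λ B c → U⊆V (h B c)
    ; open-whole  = λ A _ → 1# , 0<1 , λ B _ → _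
    ; open-∩      = λ o o′ A (u , v) →
        let (ε , 0<ε , h)    = o A u
            (ε′ , 0<ε′ , h′) = o′ A v
            (δ , 0<δ , δ≤ε , δ≤ε′) = min-positive 0<ε 0<ε′
        in δ , 0<δ , λ B c → h B (Close-weaken δ≤ε c) , h′ B (Close-weaken δ≤ε′ c)
    ; open-⋃      = λ I U o A (i , u) →
        let (ε , 0<ε , h) = o i A u in ε , 0<ε , λ B c → i , h B c
    }
    where
    0<1 : 0# < 1#
    0<1 with total 0# 1#
    ... | inj₁ 0≤1 = 0≤1 , 0≉1
    ... | inj₂ 1≤0 = ≤-trans (*-nonNeg 0≤-1 0≤-1) (≤-reflexive -1*-1≈1) , 0≉1
      where
      0≤-1 : 0# ≤ - 1#
      0≤-1 = ≤-trans (≤-reflexive (sym (-‿inverseʳ 1#)))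
               (≤-trans (+-monoˡ-≤ (- 1#) 1≤0) (≤-reflexive (+-identityˡ _)))
      -1*-1≈1 : - 1# * - 1# ≈ 1#
      -1*-1≈1 = begin
        - 1# * - 1#   ≈⟨ -‿distribˡ-* 1# (- 1#) ⟨
        - (1# * - 1#) ≈⟨ -‿cong (*-identityˡ _) ⟩
        - - 1#        ≈⟨ -‿involutive′ ⟩
        1# ∎
        where
        open import Algebra.Properties.Ring ring using (-‿involutive)
        -‿involutive′ = -‿involutive 1#

  -- The quotient topology from the space of matrices of full row rank.
  grSpace : ℕ → ℕ → TopologicalSpace (lsuc 0ℓ) (lsuc 0ℓ)
  grSpace m n =
    quotient (subspace (matrixSpace m n) LinearlyIndependent) (Gr-setoid m n)
             (λ (A , ind) → rowSpan A ind)

  symmetricTNNSpace : ℕ → TopologicalSpace 0ℓ (lsuc 0ℓ)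
  symmetricTNNSpace n =
    subspace (matrixSpace n n) (TotallyNonnegative ∩ AntidiagonalSymmetric)

  LG≥0-space : ℕ → TopologicalSpace (lsuc 0ℓ) (lsuc 0ℓ)
  LG≥0-space n = subspace (grSpace n (n ℕ.+ n)) LG≥0

{-# OPTIONS --safe #-}

-- Let B = (I ∣ M ′).  R evaluated on rows i and j of B is ± (M_{n+1-j, i} - M_{n+1-i, j}),
-- which gives (1).  For (2), expanding a maximal minor of B along its unit columns, taken from
-- left to right, leaves exactly a minor of M: the signs of the twist absorb the cofactor signs.
-- Any other basis of the row span multiplies all maximal minors by one common factor.
--
-- σ is an embedding because its inverse on {det P ≠ 0}, (P ∣ Q) ↦ P⁻¹ Q untwisted, is
-- continuous by Cramer's rule.
--
-- For density, let A be a nonnegative isotropic matrix and J the columns of a positive maximal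
-- minor.  If J is not {1, …, n}, then some d + 1 ∈ J has d ∉ J.  Adding t times column d + 1 to
-- column d, and t times another column to its cyclic neighbour so that R is preserved, moves A
-- arbitrarily little, decreases no maximal minor, and makes the minor with d + 1 replaced by d
-- positive.  As ∑ J drops, after finitely many such moves the minor of the first n columns is
-- positive, so the row span is in the image of σ.

module Submission where

open import Defs
import Algebra.Solver.Ring as RingSolver
open import Algebra.Solver.Ring.AlmostCommutativeRing
  using (fromCommutativeRing; _-Raw-AlmostCommutative⟶_)
open import Data.Empty using (⊥-elim)
open import Data.Fin.Base as Fin
  using (Fin; zero; suc; toℕ; punchIn; punchOut; opposite; fromℕ; inject₁; splitAt; _↑ˡ_; _↑ʳ_)
import Data.Fin.Properties as Finₚ
open import Data.Integer.Base as ℤ using (ℤ; -[1+_]; _⊖_)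
import Data.Integer.Properties as ℤₚ
open import Data.Maybe.Base as Maybe using (Maybe)
open import Data.Nat.Base as ℕ using (ℕ; zero; suc; NonZero)
import Data.Nat.Properties as ℕₚ
import Algebra.Properties.CommutativeMonoid.Sum ℕₚ.+-0-commutativeMonoid as ℕΣ
open import Data.Product using (Σ-syntax; ∃-syntax; _×_; _,_; proj₁; proj₂)
open import Data.Sum.Base using (_⊎_; inj₁; inj₂)
open import Data.Vec.Functional using (Vector; _∷_; _++_; removeAt; insertAt; updateAt)
import Data.Vec.Functional.Properties as VFₚ
open import Function.Base using (_∘_)
open import Function.Bundles using (_⇔_; mk⇔; Equivalence)
open import Function.Structures using (IsInjection)
open import Relation.Binary.Bundles using (Setoid)
open import Relation.Binary.Definitions using (tri<; tri≈; tri>)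
open import Relation.Binary.PropositionalEquality as ≡ using (_≡_; _≢_)
open import Relation.Binary.Structures using (IsDecTotalOrder)
open import Relation.Nullary using (¬_; yes; no; Dec)
open import Relation.Nullary.Decidable.Core using (dec⇒maybe)
open import Relation.Unary using (_∈_; _⊆_; _≐_; _∩_) renaming (U to Whole)

-- Adding column d + 1 to column d alone destroys isotropy. The map x ↦ x + t (x_s e_d + ε x_g e_f)
-- is compatible with R to first order in t when g is the index that R pairs with d, f is the one
-- paired with s, and ε balances the two coefficients. The signs of R make this compensation
-- harmless. Inside a block they alternate, so ε = 1, and the partners of neighbours are neighbours.
-- For d = n the partners are the last and the first column, and ε = (-1)^(n-1), which is exactly
-- the sign under which nonnegativity of maximal minors survives a cyclic shift of the columns.
--
-- Since `det` is given only by expansion along the first row, the transpose and product rules are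
-- derived from the uniqueness of alternating forms, without permutations. The topology of the
-- Grassmannian is a quotient of a space of matrices, so every openness claim becomes an estimate on
-- matrix entries; continuity of the chart is obtained from Lipschitz bounds at a point, which pass
-- through sums, products and reciprocals with explicit constants.

module Proof (ℝ : RealNumbers) where

  open RealNumbers ℝ hiding (zero)
  open Real ℝ
  open import Algebra.Properties.AbelianGroup +-abelianGroup using (⁻¹-∙-comm)
  open import Algebra.Properties.Ring ring
    using (-‿distribˡ-*; -‿distribʳ-*; -‿involutive; -0#≈0#; -1*x≈-x)
  open import Algebra.Properties.Semiring.Exp semiring using (_^_; ^-homo-*)
  import Algebra.Properties.Semiring.Mult.TCOptimised semiring as Mult
  open import Algebra.Properties.Semiring.Sum semiring
  open import Relation.Binary.Reasoning.Setoid setoid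

  -- Ring normalisation

  -- The coefficient ring of the solver is ℤ rather than the abstract field, whose arithmetic
  -- does not compute, so that terms cancel.
  ι : ℤ → Carrier
  ι (ℤ.+ n)  = n Mult.× 1#
  ι -[1+ n ] = - (suc n Mult.× 1#)

  x≈0⇒x+y≈y : ∀ {x y} → x ≈ 0# → x + y ≈ y
  x≈0⇒x+y≈y e = trans (+-congʳ e) (+-identityˡ _)

  ι-⊖ : ∀ m n → ι (m ⊖ n) ≈ m Mult.× 1# - n Mult.× 1#
  ι-⊖ m       zero    = sym (trans (+-congˡ -0#≈0#) (+-identityʳ _))
  ι-⊖ zero    (suc n) = sym (+-identityˡ _)
  ι-⊖ (suc m) (suc n) = begin
    ι (suc m ⊖ suc n)                     ≡⟨ ≡.cong ι (ℤₚ.[1+m]⊖[1+n]≡m⊖n m n) ⟩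
    ι (m ⊖ n)                             ≈⟨ ι-⊖ m n ⟩
    a - b                                 ≈⟨ x≈0⇒x+y≈y (-‿inverseʳ 1#) ⟨
    (1# - 1#) + (a - b)                   ≈⟨ +-assoc 1# (- 1#) (a - b) ⟩
    1# + (- 1# + (a - b))                 ≈⟨ +-congˡ (+-comm _ _) ⟩
    1# + ((a - b) - 1#)                   ≈⟨ +-congˡ (+-assoc _ _ _) ⟩
    1# + (a + (- b - 1#))                 ≈⟨ +-assoc _ _ _ ⟨
    (1# + a) + (- b - 1#)                 ≈⟨ +-congˡ (trans (⁻¹-∙-comm b 1#) (-‿cong (+-comm b 1#))) ⟩
    (1# + a) - (1# + b)                   ≈⟨ +-cong (Mult.1+× m 1#) (-‿cong (Mult.1+× n 1#)) ⟨
    suc m Mult.× 1# - suc n Mult.× 1#     ∎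
    where
    a = m Mult.× 1#
    b = n Mult.× 1#

  ι-+ : ∀ i j → ι (i ℤ.+ j) ≈ ι i + ι j
  ι-+ (ℤ.+ m)  (ℤ.+ n)  = Mult.×-homo-+ 1# m n
  ι-+ (ℤ.+ m)  -[1+ n ] = ι-⊖ m (suc n)
  ι-+ -[1+ m ] (ℤ.+ n)  = trans (ι-⊖ n (suc m)) (+-comm _ _)
  ι-+ -[1+ m ] -[1+ n ] = begin
    - (suc (suc (m ℕ.+ n)) Mult.× 1#)                ≡⟨ ≡.cong (λ k → - (suc k Mult.× 1#))
            (≡.sym (ℕₚ.+-suc m n)) ⟩
    - ((suc m ℕ.+ suc n) Mult.× 1#)                  ≈⟨ -‿cong (Mult.×-homo-+ 1# (suc m) (suc n)) ⟩
    - (suc m Mult.× 1# + suc n Mult.× 1#)            ≈⟨ ⁻¹-∙-comm _ _ ⟨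
    - (suc m Mult.× 1#) - suc n Mult.× 1#            ∎

  ι-neg : ∀ i → ι (ℤ.- i) ≈ - ι i
  ι-neg (ℤ.+ zero)  = sym -0#≈0#
  ι-neg (ℤ.+ suc n) = refl
  ι-neg -[1+ n ]    = sym (-‿involutive _)

  ι-pos-* : ∀ m j → ι (ℤ.+ m ℤ.* j) ≈ ι (ℤ.+ m) * ι j
  ι-pos-* m (ℤ.+ n) = trans (reflexive (≡.cong ι (≡.sym (ℤₚ.pos-* m n)))) (Mult.×1-homo-* m n)
  ι-pos-* m -[1+ n ] = begin
    ι (ℤ.+ m ℤ.* -[1+ n ])               ≡⟨ ≡.cong ι (≡.sym (ℤₚ.neg-distribʳ-* (ℤ.+ m) (ℤ.+ suc n))) ⟩
    ι (ℤ.- (ℤ.+ m ℤ.* ℤ.+ suc n))        ≈⟨ ι-neg (ℤ.+ m ℤ.* ℤ.+ suc n) ⟩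
    - ι (ℤ.+ m ℤ.* ℤ.+ suc n)            ≈⟨ -‿cong (ι-pos-* m (ℤ.+ suc n)) ⟩
    - (ι (ℤ.+ m) * ι (ℤ.+ suc n))        ≈⟨ -‿distribʳ-* _ _ ⟩
    ι (ℤ.+ m) * ι -[1+ n ]               ∎

  ι-* : ∀ i j → ι (i ℤ.* j) ≈ ι i * ι j
  ι-* (ℤ.+ m)  j = ι-pos-* m j
  ι-* -[1+ m ] j = begin
    ι (-[1+ m ] ℤ.* j)                   ≡⟨ ≡.cong ι (≡.sym (ℤₚ.neg-distribˡ-* (ℤ.+ suc m) j)) ⟩
    ι (ℤ.- (ℤ.+ suc m ℤ.* j))            ≈⟨ ι-neg (ℤ.+ suc m ℤ.* j) ⟩
    - ι (ℤ.+ suc m ℤ.* j)                ≈⟨ -‿cong (ι-pos-* (suc m) j) ⟩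
    - (ι (ℤ.+ suc m) * ι j)              ≈⟨ -‿distribˡ-* _ _ ⟩
    ι -[1+ m ] * ι j                     ∎

  ι-homomorphism : ℤ.+-*-rawRing -Raw-AlmostCommutative⟶ fromCommutativeRing commutativeRing
  ι-homomorphism = record
    { ⟦_⟧ = ι ; +-homo = ι-+ ; *-homo = ι-* ; -‿homo = ι-neg ; 0-homo = refl ; 1-homo = refl }

  coefficient≟ : ∀ i j → Maybe (ι i ≈ ι j)
  coefficient≟ i j = Maybe.map (λ i≡j → reflexive (≡.cong ι i≡j)) (dec⇒maybe (i ℤₚ.≟ j))

  open RingSolver ℤ.+-*-rawRing (fromCommutativeRing commutativeRing) ι-homomorphism coefficient≟
    using (solve; con; _:+_; _:*_; _:-_; :-_; _:=_)

  -- Alternating forms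

  x≈x+x⇒x≈0 : ∀ {x} → x ≈ x + x → x ≈ 0#
  x≈x+x⇒x≈0 {x} e = begin
    x              ≈⟨ solve 1 (λ x → x := (x :+ x) :- x) refl x ⟩
    (x + x) - x    ≈⟨ +-congʳ e ⟨
    x - x          ≈⟨ -‿inverseʳ x ⟩
    0#             ∎

  -- Inductive rather than an equation between `toℕ` values, so that recursion on it runs in step
  -- with `punchIn`. Alternation is demanded for neighbouring slots only; `repeated` recovers the
  -- general case by exchanges.
  data Next : ∀ {n} → Fin n → Fin n → Set where
    here  : ∀ {n} → Next {suc (suc n)} zero (suc zero)
    there : ∀ {n} {p q : Fin n} → Next p q → Next (suc p) (suc q)

  toℕ-Next : ∀ {n} {p q : Fin n} → Next p q → toℕ q ≡ suc (toℕ p)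
  toℕ-Next here       = ≡.refl
  toℕ-Next (there nx) = ≡.cong suc (toℕ-Next nx)

  -- Deleting a third column leaves two neighbours adjacent, so the cofactor still has two equal
  -- neighbouring columns and vanishes by induction.
  Next-punchIn : ∀ {n} {p q : Fin (suc n)} → Next p q → ∀ l → l ≢ p → l ≢ q →
                 ∃[ p′ ] ∃[ q′ ] Next p′ q′ × punchIn l p′ ≡ p × punchIn l q′ ≡ q
  Next-punchIn here zero l≢p l≢q = ⊥-elim (l≢p ≡.refl)
  Next-punchIn here (suc zero) l≢p l≢q = ⊥-elim (l≢q ≡.refl)
  Next-punchIn {suc (suc n)} here (suc (suc l)) l≢p l≢q = zero , suc zero , here , ≡.refl , ≡.refl
  Next-punchIn (there nx) zero l≢p l≢q = _ , _ , nx , ≡.refl , ≡.refl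
  Next-punchIn {suc n} (there nx) (suc l) l≢p l≢q
    with p′ , q′ , nx′ , ep , eq ← Next-punchIn nx l (l≢p ∘ ≡.cong suc) (l≢q ∘ ≡.cong suc)
    = suc p′ , suc q′ , there nx′ , ≡.cong suc ep , ≡.cong suc eq

  -- Omitting `p` and omitting `q` give index lists that differ in one place, where one has `q` and
  -- the other `p`. If columns `p` and `q` are equal, the two cofactors therefore coincide and their
  -- opposite signs cancel.
  punchIn-Next : ∀ {n} {p q : Fin (suc n)} → Next p q → ∀ j →
                 punchIn p j ≡ punchIn q j ⊎ (punchIn p j ≡ q × punchIn q j ≡ p)
  punchIn-Next here zero    = inj₂ (≡.refl , ≡.refl)
  punchIn-Next here (suc j) = inj₁ ≡.refl
  punchIn-Next (there nx) zero = inj₁ ≡.refl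
  punchIn-Next (there nx) (suc j) with punchIn-Next nx j
  ... | inj₁ e       = inj₁ (≡.cong suc e)
  ... | inj₂ (e , f) = inj₂ (≡.cong suc e , ≡.cong suc f)

  sum-Next : ∀ {n} {p q : Fin n} → Next p q → (f : Vector Carrier n) →
             (∀ l → l ≢ p → l ≢ q → f l ≈ 0#) → f p + f q ≈ 0# → sum f ≈ 0#
  sum-Next here f f≈0 e = begin
    f zero + (f (suc zero) + sum (λ l → f (suc (suc l)))) ≈⟨ +-assoc _ _ _ ⟨
    (f zero + f (suc zero)) + sum (λ l → f (suc (suc l))) ≈⟨ x≈0⇒x+y≈y e ⟩
    sum (λ l → f (suc (suc l)))                           ≈⟨ sum-zero _
            (λ l → f≈0 (suc (suc l)) (λ ()) (λ ())) ⟩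
    0# ∎
  sum-Next (there nx) f f≈0 e = trans (x≈0⇒x+y≈y (f≈0 zero (λ ()) (λ ())))
    (sum-Next nx (f ∘ suc) (λ l l≢p l≢q → f≈0 (suc l) (l≢p ∘ Finₚ.suc-injective) (l≢q ∘ Finₚ.suc-injective)) e)

  det-cong : ∀ {n} {A B : Matrix n n} → (∀ i j → A i j ≈ B i j) → det A ≈ det B
  det-cong {zero}  A≈B = refl
  det-cong {suc n} A≈B = sum-cong-≋ {suc n} λ j →
    *-cong (*-congˡ {(- 1#) ^ toℕ j} (A≈B zero j)) (det-cong (λ i l → A≈B (suc i) (punchIn j l)))

  -- Linearity in slot p is relational (u = a v + w in slot p, all equal elsewhere),
  -- so that no update operation has to be computed with.
  record Alternating {k m} (F : Matrix k m → Carrier) : Set where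
    field
      cong        : ∀ {u v} → (∀ i j → u i j ≈ v i j) → F u ≈ F v
      linear      : ∀ p a {u v w} → (∀ j → u p j ≈ a * v p j + w p j) →
                    (∀ i → i ≢ p → ∀ j → u i j ≈ v i j) →
                    (∀ i → i ≢ p → ∀ j → u i j ≈ w i j) → F u ≈ a * F v + F w
      alternating : ∀ {p q} → Next p q → ∀ {v} → (∀ j → v p j ≈ v q j) → F v ≈ 0#

  open Alternating

  -- Expansion along the first row treats all columns alike, so the column properties are a direct
  -- induction. The row properties are not, and wait for `det-transpose`.
  transpose-det-alternating : ∀ n → Alternating {n} {n} (λ v → det (λ i j → v j i))
  transpose-det-alternating n .cong u≈v = det-cong (λ i j → u≈v j i)
  transpose-det-alternating (suc n) .linear p a {u} {v} {w} hp hv hw = begin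
    sum (term u)
      ≈⟨ sum-cong-≋ {suc n} (λ l → step l (l Finₚ.≟ p)) ⟩
    sum (λ l → a * term v l + term w l)
      ≈⟨ ∑-distrib-+ (λ l → a * term v l) (term w) ⟩
    sum (λ l → a * term v l) + sum (term w)
      ≈⟨ +-congʳ (*-distribˡ-sum a (term v)) ⟨
    a * sum (term v) + sum (term w) ∎
    where
    minor : Matrix (suc n) (suc n) → Fin (suc n) → Matrix n n
    minor x l i j = x (punchIn l j) (suc i)
    term : Matrix (suc n) (suc n) → Fin (suc n) → Carrier
    term x l = (- 1#) ^ toℕ l * x l zero * det (minor x l)
    step : ∀ l → Dec (l ≡ p) → term u l ≈ a * term v l + term w l
    step l (yes ≡.refl) = begin
      s * u l zero * det (minor u l)
        ≈⟨ *-congʳ (*-congˡ (hp zero)) ⟩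
      s * (a * v l zero + w l zero) * det (minor u l)
        ≈⟨ solve 5 (λ s a x y d → s :* (a :* x :+ y) :* d := a :* (s :* x :* d) :+ s :* y :* d)
                 refl s a (v l zero) (w l zero) _ ⟩
      a * (s * v l zero * det (minor u l)) + s * w l zero * det (minor u l)
        ≈⟨ +-cong (*-congˡ (*-congˡ (det-cong λ i j → hv _ (Finₚ.punchInᵢ≢i l j) (suc i))))
                  (*-congˡ (det-cong λ i j → hw _ (Finₚ.punchInᵢ≢i l j) (suc i))) ⟩
      a * term v l + term w l ∎
      where s = (- 1#) ^ toℕ l
    step l (no l≢p) = begin
      s * u l zero * det (minor u l)
        ≈⟨ *-congˡ (transpose-det-alternating n .linear (punchOut l≢p) a
             {λ j i → u (punchIn l j) (suc i)} {λ j i → v (punchIn l j) (suc i)}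
                     {λ j i → w (punchIn l j) (suc i)}
             (λ j → hp′ (suc j)) (λ i i≢ j → hv _ (off i≢) (suc j)) (λ i i≢ j → hw _ (off i≢) (suc j))) ⟩
      s * u l zero * (a * det (minor v l) + det (minor w l))
        ≈⟨ solve 5 (λ s a x d e → s :* x :* (a :* d :+ e) := a :* (s :* x :* d) :+ s :* x :* e)
                 refl s a (u l zero) _ _ ⟩
      a * (s * u l zero * det (minor v l)) + s * u l zero * det (minor w l)
        ≈⟨ +-cong (*-congˡ (*-congʳ (*-congˡ (hv l l≢p zero)))) (*-congʳ (*-congˡ (hw l l≢p zero))) ⟩
      a * term v l + term w l ∎
      where
      s = (- 1#) ^ toℕ l
      back : punchIn l (punchOut l≢p) ≡ p
      back = Finₚ.punchIn-punchOut l≢p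
      hp′ : ∀ j → u (punchIn l (punchOut l≢p)) j ≈ a * v (punchIn l (punchOut l≢p)) j + w
              (punchIn l (punchOut l≢p)) j
      hp′ j = ≡.subst (λ q → u q j ≈ a * v q j + w q j) (≡.sym back) (hp j)
      off : ∀ {i} → i ≢ punchOut l≢p → punchIn l i ≢ p
      off i≢ e = i≢ (Finₚ.punchIn-injective l _ _ (≡.trans e (≡.sym back)))
  transpose-det-alternating (suc n) .alternating {p} {q} nx {v} vp≈vq = sum-Next nx term other pair
    where
    minor : Fin (suc n) → Matrix n n
    minor l i j = v (punchIn l j) (suc i)
    term : Fin (suc n) → Carrier
    term l = (- 1#) ^ toℕ l * v l zero * det (minor l)
    other : ∀ l → l ≢ p → l ≢ q → term l ≈ 0#
    other l l≢p l≢q with p′ , q′ , nx′ , ≡.refl , ≡.refl ← Next-punchIn nx l l≢p l≢q =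
      trans (*-congˡ (transpose-det-alternating n .alternating nx′ {λ j i → v (punchIn l j) (suc i)}
              (λ j → vp≈vq (suc j)))) (zeroʳ _)
    minor-≈ : ∀ i j → minor q i j ≈ minor p i j
    minor-≈ i j with punchIn-Next nx j
    ... | inj₁ e       = reflexive (≡.cong (λ r → v r (suc i)) (≡.sym e))
    ... | inj₂ (e , f) = trans (reflexive (≡.cong (λ r → v r (suc i)) f))
                           (trans (vp≈vq (suc i)) (reflexive (≡.cong (λ r → v r (suc i)) (≡.sym e))))
    pair : term p + term q ≈ 0#
    pair = begin
      term p + (- 1#) ^ toℕ q * v q zero * det (minor q)
        ≈⟨ +-congˡ (*-cong (*-cong (reflexive (≡.cong ((- 1#) ^_) (toℕ-Next nx))) (sym (vp≈vq zero)))
                (det-cong minor-≈)) ⟩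
      term p + (- 1# * (- 1#) ^ toℕ p) * v p zero * det (minor p)
        ≈⟨ solve 3 (λ s x d → s :* x :* d :+ (:- con (ℤ.+ 1) :* s) :* x :* d := con (ℤ.+ 0)) refl
             ((- 1#) ^ toℕ p) (v p zero) (det (minor p)) ⟩
      0# ∎

  module _ {m : ℕ} where

    fix-first : ∀ {k} {F : Matrix (suc k) m → Carrier} → Alternating F →
                ∀ x → Alternating (λ u → F (x ∷ u))
    fix-first alt x .cong e = alt .cong λ { zero j → refl ; (suc i) j → e i j }
    fix-first alt x .linear p a hp hv hw = alt .linear (suc p) a hp
      (λ { zero _ j → refl ; (suc i) i≢ j → hv i (i≢ ∘ ≡.cong suc) j })
      (λ { zero _ j → refl ; (suc i) i≢ j → hw i (i≢ ∘ ≡.cong suc) j })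
    fix-first alt x .alternating nx = alt .alternating (there nx)

    precompose : ∀ {k m′} {F : Matrix k m → Carrier} → Alternating F →
                 (L : Vector Carrier m′ → Vector Carrier m) →
                 (∀ {x y} → (∀ j → x j ≈ y j) → ∀ j → L x j ≈ L y j) →
                 (∀ {x y z} a → (∀ j → x j ≈ a * y j + z j) → ∀ j → L x j ≈ a * L y j + L z j) →
                 Alternating (λ u → F (λ i → L (u i)))
    precompose alt L L-cong L-linear .cong e = alt .cong λ i → L-cong (e i)
    precompose alt L L-cong L-linear .linear p a hp hv hw = alt .linear p a (L-linear a hp)
      (λ i i≢ → L-cong (hv i i≢)) (λ i i≢ → L-cong (hw i i≢))
    precompose alt L L-cong L-linear .alternating nx e = alt .alternating nx (L-cong e)

    -- A zero slot equals 1 times itself plus itself, so linearity doubles the value of `F`.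
    zero-slot : ∀ {k} {F : Matrix k m → Carrier} → Alternating F → ∀ p {v} → (∀ j → v p j ≈ 0#) → F v ≈ 0#
    zero-slot alt p {v} e = x≈x+x⇒x≈0 (trans
      (alt .linear p 1# {v} {v} {v}
        (λ j → trans (e j) (sym (trans (+-cong (trans (*-identityˡ _) (e j)) (e j)) (+-identityˡ _))))
        (λ _ _ _ → refl) (λ _ _ _ → refl))
      (+-congʳ (*-identityˡ _)))

    linear-first : ∀ {k} {F : Matrix (suc k) m → Carrier} → Alternating F →
                   ∀ a {x y z} u → (∀ j → x j ≈ a * y j + z j) →
                   F (x ∷ u) ≈ a * F (y ∷ u) + F (z ∷ u)
    linear-first alt a u e = alt .linear zero a e
      (λ { zero i≢ → ⊥-elim (i≢ ≡.refl) ; (suc i) _ j → refl })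
      (λ { zero i≢ → ⊥-elim (i≢ ≡.refl) ; (suc i) _ j → refl })

    combination-first : ∀ {k} {F : Matrix (suc k) m → Carrier} → Alternating F →
                        ∀ {n} (c : Vector Carrier n) (A : Matrix n m) u →
                        F (combination c A ∷ u) ≈ sum (λ i → c i * F (A i ∷ u))
    combination-first alt {zero}  c A u = zero-slot alt zero (λ _ → refl)
    combination-first alt {suc n} c A u =
      trans (linear-first alt (c zero) u (λ j → refl)) (+-congˡ (combination-first alt (c ∘ suc) (A ∘ suc) u))

    swap : ∀ {k} {F : Matrix (suc (suc k)) m → Carrier} → Alternating F →
           ∀ x y u → F (x ∷ y ∷ u) ≈ - F (y ∷ x ∷ u)
    swap {F = F} alt x y u = begin
      F (x ∷ y ∷ u)
        ≈⟨ solve 2 (λ a b → a := ((con (ℤ.+ 0) :+ a) :+ (b :+ con (ℤ.+ 0))) :- b) refl _ (F (y ∷ x ∷ u)) ⟩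
      ((0# + F (x ∷ y ∷ u)) + (F (y ∷ x ∷ u) + 0#)) - F (y ∷ x ∷ u)
        ≈⟨ +-congʳ (+-cong (+-congʳ (same x)) (+-congˡ (same y))) ⟨
      ((F (x ∷ x ∷ u) + F (x ∷ y ∷ u)) + (F (y ∷ x ∷ u) + F (y ∷ y ∷ u))) - F (y ∷ x ∷ u)
        ≈⟨ +-congʳ (trans (splitˡ x+y) (+-cong (splitʳ x) (splitʳ y))) ⟨
      F (x+y ∷ x+y ∷ u) - F (y ∷ x ∷ u)
        ≈⟨ x≈0⇒x+y≈y (same x+y) ⟩
      - F (y ∷ x ∷ u) ∎
      where
      x+y : Vector Carrier m
      x+y j = x j + y j
      same : ∀ z → F (z ∷ z ∷ u) ≈ 0#
      same z = alt .alternating here (λ j → refl)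
      splitˡ : ∀ z → F (x+y ∷ z ∷ u) ≈ F (x ∷ z ∷ u) + F (y ∷ z ∷ u)
      splitˡ z = trans (linear-first alt 1# (z ∷ u) (λ j → +-congʳ (sym (*-identityˡ _))))
              (+-congʳ (*-identityˡ _))
      splitʳ : ∀ z → F (z ∷ x+y ∷ u) ≈ F (z ∷ x ∷ u) + F (z ∷ y ∷ u)
      splitʳ z = trans (linear-first (fix-first alt z) 1# u (λ j → +-congʳ (sym (*-identityˡ _))))
              (+-congʳ (*-identityˡ _))

    -- Slot `p` reaches the front by `toℕ p` exchanges of neighbours.
    insertAt-sign : ∀ {k} {F : Matrix (suc k) m → Carrier} → Alternating F →
                    ∀ u p x → F (insertAt u p x) ≈ (- 1#) ^ toℕ p * F (x ∷ u)
    insertAt-sign {k} alt u zero x = trans (alt .cong λ { zero j → refl ; (suc i) j → refl })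
            (sym (*-identityˡ _))
    insertAt-sign {suc k} {F} alt u (suc p) x = begin
      F (insertAt u (suc p) x)
        ≈⟨ alt .cong (λ { zero j → refl ; (suc i) j → refl }) ⟩
      F (u zero ∷ insertAt (u ∘ suc) p x)
        ≈⟨ insertAt-sign (fix-first alt (u zero)) (u ∘ suc) p x ⟩
      (- 1#) ^ toℕ p * F (u zero ∷ x ∷ (u ∘ suc))
        ≈⟨ *-congˡ (swap alt _ _ _) ⟩
      (- 1#) ^ toℕ p * - F (x ∷ u zero ∷ (u ∘ suc))
        ≈⟨ solve 2 (λ s f → s :* (:- f) := (:- con (ℤ.+ 1) :* s) :* f) refl _ _ ⟩
      (- 1# * (- 1#) ^ toℕ p) * F (x ∷ u zero ∷ (u ∘ suc))
        ≈⟨ *-congˡ (alt .cong λ { zero j → refl ; (suc zero) j → refl ; (suc (suc i)) j → refl }) ⟩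
      (- 1# * (- 1#) ^ toℕ p) * F (x ∷ u) ∎

    first-repeated : ∀ {k} {F : Matrix (suc k) m → Carrier} → Alternating F →
                     ∀ x u q → (∀ j → x j ≈ u q j) → F (x ∷ u) ≈ 0#
    first-repeated alt x u zero    e = alt .alternating here e
    first-repeated {suc (suc k)} {F} alt x u (suc q) e = begin
      F (x ∷ u)                          ≈⟨ alt .cong
              (λ { zero j → refl ; (suc zero) j → refl ; (suc (suc i)) j → refl }) ⟩
      F (x ∷ u zero ∷ (u ∘ suc))         ≈⟨ swap alt _ _ _ ⟩
      - F (u zero ∷ x ∷ (u ∘ suc))       ≈⟨ -‿cong (first-repeated (fix-first alt (u zero)) x (u ∘ suc) q e) ⟩
      - 0#                               ≈⟨ -0#≈0# ⟩
      0# ∎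

    repeated : ∀ {k} {F : Matrix k m → Carrier} → Alternating F →
               ∀ {v p q} → p ≢ q → (∀ j → v p j ≈ v q j) → F v ≈ 0#
    repeated {suc k} {F} alt {v} {zero}  {zero}  p≢q e = ⊥-elim (p≢q ≡.refl)
    repeated {suc k} {F} alt {v} {zero}  {suc q} p≢q e =
      trans (alt .cong λ { zero j → refl ; (suc i) j → refl }) (first-repeated alt (v zero) (v ∘ suc) q e)
    repeated {suc k} {F} alt {v} {suc p} {zero}  p≢q e =
      trans (alt .cong λ { zero j → refl ; (suc i) j → refl })
              (first-repeated alt (v zero) (v ∘ suc) p (sym ∘ e))
    repeated {suc k} {F} alt {v} {suc p} {suc q} p≢q e =
      trans (alt .cong λ { zero j → refl ; (suc i) j → refl })
        (repeated (fix-first alt (v zero)) {v ∘ suc} {p} {q} (p≢q ∘ ≡.cong suc) e)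

    -- Row elimination: each added multiple of `x` contributes only a term with `x` in two slots. In
    -- `alternating-unique` it empties a whole column.
    clear : ∀ {k} {F : Matrix (suc k) m → Carrier} → Alternating F →
            ∀ x u (c : Vector Carrier k) → F (x ∷ u) ≈ F (x ∷ λ i j → c i * x j + u i j)
    clear {zero}  {F} alt x u c = alt .cong λ { zero j → refl }
    clear {suc k} {F} alt x u c = begin
      F (x ∷ u)
        ≈⟨ alt .cong (λ { zero j → refl ; (suc zero) j → refl ; (suc (suc i)) j → refl }) ⟩
      F (x ∷ u zero ∷ (u ∘ suc))
        ≈⟨ swap alt _ _ _ ⟩
      - F (u zero ∷ x ∷ (u ∘ suc))
        ≈⟨ -‿cong (clear (fix-first alt (u zero)) x (u ∘ suc) (c ∘ suc)) ⟩
      - F (u zero ∷ x ∷ u″)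
        ≈⟨ swap alt _ _ _ ⟨
      F (x ∷ u zero ∷ u″)
        ≈⟨ x≈0⇒x+y≈y (trans (*-congˡ (alt .alternating here (λ j → refl))) (zeroʳ _)) ⟨
      c zero * F (x ∷ x ∷ u″) + F (x ∷ u zero ∷ u″)
        ≈⟨ linear-first (fix-first alt x) (c zero) u″ (λ j → refl) ⟨
      F (x ∷ (λ j → c zero * x j + u zero j) ∷ u″)
        ≈⟨ alt .cong (λ { zero j → refl ; (suc zero) j → refl ; (suc (suc i)) j → refl }) ⟩
      F (x ∷ λ i j → c i * x j + u i j) ∎
      where
      u″ : Matrix k m
      u″ i j = c (suc i) * x j + u (suc i) j

  -- Determinants

  sgn-square : ∀ k → (- 1#) ^ k * (- 1#) ^ k ≈ 1#
  sgn-square zero    = *-identityˡ 1#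
  sgn-square (suc k) = trans
    (solve 1 (λ s → (:- con (ℤ.+ 1) :* s) :* (:- con (ℤ.+ 1) :* s) := s :* s) refl ((- 1#) ^ k))
    (sgn-square k)

  identity-≡ : ∀ {n} (i : Fin n) → identity i i ≈ 1#
  identity-≡ zero    = refl
  identity-≡ (suc i) = identity-≡ i

  identity-≢ : ∀ {n} {i j : Fin n} → i ≢ j → identity i j ≈ 0#
  identity-≢ {i = zero}  {zero}  i≢j = ⊥-elim (i≢j ≡.refl)
  identity-≢ {i = zero}  {suc j} i≢j = refl
  identity-≢ {i = suc i} {zero}  i≢j = refl
  identity-≢ {i = suc i} {suc j} i≢j = identity-≢ (i≢j ∘ ≡.cong suc)

  identity-comm : ∀ {n} (i j : Fin n) → identity i j ≈ identity j i
  identity-comm zero    zero    = refl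
  identity-comm zero    (suc j) = refl
  identity-comm (suc i) zero    = refl
  identity-comm (suc i) (suc j) = identity-comm i j

  identity-punchIn : ∀ {n} (p : Fin (suc n)) (i j : Fin n) →
                     identity (punchIn p i) (punchIn p j) ≈ identity i j
  identity-punchIn zero    i       j       = refl
  identity-punchIn (suc p) zero    zero    = refl
  identity-punchIn (suc p) zero    (suc j) = refl
  identity-punchIn (suc p) (suc i) zero    = refl
  identity-punchIn (suc p) (suc i) (suc j) = identity-punchIn p i j

  data Around {n} (p : Fin (suc n)) : Fin (suc n) → Set where
    at   : Around p p
    away : ∀ i → Around p (punchIn p i)

  around : ∀ {n} (p i : Fin (suc n)) → Around p i
  around p i with p Finₚ.≟ i
  ... | yes ≡.refl = at
  ... | no  p≢i    = ≡.subst (Around p) (Finₚ.punchIn-punchOut p≢i) (away (punchOut p≢i))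

  insertAt-at : ∀ {a} {A : Set a} {n} (xs : Vector A n) p x → insertAt xs p x p ≡ x
  insertAt-at xs p x = VFₚ.insertAt-lookup xs p x

  insertAt-away : ∀ {a} {A : Set a} {n} (xs : Vector A n) p x i → insertAt xs p x (punchIn p i) ≡ xs i
  insertAt-away xs p x i = VFₚ.insertAt-punchIn xs p x i

  det-identity : ∀ n → det (identity {n}) ≈ 1#
  det-identity zero    = refl
  det-identity (suc n) = begin
    1# * 1# * det (identity {n}) + sum {n} (λ j → (- 1#) ^ suc (toℕ j) * 0# * rest j)
      ≈⟨ +-cong (*-cong (*-identityˡ 1#) (det-identity n))
                (sum-zero {n} _ λ j → trans (*-congʳ {rest j} (zeroʳ ((- 1#) ^ suc (toℕ j))))
                        (zeroˡ (rest j))) ⟩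
    1# * 1# + 0#
      ≈⟨ trans (+-identityʳ _) (*-identityˡ 1#) ⟩
    1# ∎
    where
    rest : Fin n → Carrier
    rest j = det (λ i → removeAt (identity (suc i)) (suc j))

  -- The first row is expanded into unit vectors e_j. For each j, elimination empties column j of
  -- the other rows, and what remains is an alternating form `G j` of a matrix one size smaller, to
  -- which induction applies. The sum over j is then the defining expansion of `det`.
  alternating-unique : ∀ {n} {F : Matrix n n → Carrier} → Alternating F → ∀ A → F A ≈ det A * F identity
  alternating-unique {zero}  alt A = trans (alt .cong (λ ())) (sym (*-identityˡ _))
  alternating-unique {suc n} {F} alt A = begin
    F A
      ≈⟨ alt .cong (λ { zero j → sym (combination-identity (A zero) identity j j (λ _ → refl)) ; (suc i) j →
              refl }) ⟩
    F (combination (A zero) identity ∷ rest)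
      ≈⟨ combination-first alt (A zero) identity rest ⟩
    sum (λ j → A zero j * F (identity j ∷ rest))
      ≈⟨ sum-cong-≋ {suc n} (λ j → trans (*-congˡ (expand j))
           (solve 4 (λ a d s f → a :* (d :* (s :* f)) := s :* a :* d :* f) refl (A zero j) _
                   ((- 1#) ^ toℕ j) _)) ⟩
    sum (λ j → (- 1#) ^ toℕ j * A zero j * det (λ i → removeAt (rest i) j) * F identity)
      ≈⟨ *-distribʳ-sum {suc n} (F identity) (λ j → (- 1#) ^ toℕ j * A zero j * det
              (λ i → removeAt (rest i) j)) ⟨
    det A * F identity ∎
    where
    rest : Matrix n (suc n)
    rest = A ∘ suc
    clear-entry : ∀ j i l → - rest i j * identity j l + rest i l ≈ insertAt (removeAt (rest i) j) j 0# l
    clear-entry j i l with around j l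
    ... | at     = begin
      - rest i j * identity j j + rest i j ≈⟨ +-congʳ (*-congˡ (identity-≡ j)) ⟩
      - rest i j * 1# + rest i j           ≈⟨ solve 1 (λ x → :- x :* con (ℤ.+ 1) :+ x := con (ℤ.+ 0)) refl
              (rest i j) ⟩
      0#                                   ≡⟨ insertAt-at (removeAt (rest i) j) j 0# ⟨
      insertAt (removeAt (rest i) j) j 0# j ∎
    ... | away l′ = begin
      - rest i j * identity j (punchIn j l′) + rest i (punchIn j l′)
        ≈⟨ x≈0⇒x+y≈y (trans (*-congˡ (identity-≢ (Finₚ.punchInᵢ≢i j l′ ∘ ≡.sym))) (zeroʳ _)) ⟩
      rest i (punchIn j l′)
        ≡⟨ insertAt-away (removeAt (rest i) j) j 0# l′ ⟨
      insertAt (removeAt (rest i) j) j 0# (punchIn j l′) ∎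
    pad : Fin (suc n) → Vector Carrier n → Vector Carrier (suc n)
    pad j x = insertAt x j 0#
    pad-cong : ∀ j {x y} → (∀ l → x l ≈ y l) → ∀ l → pad j x l ≈ pad j y l
    pad-cong j {x} {y} e l with around j l
    ... | at      = reflexive (≡.trans (insertAt-at x j 0#) (≡.sym (insertAt-at y j 0#)))
    ... | away l′ = trans (reflexive (insertAt-away x j 0# l′))
            (trans (e l′) (reflexive (≡.sym (insertAt-away y j 0# l′))))
    pad-linear : ∀ j {x y z} a → (∀ l → x l ≈ a * y l + z l) → ∀ l → pad j x l ≈ a * pad j y l + pad j z l
    pad-linear j {x} {y} {z} a e l with around j l
    ... | at      = trans (reflexive (insertAt-at x j 0#))
                      (sym (trans (+-cong (trans (*-congˡ (reflexive (insertAt-at y j 0#))) (zeroʳ a))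
                              (reflexive (insertAt-at z j 0#))) (+-identityˡ _)))
    ... | away l′ = trans (reflexive (insertAt-away x j 0# l′)) (trans (e l′)
                      (sym (+-cong (*-congˡ (reflexive (insertAt-away y j 0# l′)))
                              (reflexive (insertAt-away z j 0# l′)))))
    G : Fin (suc n) → Matrix n n → Carrier
    G j u = F (identity j ∷ λ i → pad j (u i))
    -- Carrying `identity j` from the front back to its place j produces the cofactor sign.
    G-identity : ∀ j → G j identity ≈ (- 1#) ^ toℕ j * F identity
    G-identity j = begin
      G j identity
        ≈⟨ alt .cong (λ { zero l → refl ; (suc i) l → entry i l }) ⟩
      F (identity j ∷ λ i → identity (punchIn j i))
        ≈⟨ *-identityˡ _ ⟨
      1# * F (identity j ∷ λ i → identity (punchIn j i))
        ≈⟨ *-congʳ (sgn-square (toℕ j)) ⟨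
      (- 1#) ^ toℕ j * (- 1#) ^ toℕ j * F (identity j ∷ λ i → identity (punchIn j i))
        ≈⟨ *-assoc _ _ _ ⟩
      (- 1#) ^ toℕ j * ((- 1#) ^ toℕ j * F (identity j ∷ λ i → identity (punchIn j i)))
        ≈⟨ *-congˡ (insertAt-sign alt (λ i → identity (punchIn j i)) j (identity j)) ⟨
      (- 1#) ^ toℕ j * F (insertAt (λ i → identity (punchIn j i)) j (identity j))
        ≈⟨ *-congˡ (alt .cong whole) ⟩
      (- 1#) ^ toℕ j * F identity ∎
      where
      entry : ∀ i l → pad j (identity i) l ≈ identity (punchIn j i) l
      entry i l with around j l
      ... | at      = trans (reflexive (insertAt-at (identity i) j 0#)) (sym (identity-≢ (Finₚ.punchInᵢ≢i j i)))
      ... | away l′ = trans (reflexive (insertAt-away (identity i) j 0# l′)) (sym (identity-punchIn j i l′))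
      whole : ∀ i l → insertAt (λ i → identity (punchIn j i)) j (identity j) i l ≈ identity i l
      whole i l with around j i
      ... | at      = reflexive (≡.cong (λ r → r l) (insertAt-at (λ i → identity (punchIn j i)) j (identity j)))
      ... | away i′ = reflexive (≡.cong (λ r → r l)
              (insertAt-away (λ i → identity (punchIn j i)) j (identity j) i′))
    expand : ∀ j → F (identity j ∷ rest) ≈ det (λ i → removeAt (rest i) j) * ((- 1#) ^ toℕ j * F identity)
    expand j = begin
      F (identity j ∷ rest)
        ≈⟨ clear alt (identity j) rest (λ i → - rest i j) ⟩
      F (identity j ∷ λ i l → - rest i j * identity j l + rest i l)
        ≈⟨ alt .cong (λ { zero l → refl ; (suc i) l → clear-entry j i l }) ⟩
      G j (λ i → removeAt (rest i) j)
        ≈⟨ alternating-unique (precompose (fix-first alt (identity j)) (pad j) (pad-cong j) (pad-linear j))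
                (λ i → removeAt (rest i) j) ⟩
      det (λ i → removeAt (rest i) j) * G j identity
        ≈⟨ *-congˡ (G-identity j) ⟩
      det (λ i → removeAt (rest i) j) * ((- 1#) ^ toℕ j * F identity) ∎

  det-transpose : ∀ {n} (A : Matrix n n) → det (λ i j → A j i) ≈ det A
  det-transpose {n} A = begin
    det (λ i j → A j i)                        ≈⟨ alternating-unique (transpose-det-alternating n) A ⟩
    det A * det (λ i j → identity {n} j i)     ≈⟨ *-congˡ
            (trans (det-cong (λ i j → identity-comm {n} j i)) (det-identity n)) ⟩
    det A * 1#                                 ≈⟨ *-identityʳ _ ⟩
    det A ∎

  det-alternating : ∀ {n} → Alternating {n} {n} det
  det-alternating .cong = det-cong
  det-alternating {n} .linear p a {u} {v} {w} hp hv hw = begin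
    det u                                             ≈⟨ det-transpose u ⟨
    det (λ i j → u j i)                               ≈⟨ transpose-det-alternating n .linear p a hp hv hw ⟩
    a * det (λ i j → v j i) + det (λ i j → w j i)     ≈⟨ +-cong (*-congˡ (det-transpose v)) (det-transpose w) ⟩
    a * det v + det w ∎
  det-alternating {n} .alternating nx {v} e = trans (sym (det-transpose v))
          (transpose-det-alternating n .alternating nx e)

  -- Matrix products, Cramer's rule and inverses

  combination-cong : ∀ {m n} {c d : Vector Carrier m} {A B : Matrix m n} →
                     (∀ i → c i ≈ d i) → (∀ i j → A i j ≈ B i j) →
                     ∀ j → combination c A j ≈ combination d B j
  combination-cong {m} c≈d A≈B j = sum-cong-≋ {m} λ i → *-cong (c≈d i) (A≈B i j)

  combination-linear : ∀ {m n} (B : Matrix m n) {x y z : Vector Carrier m} a →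
                       (∀ i → x i ≈ a * y i + z i) →
                       ∀ j → combination x B j ≈ a * combination y B j + combination z B j
  combination-linear {m} B {x} {y} {z} a e j = begin
    sum (λ i → x i * B i j)
      ≈⟨ sum-cong-≋ {m} (λ i → trans (*-congʳ (e i))
              (solve 4 (λ a y z b → (a :* y :+ z) :* b := a :* (y :* b) :+ z :* b) refl a (y i) (z i)
                      (B i j))) ⟩
    sum (λ i → a * (y i * B i j) + z i * B i j)
      ≈⟨ ∑-distrib-+ {m} (λ i → a * (y i * B i j)) (λ i → z i * B i j) ⟩
    sum (λ i → a * (y i * B i j)) + combination z B j
      ≈⟨ +-congʳ (*-distribˡ-sum {m} a (λ i → y i * B i j)) ⟨
    a * combination y B j + combination z B j ∎

  -- In `C` the left side is an alternating form whose value at the identity is `det B`.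
  det-* : ∀ {n} (C B : Matrix n n) → det (λ i → combination (C i) B) ≈ det C * det B
  det-* C B = trans
    (alternating-unique
      (precompose det-alternating (λ c → combination c B)
        (λ e → combination-cong {B = B} e (λ _ _ → refl)) (combination-linear B)) C)
    (*-congˡ (det-cong (λ i j → sym (row-combination B i j))))

  combination-assoc : ∀ {k m n} (c : Vector Carrier k) (A : Matrix k m) (B : Matrix m n) l →
                      combination (combination c A) B l ≈ combination c (λ i → combination (A i) B) l
  combination-assoc {k} {m} c A B l = begin
    sum (λ j → sum (λ i → c i * A i j) * B j l)
      ≈⟨ sum-cong-≋ {m} (λ j → trans (*-distribʳ-sum {k} (B j l) (λ i → c i * A i j))
              (sum-cong-≋ {k} (λ i → *-assoc _ _ _))) ⟩
    sum (λ j → sum (λ i → c i * (A i j * B j l)))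
      ≈⟨ ∑-comm {m} {k} (λ j i → c i * (A i j * B j l)) ⟩
    sum (λ i → sum (λ j → c i * (A i j * B j l)))
      ≈⟨ sum-cong-≋ {k} (λ i → *-distribˡ-sum {m} (c i) (λ j → A i j * B j l)) ⟨
    combination c (λ i → combination (A i) B) l ∎

  -- det P times the solution of P y = q.
  cramer : ∀ {n} → Matrix n n → Vector Carrier n → Vector Carrier n
  cramer {suc n} P q i = (- 1#) ^ toℕ i * det (λ b → q b ∷ removeAt (P b) i)

  -- Expanding along row 0 the (n+1)-square matrix (q | P) whose row a is repeated on top.
  cramer-solves : ∀ {n} (P : Matrix n n) q a → sum (λ i → P a i * cramer P q i) ≈ det P * q a
  cramer-solves {suc n} P q a = begin
    sum (λ i → P a i * cramer P q i)
      ≈⟨ solve 2 (λ x s → s := x :- (con (ℤ.+ 1) :* x :+ :- con (ℤ.+ 1) :* s)) refl (q a * det P) _ ⟩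
    q a * det P - (1# * (q a * det P) + - 1# * sum (λ i → P a i * cramer P q i))
      ≈⟨ +-congˡ (-‿cong (+-cong (*-assoc _ _ _)
              (trans (sum-cong-≋ {suc n} λ i → term i)
                      (sym (*-distribˡ-sum {suc n} (- 1#) (λ i → P a i * cramer P q i)))))) ⟨
    q a * det P - det T
      ≈⟨ +-congˡ (-‿cong (first-repeated det-alternating (q a ∷ P a) (λ b → q b ∷ P b) a (λ j → refl))) ⟩
    q a * det P - 0#
      ≈⟨ solve 2 (λ x y → x :* y :- con (ℤ.+ 0) := y :* x) refl (q a) (det P) ⟩
    det P * q a ∎
    where
    T : Matrix (suc (suc n)) (suc (suc n))
    T = (q a ∷ P a) ∷ λ b → q b ∷ P b
    term : ∀ i → (- 1#) ^ suc (toℕ i) * P a i * det (λ b → removeAt (q b ∷ P b) (suc i)) ≈ - 1# *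
            (P a i * cramer P q i)
    term i = trans
      (*-congˡ (det-cong {suc n} {λ b → removeAt (q b ∷ P b) (suc i)} {λ b → q b ∷ removeAt (P b) i} λ
              { b zero → refl ; b (suc j) → refl }))
      (solve 3 (λ s p d → :- con (ℤ.+ 1) :* s :* p :* d := :- con (ℤ.+ 1) :* (p :* (s :* d))) refl
              ((- 1#) ^ toℕ i) (P a i) _)

  right-inverse : ∀ {n} (P : Matrix n n) → ¬ det P ≈ 0# → ∃[ D ] (∀ i j → combination (P i) D j ≈ identity i j)
  right-inverse {n} P det≉0 =
    let d , e = inverse (det P) det≉0 in
    (λ i j → d * cramer P (λ a → identity a j) i) , λ i j → begin
      sum (λ l → P i l * (d * cramer P (λ a → identity a j) l))
        ≈⟨ sum-cong-≋ {n} (λ l → solve 3 (λ p d c → p :* (d :* c) := d :* (p :* c)) refl (P i l) d _) ⟩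
      sum (λ l → d * (P i l * cramer P (λ a → identity a j) l))
        ≈⟨ *-distribˡ-sum {n} d _ ⟨
      d * sum (λ l → P i l * cramer P (λ a → identity a j) l)
        ≈⟨ *-congˡ (cramer-solves P _ i) ⟩
      d * (det P * identity i j)
        ≈⟨ solve 3 (λ d p x → d :* (p :* x) := (p :* d) :* x) refl d (det P) _ ⟩
      (det P * d) * identity i j
        ≈⟨ trans (*-congʳ e) (*-identityˡ _) ⟩
      identity i j ∎

  left-inverse : ∀ {n} (P : Matrix n n) → ¬ det P ≈ 0# → ∃[ D ] (∀ i j → combination (D i) P j ≈ identity i j)
  left-inverse {n} P det≉0 =
    let D , e = right-inverse (λ i j → P j i) (λ z → det≉0 (trans (sym (det-transpose P)) z))
    in (λ i j → D j i) , λ i j →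
         trans (sum-cong-≋ {n} (λ l → *-comm _ _)) (trans (e j i) (identity-comm j i))

  minor : ∀ {m n} → Matrix m n → (Fin m → Fin n) → Carrier
  minor A J = det (λ a b → A a (J b))

  minor-cong : ∀ {m n} (A : Matrix m n) {J K : Fin m → Fin n} → (∀ b → J b ≡ K b) → minor A J ≈ minor A K
  minor-cong A e = det-cong λ a b → reflexive (≡.cong (A a) (e b))

  -- With D a right inverse of the square submatrix P on the columns `J`, a relation c A = 0 gives c
  -- = c P D = 0.
  minor≉0⇒independent : ∀ {m n} (A : Matrix m n) J → ¬ minor A J ≈ 0# → LinearlyIndependent A
  minor≉0⇒independent {m} A J minor≉0 c c·A≈0 i = begin
    c i
      ≈⟨ combination-identity c identity i i (λ _ → refl) ⟨
    combination c identity i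
      ≈⟨ combination-cong {c = c} (λ _ → refl) (proj₂ D) i ⟨
    combination c (λ a → combination (λ b → A a (J b)) (proj₁ D)) i
      ≈⟨ combination-assoc c (λ a b → A a (J b)) (proj₁ D) i ⟨
    combination (combination c (λ a b → A a (J b))) (proj₁ D) i
      ≈⟨ sum-zero {m} _ (λ b → trans (*-congʳ (c·A≈0 (J b))) (zeroˡ _)) ⟩
    0# ∎
    where
    D : ∃[ D ] (∀ i j → combination (λ b → A i (J b)) D j ≈ identity i j)
    D = right-inverse (λ a b → A a (J b)) minor≉0

  minor-* : ∀ {k m} (C : Matrix k k) (B : Matrix k m) J → minor
          (λ i → combination (C i) B) J ≈ det C * minor B J
  minor-* C B J = det-* C (λ a b → B a (J b))

  -- Ordered fields

  ≤-cong : ∀ {x x′ y y′} → x ≈ x′ → y ≈ y′ → x ≤ y → x′ ≤ y′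
  ≤-cong x≈x′ y≈y′ x≤y = ≤-trans (≤-reflexive (sym x≈x′)) (≤-trans x≤y (≤-reflexive y≈y′))

  _≈?_ : ∀ x y → Dec (x ≈ y)
  _≈?_ = IsDecTotalOrder._≟_ isDecTotalOrder

  x≤y⇒0≤y-x : ∀ {x y} → x ≤ y → 0# ≤ y - x
  x≤y⇒0≤y-x {x} x≤y = ≤-cong (-‿inverseʳ x) refl (+-monoˡ-≤ (- x) x≤y)

  0≤y-x⇒x≤y : ∀ {x y} → 0# ≤ y - x → x ≤ y
  0≤y-x⇒x≤y {x} {y} 0≤y-x = ≤-cong (+-identityˡ x)
    (solve 2 (λ x y → (y :- x) :+ x := y) refl x y) (+-monoˡ-≤ x 0≤y-x)

  +-mono-≤ : ∀ {x y u v} → x ≤ y → u ≤ v → x + u ≤ y + v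
  +-mono-≤ {x} {y} {u} {v} x≤y u≤v =
    ≤-trans (+-monoˡ-≤ u x≤y) (≤-cong (+-comm u y) (+-comm v y) (+-monoˡ-≤ y u≤v))

  neg-mono-≤ : ∀ {x y} → x ≤ y → - y ≤ - x
  neg-mono-≤ {x} {y} x≤y =
    0≤y-x⇒x≤y (≤-cong refl (solve 2 (λ x y → y :- x := (:- x) :- (:- y)) refl x y) (x≤y⇒0≤y-x x≤y))

  +-nonNeg : ∀ {x y} → 0# ≤ x → 0# ≤ y → 0# ≤ x + y
  +-nonNeg 0≤x 0≤y = ≤-cong (+-identityˡ 0#) refl (+-mono-≤ 0≤x 0≤y)

  ≤0⇒0≤- : ∀ {x} → x ≤ 0# → 0# ≤ - x
  ≤0⇒0≤- x≤0 = ≤-cong -0#≈0# refl (neg-mono-≤ x≤0)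

  0≤x² : ∀ x → 0# ≤ x * x
  0≤x² x with total 0# x
  ... | inj₁ 0≤x = *-nonNeg 0≤x 0≤x
  ... | inj₂ x≤0 = ≤-cong refl (solve 1 (λ x → :- x :* :- x := x :* x) refl x)
          (*-nonNeg (≤0⇒0≤- x≤0) (≤0⇒0≤- x≤0))

  0≤1 : 0# ≤ 1#
  0≤1 = ≤-cong refl (*-identityˡ 1#) (0≤x² 1#)

  0<1 : 0# < 1#
  0<1 = 0≤1 , 0≉1

  *-monoˡ-≤ : ∀ {z x y} → 0# ≤ z → x ≤ y → z * x ≤ z * y
  *-monoˡ-≤ {z} {x} {y} 0≤z x≤y = 0≤y-x⇒x≤y
    (≤-cong refl (solve 3 (λ z x y → z :* (y :- x) := z :* y :- z :* x) refl z x y)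
            (*-nonNeg 0≤z (x≤y⇒0≤y-x x≤y)))

  x*y≈0⇒y≈0 : ∀ {x y} → ¬ x ≈ 0# → x * y ≈ 0# → y ≈ 0#
  x*y≈0⇒y≈0 {x} {y} x≉0 e = let u , xu≈1 = inverse x x≉0 in begin
    y            ≈⟨ *-identityˡ y ⟨
    1# * y       ≈⟨ *-congʳ xu≈1 ⟨
    (x * u) * y  ≈⟨ solve 3 (λ x u y → (x :* u) :* y := u :* (x :* y)) refl x u y ⟩
    u * (x * y)  ≈⟨ trans (*-congˡ e) (zeroʳ u) ⟩
    0# ∎

  *-pos : ∀ {x y} → 0# < x → 0# < y → 0# < x * y
  *-pos (0≤x , 0≉x) (0≤y , 0≉y) =
    *-nonNeg 0≤x 0≤y , λ e → 0≉y (sym (x*y≈0⇒y≈0 (0≉x ∘ sym) (sym e)))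

  *-cancel-nonNeg : ∀ {x y} → 0# < x → 0# ≤ x * y → 0# ≤ y
  *-cancel-nonNeg {x} {y} (0≤x , 0≉x) 0≤xy with total 0# y
  ... | inj₁ 0≤y = 0≤y
  ... | inj₂ y≤0 = ≤-reflexive (sym (x*y≈0⇒y≈0 (0≉x ∘ sym)
      (antisym (≤-cong refl (zeroʳ x) (*-monoˡ-≤ 0≤x y≤0)) 0≤xy)))

  pos⇒≉0 : ∀ {x} → 0# < x → ¬ x ≈ 0#
  pos⇒≉0 (_ , 0≉x) = 0≉x ∘ sym

  inverse-pos : ∀ {x} → 0# < x → ∃[ y ] 0# < y × x * y ≈ 1#
  inverse-pos {x} 0<x = let y , xy≈1 = inverse x (pos⇒≉0 0<x) in
    y , (*-cancel-nonNeg 0<x (≤-cong refl (sym xy≈1) 0≤1) ,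
         λ 0≈y → 0≉1 (trans (sym (zeroʳ x)) (trans (*-congˡ 0≈y) xy≈1))) , xy≈1

  -- Maximal minors of (I ∣ M ′)

  punchIn-fromℕ : ∀ {n} (i : Fin n) → punchIn (fromℕ n) i ≡ inject₁ i
  punchIn-fromℕ zero    = ≡.refl
  punchIn-fromℕ (suc i) = ≡.cong suc (punchIn-fromℕ i)

  punchIn-inject₁-fromℕ : ∀ {n} (p : Fin (suc n)) → punchIn (inject₁ p) (fromℕ n) ≡ fromℕ (suc n)
  punchIn-inject₁-fromℕ zero            = ≡.refl
  punchIn-inject₁-fromℕ {suc n} (suc p) = ≡.cong suc (punchIn-inject₁-fromℕ p)

  punchIn-inject₁ : ∀ {n} (p : Fin (suc n)) (i : Fin n) → punchIn (inject₁ p) (inject₁ i) ≡ inject₁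
          (punchIn p i)
  punchIn-inject₁ zero    i       = ≡.refl
  punchIn-inject₁ (suc p) zero    = ≡.refl
  punchIn-inject₁ (suc p) (suc i) = ≡.cong suc (punchIn-inject₁ p i)

  -- Because of the reversal in the twist, deleting row `p` of the block deletes row `opposite p` of
  -- the underlying matrix.
  opposite-punchIn : ∀ {n} (p : Fin (suc n)) i → opposite (punchIn p i) ≡ punchIn (opposite p) (opposite i)
  opposite-punchIn zero    i       = ≡.sym (punchIn-fromℕ (opposite i))
  opposite-punchIn (suc p) zero    = ≡.sym (punchIn-inject₁-fromℕ (opposite p))
  opposite-punchIn (suc p) (suc i) =
    ≡.trans (≡.cong inject₁ (opposite-punchIn p i)) (≡.sym (punchIn-inject₁ (opposite p) (opposite i)))

  punchIn-< : ∀ {n} (p : Fin (suc n)) i → toℕ i ℕ.< toℕ p → toℕ (punchIn p i) ≡ toℕ i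
  punchIn-< (suc p) zero    _             = ≡.refl
  punchIn-< (suc p) (suc i) (ℕ.s≤s i<p) = ≡.cong suc (punchIn-< p i i<p)

  punchIn-≥ : ∀ {n} (p : Fin (suc n)) i → toℕ p ℕ.≤ toℕ i → punchIn p i ≡ suc i
  punchIn-≥ zero    i       _             = ≡.refl
  punchIn-≥ (suc p) (suc i) (ℕ.s≤s p≤i) = ≡.cong suc (punchIn-≥ p i p≤i)

  opposite-anti-< : ∀ {n} {i j : Fin n} → i Fin.< j → opposite j Fin.< opposite i
  opposite-anti-< {n} {i} {j} i<j = ≡.subst₂ ℕ._<_ (≡.sym (Finₚ.opposite-prop j)) (≡.sym (Finₚ.opposite-prop i))
    (ℕₚ.∸-monoʳ-< {n} (ℕ.s≤s i<j) (Finₚ.toℕ<n j))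

  data Column n {q} : Fin (n ℕ.+ q) → Set where
    left  : ∀ x → Column n (x ↑ˡ q)
    right : ∀ z → Column n (n ↑ʳ z)

  column : ∀ n {q} (y : Fin (n ℕ.+ q)) → Column n y
  column n y with splitAt n y in eq
  ... | inj₁ x = ≡.subst (Column n) (Finₚ.splitAt⁻¹-↑ˡ eq) (left x)
  ... | inj₂ z = ≡.subst (Column n) (Finₚ.splitAt⁻¹-↑ʳ {n} eq) (right z)

  -- [I ∣ M ′] for a rectangular M.
  signReverse : ∀ {n q} → Matrix n q → Matrix n q
  signReverse {n} M i j = (- 1#) ^ (n ℕ.∸ suc (toℕ i)) * M (opposite i) j

  -- Rectangular, since the expansion along unit columns deletes rows of `M` but none of its
  -- columns. For square `M` it is definitionally the matrix spanning `σ M`.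
  block : ∀ {n q} → Matrix n q → Matrix n (n ℕ.+ q)
  block M i = identity i ++ signReverse M i

  block-left : ∀ {n q} (M : Matrix n q) i j → block M i (j ↑ˡ q) ≡ identity i j
  block-left M i j = VFₚ.lookup-++ˡ (identity i) (signReverse M i) j

  block-right : ∀ {n q} (M : Matrix n q) i j → block M i (n ↑ʳ j) ≡ signReverse M i j
  block-right M i j = VFₚ.lookup-++ʳ (identity i) (signReverse M i) j

  -- After the reversal the last row of `A` stands first with sign (-1)^n, which is also the cost of
  -- moving it back past the n other rows; induction treats those.
  det-signReverse : ∀ {n} (A : Matrix n n) → det (signReverse A) ≈ det A
  det-signReverse {zero}  A = refl
  det-signReverse {suc n} A = begin
    sum (λ j → (- 1#) ^ toℕ j * ((- 1#) ^ n * A (fromℕ n) j) * det (minors (signReverse upper) j))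
      ≈⟨ sum-cong-≋ {suc n} (λ j → trans (*-congˡ (det-signReverse (minors upper j)))
           (solve 4 (λ s t a d → s :* (t :* a) :* d := t :* (s :* a :* d)) refl ((- 1#) ^ toℕ j)
                   ((- 1#) ^ n) (A (fromℕ n) j) _)) ⟩
    sum (λ j → (- 1#) ^ n * ((- 1#) ^ toℕ j * A (fromℕ n) j * det (minors upper j)))
      ≈⟨ *-distribˡ-sum {suc n} ((- 1#) ^ n) (λ j → (- 1#) ^ toℕ j * A (fromℕ n) j * det (minors upper j)) ⟨
    (- 1#) ^ n * det (A (fromℕ n) ∷ upper)
      ≈⟨ *-congʳ (reflexive (≡.cong ((- 1#) ^_) (Finₚ.toℕ-fromℕ n))) ⟨
    (- 1#) ^ toℕ (fromℕ n) * det (A (fromℕ n) ∷ upper)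
      ≈⟨ insertAt-sign det-alternating upper (fromℕ n) (A (fromℕ n)) ⟨
    det (insertAt upper (fromℕ n) (A (fromℕ n)))
      ≈⟨ det-cong whole ⟩
    det A ∎
    where
    upper : Matrix n (suc n)
    upper i = A (inject₁ i)
    minors : Matrix n (suc n) → Fin (suc n) → Matrix n n
    minors B j i = removeAt (B i) j
    whole : ∀ i j → insertAt upper (fromℕ n) (A (fromℕ n)) i j ≈ A i j
    whole i j with around (fromℕ n) i
    ... | at      = reflexive (≡.cong (λ r → r j) (insertAt-at upper (fromℕ n) (A (fromℕ n))))
    ... | away i′ = reflexive (≡.trans
                      (≡.cong (λ r → r j) (insertAt-away upper (fromℕ n) (A (fromℕ n)) i′))
                      (≡.cong (λ k → A k j) (≡.sym (punchIn-fromℕ i′))))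

  det-negate-rows : ∀ {n} a (A B : Matrix n n) → a ℕ.≤ n →
                    (∀ i → toℕ i ℕ.< a → ∀ j → B i j ≈ - A i j) →
                    (∀ i → a ℕ.≤ toℕ i → ∀ j → B i j ≈ A i j) →
                    det B ≈ (- 1#) ^ a * det A
  det-negate-rows zero    A B _ _ same = trans (det-cong (λ i → same i ℕ.z≤n)) (sym (*-identityˡ _))
  det-negate-rows {suc n} (suc a) A B (ℕ.s≤s a≤n) negated same = begin
    sum (λ j → (- 1#) ^ toℕ j * B zero j * det (minors B j))
      ≈⟨ sum-cong-≋ {suc n} (λ j → trans
           (*-cong (*-congˡ {(- 1#) ^ toℕ j} (negated zero (ℕ.s≤s ℕ.z≤n) j))
             (det-negate-rows a (minors A j) (minors B j) a≤n
               (λ i i<a l → negated (suc i) (ℕ.s≤s i<a) (punchIn j l))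
                       (λ i a≤i l → same (suc i) (ℕ.s≤s a≤i) (punchIn j l))))
           (solve 4 (λ s x t d → s :* (:- x) :* (t :* d) := (:- con (ℤ.+ 1) :* t) :* (s :* x :* d)) refl
             ((- 1#) ^ toℕ j) (A zero j) ((- 1#) ^ a) (det (minors A j)))) ⟩
    sum (λ j → (- 1#) ^ suc a * ((- 1#) ^ toℕ j * A zero j * det (minors A j)))
      ≈⟨ *-distribˡ-sum {suc n} ((- 1#) ^ suc a) (λ j → (- 1#) ^ toℕ j * A zero j * det (minors A j)) ⟨
    (- 1#) ^ suc a * det A ∎
    where
    minors : Matrix (suc n) (suc n) → Fin (suc n) → Matrix n n
    minors C j i = removeAt (C (suc i)) j

  det-unit-row : ∀ {n} (a : Fin (suc n)) (A : Matrix n (suc n)) →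
                 det (identity a ∷ A) ≈ (- 1#) ^ toℕ a * det (λ i → removeAt (A i) a)
  det-unit-row {n} a A = begin
    sum (λ j → (- 1#) ^ toℕ j * identity a j * det (λ i → removeAt (A i) j))
      ≈⟨ sum-cong-≋ {suc n} (λ j → trans (*-congʳ {det (λ i → removeAt (A i) j)}
              (*-congˡ {(- 1#) ^ toℕ j} (identity-comm a j)))
           (solve 3 (λ s e d → s :* e :* d := s :* d :* e) refl ((- 1#) ^ toℕ j) (identity j a)
                   (det (λ i → removeAt (A i) j)))) ⟩
    sum (λ j → (- 1#) ^ toℕ j * det (λ i → removeAt (A i) j) * identity j a)
      ≈⟨ combination-identity (λ j → (- 1#) ^ toℕ j * det (λ i → removeAt (A i) j)) identity a a (λ _ → refl) ⟩
    (- 1#) ^ toℕ a * det (λ i → removeAt (A i) a) ∎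

  -- Rows above a change sign in the twist when row a is dropped, and they meet no column of
  -- the identity block, so their signs cancel the cofactor sign of the column e_a.
  minor-block-∷ : ∀ {n q} (M : Matrix (suc n) q) (a : Fin (suc n)) (J : Fin n → Fin (n ℕ.+ q)) →
                  (∀ b → toℕ a ℕ.≤ toℕ (J b)) →
                  minor (block M) ((a ↑ˡ q) ∷ (suc ∘ J)) ≈ minor (block (λ i → M (punchIn (opposite a) i))) J
  minor-block-∷ {n} {q} M a J a≤J = begin
    minor (block M) ((a ↑ˡ q) ∷ (suc ∘ J))
      ≈⟨ det-transpose (λ i b → block M i (((a ↑ˡ q) ∷ (suc ∘ J)) b)) ⟨
    det (λ b i → block M i (((a ↑ˡ q) ∷ (suc ∘ J)) b))
      ≈⟨ det-cong {suc n} {λ b i → block M i (((a ↑ˡ q) ∷ (suc ∘ J)) b)}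
              {identity a ∷ λ b i → block M i (suc (J b))}
                      (λ { zero i → trans (reflexive (block-left M i a)) (identity-comm i a) ; (suc b) i →
                              refl }) ⟩
    det (identity a ∷ λ b i → block M i (suc (J b)))
      ≈⟨ det-unit-row a (λ b i → block M i (suc (J b))) ⟩
    (- 1#) ^ toℕ a * det (λ b i → block M (punchIn a i) (suc (J b)))
      ≈⟨ *-congˡ (det-transpose (λ i b → block M (punchIn a i) (suc (J b)))) ⟩
    (- 1#) ^ toℕ a * det (λ i b → block M (punchIn a i) (suc (J b)))
      ≈⟨ *-congˡ (det-negate-rows (toℕ a) (λ i b → block M′ i (J b)) (λ i b → block M (punchIn a i) (suc (J b)))
           (ℕ.s≤s⁻¹ (Finₚ.toℕ<n a))
           (λ i i<a b → above i i<a (J b) (a≤J b)) (λ i a≤i b → below i a≤i (J b) (a≤J b))) ⟩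
    (- 1#) ^ toℕ a * ((- 1#) ^ toℕ a * minor (block M′) J)
      ≈⟨ trans (sym (*-assoc _ _ _)) (trans (*-congʳ (sgn-square (toℕ a))) (*-identityˡ _)) ⟩
    minor (block M′) J ∎
    where
    M′ : Matrix n q
    M′ i = M (punchIn (opposite a) i)
    entry : ∀ i z → M (opposite (punchIn a i)) z ≈ M′ (opposite i) z
    entry i z = reflexive (≡.cong (λ k → M k z) (opposite-punchIn a i))
    units : ∀ i x → toℕ a ℕ.≤ toℕ (x ↑ˡ q) → block M (punchIn a i) (suc (x ↑ˡ q)) ≈ block M′ i (x ↑ˡ q)
    units i x a≤x = trans (reflexive (block-left M (punchIn a i) (suc x)))
      (trans (reflexive (≡.cong (identity (punchIn a i))
               (≡.sym (punchIn-≥ a x (≡.subst (toℕ a ℕ.≤_) (Finₚ.toℕ-↑ˡ x q) a≤x)))))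
             (trans (identity-punchIn a i x) (reflexive (≡.sym (block-left M′ i x)))))
    above : ∀ i → toℕ i ℕ.< toℕ a → ∀ y → toℕ a ℕ.≤ toℕ y →
            block M (punchIn a i) (suc y) ≈ - block M′ i y
    above i i<a y a≤y with column n y
    ... | left x =
      trans (units i x a≤y) (trans i≈0 (trans (sym -0#≈0#) (-‿cong (sym i≈0))))
      where
      i≈0 : block M′ i (x ↑ˡ q) ≈ 0#
      i≈0 = trans (reflexive (block-left M′ i x))
              (identity-≢ {i = i} {x} λ { ≡.refl → ℕₚ.<⇒≱ i<a (≡.subst (toℕ a ℕ.≤_) (Finₚ.toℕ-↑ˡ x q) a≤y) })
    ... | right z = begin
      block M (punchIn a i) (suc n ↑ʳ z)
        ≡⟨ block-right M (punchIn a i) z ⟩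
      (- 1#) ^ (n ℕ.∸ toℕ (punchIn a i)) * M (opposite (punchIn a i)) z
        ≈⟨ *-cong (reflexive (≡.cong ((- 1#) ^_) (≡.trans (≡.cong (n ℕ.∸_) (punchIn-< a i i<a))
             (≡.trans (≡.sym (ℕₚ.suc-pred (n ℕ.∸ toℕ i) {{ℕ.>-nonZero (ℕₚ.m<n⇒0<n∸m (Finₚ.toℕ<n i))}}))
                      (≡.cong suc (ℕₚ.pred[m∸n]≡m∸[1+n] n (toℕ i))))))) (entry i z) ⟩
      (- 1# * (- 1#) ^ (n ℕ.∸ suc (toℕ i))) * M′ (opposite i) z
        ≈⟨ solve 2 (λ s x → (:- con (ℤ.+ 1) :* s) :* x := :- (s :* x)) refl ((- 1#) ^ (n ℕ.∸ suc (toℕ i))) _ ⟩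
      - signReverse M′ i z
        ≡⟨ ≡.cong -_ (block-right M′ i z) ⟨
      - block M′ i (n ↑ʳ z) ∎
    below : ∀ i → toℕ a ℕ.≤ toℕ i → ∀ y → toℕ a ℕ.≤ toℕ y →
            block M (punchIn a i) (suc y) ≈ block M′ i y
    below i a≤i y a≤y with column n y
    ... | left x = units i x a≤y
    ... | right z =
      trans (reflexive (block-right M (punchIn a i) z)) (trans
        (*-cong (reflexive (≡.cong (λ k → (- 1#) ^ (n ℕ.∸ toℕ k)) (punchIn-≥ a i a≤i))) (entry i z))
        (reflexive (≡.sym (block-right M′ i z))))

  minor-block-right : ∀ {n q} (M : Matrix n q) (b : Fin n → Fin q) →
                      minor (block M) (λ i → n ↑ʳ b i) ≈ minor M b
  minor-block-right M b = trans (det-cong (λ i j → reflexive (block-right M i (b j))))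
          (det-signReverse (λ i j → M i (b j)))

  ∷-strict : ∀ {k n} {x : Fin n} {J : Fin k → Fin n} → (∀ b → x Fin.< J b) → StrictlyIncreasing J →
          StrictlyIncreasing (x ∷ J)
  ∷-strict x<J J↗ {zero}  {suc j} _             = x<J j
  ∷-strict x<J J↗ {suc i} {suc j} (ℕ.s≤s i<j) = J↗ i<j

  punchIn-strict : ∀ {n} (p : Fin (suc n)) → StrictlyIncreasing (punchIn p)
  punchIn-strict p {i} {j} i<j = ℕₚ.≰⇒> (ℕₚ.<⇒≱ i<j ∘ Finₚ.punchIn-cancel-≤ p j i)

  unsuc : ∀ {k n} (J : Fin k → Fin (suc n)) → StrictlyIncreasing J → (∀ b → 0 ℕ.< toℕ (J b)) →
          ∃[ J′ ] (StrictlyIncreasing {k} {n} J′ × ∀ b → J b ≡ suc (J′ b))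
  unsuc J J↗ 0<J = J′ , (λ i<j → ℕ.s≤s⁻¹ (≡.subst₂ Fin._<_ (eq _) (eq _) (J↗ i<j))) , eq
    where
    0≢J : ∀ b → zero ≢ J b
    0≢J b e = ℕₚ.<⇒≢ (0<J b) (≡.cong toℕ e)
    J′ = λ b → punchOut (0≢J b)
    eq : ∀ b → J b ≡ suc (J′ b)
    eq b = ≡.sym (Finₚ.punchIn-punchOut (0≢J b))

  -- Only the least column of `J` has to be inspected. If it is a unit column, one row of `M` is
  -- dropped, and what remains is still totally nonnegative. Otherwise all of `J` lies in the right
  -- block, and the minor is one of `M` using all rows.
  tnn⇒block-nonNeg : ∀ {n q} (M : Matrix n q) → TotallyNonnegative M → MaximalMinorsNonnegative (block M)
  tnn⇒block-nonNeg {zero}  M M≥0 J J↗ = 0≤1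
  tnn⇒block-nonNeg {suc n} {q} M M≥0 J J↗ = from (column (suc n) (J zero)) ≡.refl
    where
    leftmost : ∀ a → J zero ≡ a ↑ˡ q → 0# ≤ minor (block M) J
    leftmost a J0≡ = ≤-cong refl (sym (begin
        minor (block M) J
          ≈⟨ minor-cong (block M) {J} {(a ↑ˡ q) ∷ (suc ∘ J′)} (λ { zero → J0≡ ; (suc b) → J≡ b }) ⟩
        minor (block M) ((a ↑ˡ q) ∷ (suc ∘ J′))
          ≈⟨ minor-block-∷ M a J′ a≤J′ ⟩
        minor (block M′) J′ ∎))
        (tnn⇒block-nonNeg M′ (λ k I K I↗ K↗ → M≥0 k (punchIn (opposite a) ∘ I) K
                (punchIn-strict (opposite a) ∘ I↗) K↗) J′ J′↗)
      where
      M′ : Matrix n q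
      M′ i = M (punchIn (opposite a) i)
      J0< : ∀ b → toℕ (J zero) ℕ.< toℕ (J (suc b))
      J0< b = J↗ (ℕ.s≤s ℕ.z≤n)
      rest = unsuc (J ∘ suc) (λ i<j → J↗ (ℕ.s≤s i<j)) (λ b → ℕₚ.≤-<-trans ℕ.z≤n (J0< b))
      J′ = proj₁ rest
      J′↗ : StrictlyIncreasing J′
      J′↗ = proj₁ (proj₂ rest)
      J≡ : ∀ b → J (suc b) ≡ suc (J′ b)
      J≡ = proj₂ (proj₂ rest)
      a≤J′ : ∀ b → toℕ a ℕ.≤ toℕ (J′ b)
      a≤J′ b = ℕ.s≤s⁻¹ (≡.subst₂ ℕ._<_ (≡.trans (≡.cong toℕ J0≡) (Finₚ.toℕ-↑ˡ a q)) (≡.cong toℕ (J≡ b)) (J0< b))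
    rightmost : ∀ z → J zero ≡ suc n ↑ʳ z → 0# ≤ minor (block M) J
    rightmost z J0≡ = ≤-cong refl (sym (begin
        minor (block M) J
          ≈⟨ minor-cong (block M) {J} (proj₂ ∘ onRight) ⟩
        minor (block M) (λ b → suc n ↑ʳ proj₁ (onRight b))
          ≈⟨ minor-block-right M (proj₁ ∘ onRight) ⟩
        minor M (proj₁ ∘ onRight) ∎))
        (M≥0 (suc n) (λ i → i) (proj₁ ∘ onRight) (λ i<j → i<j)
          (λ {i} {j} i<j → ℕₚ.+-cancelˡ-< (suc n) _ _
            (≡.subst₂ ℕ._<_ (toℕ-onRight i) (toℕ-onRight j) (J↗ i<j))))
      where
      J0≤ : ∀ b → toℕ (J zero) ℕ.≤ toℕ (J b)
      J0≤ zero    = ℕₚ.≤-refl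
      J0≤ (suc b) = ℕₚ.<⇒≤ (J↗ (ℕ.s≤s ℕ.z≤n))
      n<J : ∀ b → suc n ℕ.≤ toℕ (J b)
      n<J b = ℕₚ.≤-trans (ℕₚ.≤-trans (ℕₚ.m≤m+n (suc n) (toℕ z))
        (ℕₚ.≤-reflexive (≡.trans (≡.sym (Finₚ.toℕ-↑ʳ (suc n) z)) (≡.cong toℕ (≡.sym J0≡))))) (J0≤ b)
      onRight : ∀ b → ∃[ z ] J b ≡ suc n ↑ʳ z
      onRight b = Fin.reduce≥ (J b) (n<J b) , ≡.sym
              (Finₚ.splitAt⁻¹-↑ʳ {suc n} (Finₚ.splitAt-≥ (suc n) (J b) (n<J b)))
      toℕ-onRight : ∀ b → toℕ (J b) ≡ suc n ℕ.+ toℕ (proj₁ (onRight b))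
      toℕ-onRight b = ≡.trans (≡.cong toℕ (proj₂ (onRight b))) (Finₚ.toℕ-↑ʳ (suc n) (proj₁ (onRight b)))
    from : ∀ {y} → Column (suc n) y → J zero ≡ y → 0# ≤ minor (block M) J
    from (left a)  = leftmost a
    from (right z) = rightmost z

  -- In skip, a is the least value that r misses.
  data Gap {k} : ∀ {n} → (Fin k → Fin n) → Set where
    full : {r : Fin k → Fin k} → (∀ i → r i ≡ i) → Gap r
    skip : ∀ {n} {r : Fin k → Fin (suc n)} (a : Fin (suc n)) (r′ : Fin k → Fin n) → toℕ a ℕ.≤ k →
           StrictlyIncreasing r′ → (∀ i → r i ≡ punchIn a (r′ i)) →
           (∀ i → toℕ i ℕ.< toℕ a → toℕ (r′ i) ≡ toℕ i) → Gap r

  gap : ∀ {k n} (r : Fin k → Fin n) → StrictlyIncreasing r → Gap r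
  gap {zero}  {zero}  r r↗ = full (λ ())
  gap {zero}  {suc n} r r↗ = skip zero (λ ()) ℕ.z≤n (λ { {()} }) (λ ()) (λ ())
  gap {suc k} {zero}  r r↗ with () ← r zero
  gap {suc k} {suc n} r r↗ = from (r zero) ≡.refl
    where
    tail↗ : StrictlyIncreasing (r ∘ suc)
    tail↗ i<j = r↗ (ℕ.s≤s i<j)
    0<tail : ∀ i → 0 ℕ.< toℕ (r (suc i))
    0<tail i = ℕₚ.≤-<-trans ℕ.z≤n (r↗ (ℕ.s≤s ℕ.z≤n))
    extend : ∀ {n} {r : Fin (suc k) → Fin (suc n)} {r″ : Fin k → Fin n} → r zero ≡ zero →
            StrictlyIncreasing r″ →
             (∀ i → r (suc i) ≡ suc (r″ i)) → Gap r″ → Gap r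
    extend e r″↗ eq (full id) = full λ { zero → e ; (suc i) → ≡.trans (eq i) (≡.cong suc (id i)) }
    extend e r″↗ eq (skip a r‴ a≤k r‴↗ h below) = skip (suc a) (zero ∷ (suc ∘ r‴)) (ℕ.s≤s a≤k)
      (∷-strict (λ _ → ℕ.s≤s ℕ.z≤n) (λ i<j → ℕ.s≤s (r‴↗ i<j)))
      (λ { zero → e ; (suc i) → ≡.trans (eq i) (≡.cong suc (h i)) })
      (λ { zero _ → ≡.refl ; (suc i) (ℕ.s≤s i<a) → ≡.cong suc (below i i<a) })
    from : ∀ x → r zero ≡ x → Gap r
    from zero e = let r″ , r″↗ , eq = unsuc (r ∘ suc) tail↗ 0<tail in extend e r″↗ eq (gap r″ r″↗)
    from (suc x) e = let r′ , r′↗ , eq = unsuc r r↗ 0<r in skip zero r′ ℕ.z≤n r′↗ eq (λ _ ())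
      where
      0<r : ∀ i → 0 ℕ.< toℕ (r i)
      0<r zero    = ≡.subst (λ y → 0 ℕ.< toℕ y) (≡.sym e) (ℕ.s≤s ℕ.z≤n)
      0<r (suc i) = 0<tail i

  -- The unit columns of J are the rows missed by r, listed increasingly; the bound d is
  -- what minor-block-∷ needs in the recursion.
  minor-in-block : ∀ {n k q} (M : Matrix n q) d (r : Fin k → Fin n) (b : Fin k → Fin q) →
                   StrictlyIncreasing r → StrictlyIncreasing b → d ℕ.≤ k →
                   (∀ i → toℕ i ℕ.< d → toℕ (r i) ≡ toℕ i) →
                   ∃[ J ] StrictlyIncreasing J × (∀ i → d ℕ.≤ toℕ (J i)) ×
                          minor (block M) J ≈ det (λ i j → M (opposite (r (opposite i))) (b j))
  minor-in-block {n} {k} {q} M d r b r↗ b↗ d≤k below with gap r r↗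
  ... | full r≡ = (λ i → k ↑ʳ b i) ,
      (λ {i} {j} i<j → ≡.subst₂ ℕ._<_ (≡.sym (Finₚ.toℕ-↑ʳ k (b i))) (≡.sym (Finₚ.toℕ-↑ʳ k (b j)))
              (ℕₚ.+-monoʳ-< k (b↗ i<j))) ,
      (λ i → ℕₚ.≤-trans d≤k (ℕₚ.≤-trans (ℕₚ.m≤m+n k (toℕ (b i)))
              (ℕₚ.≤-reflexive (≡.sym (Finₚ.toℕ-↑ʳ k (b i)))))) ,
      trans (minor-block-right M b)
        (det-cong (λ i j → reflexive (≡.cong (λ l → M l (b j))
          (≡.trans (≡.sym (Finₚ.opposite-involutive i)) (≡.cong opposite (≡.sym (r≡ (opposite i))))))))
  minor-in-block {suc n} {k} {q} M d r b r↗ b↗ d≤k below | skip a r′ a≤k r′↗ r≡ below′ =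
      let J , J↗ , a≤J , eq = minor-in-block (λ i → M (punchIn (opposite a) i))
              (toℕ a) r′ b r′↗ b↗ a≤k below′ in
      ((a ↑ˡ q) ∷ (suc ∘ J)) ,
      ∷-strict (λ i → ℕ.s≤s (≡.subst (ℕ._≤ toℕ (J i)) (≡.sym (Finₚ.toℕ-↑ˡ a q)) (a≤J i)))
              (λ i<j → ℕ.s≤s (J↗ i<j)) ,
      (λ { zero → ≡.subst (d ℕ.≤_) (≡.sym (Finₚ.toℕ-↑ˡ a q)) d≤a ; (suc i) → ℕₚ.m≤n⇒m≤1+n
              (ℕₚ.≤-trans d≤a (a≤J i)) }) ,
      trans (minor-block-∷ M a J a≤J) (trans eq (det-cong (λ i j → reflexive (≡.cong (λ l → M l (b j))
        (≡.trans (≡.sym (opposite-punchIn a (r′ (opposite i)))) (≡.cong opposite (≡.sym (r≡ (opposite i)))))))))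
    where
    -- Each value below `d` is taken by `r` at the index equal to it, whereas `a` is missed.
    d≤a : d ℕ.≤ toℕ a
    d≤a = ℕₚ.≮⇒≥ λ a<d →
      let i = Fin.fromℕ< (ℕₚ.<-≤-trans a<d d≤k)
          i≡a = Finₚ.toℕ-fromℕ< (ℕₚ.<-≤-trans a<d d≤k)
          ri≡a = ≡.trans (below i (≡.subst (ℕ._< d) (≡.sym i≡a) a<d)) i≡a
      in Finₚ.punchInᵢ≢i a (r′ i) (≡.trans (≡.sym (r≡ i)) (Finₚ.toℕ-injective ri≡a))

  block-nonNeg⇒tnn : ∀ {n q} (M : Matrix n q) → MaximalMinorsNonnegative (block M) → TotallyNonnegative M
  block-nonNeg⇒tnn M h k I K I↗ K↗ =
    -- The block lists the rows of `M` in reverse, so the row selection is conjugated by `opposite`;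
    -- this keeps it increasing, and the involution undoes it at the end.
    let J , J↗ , _ , eq = minor-in-block M 0 (opposite ∘ I ∘ opposite) K
                            (λ i<j → opposite-anti-< (I↗ (opposite-anti-< i<j))) K↗ ℕ.z≤n (λ _ ())
    in ≤-cong refl (trans eq (det-cong λ i j → reflexive (≡.cong (λ l → M l (K j))
         (≡.trans (Finₚ.opposite-involutive _) (≡.cong I (Finₚ.opposite-involutive i)))))) (h J J↗)

  minor-block-identity : ∀ {n q} (M : Matrix n q) → minor (block M) (_↑ˡ q) ≈ 1#
  minor-block-identity {n} M = trans (det-cong (λ i j → reflexive (block-left M i j))) (det-identity n)

  ↑ˡ-strict : ∀ {n} q → StrictlyIncreasing {n} (_↑ˡ q)
  ↑ˡ-strict q {i} {j} i<j = ≡.subst₂ ℕ._<_ (≡.sym (Finₚ.toℕ-↑ˡ i q)) (≡.sym (Finₚ.toℕ-↑ˡ j q)) i<j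

  self-basis : ∀ {m n} (A : Matrix m n) (ind : LinearlyIndependent A) → IsBasis A (Gr.members (rowSpan A ind))
  self-basis A ind = proj₂ (Gr.hasBasis (rowSpan A ind))

  -- A basis A of the row span of B = (I ∣ M ′) is C B with C invertible, and C is the left
  -- block of A, so every maximal minor of A is that of B times a fixed positive minor.
  σ-nonNeg⇒block-nonNeg : ∀ {n} (M : Matrix n n) → Gr≥0 (σ M) → MaximalMinorsNonnegative (block M)
  σ-nonNeg⇒block-nonNeg {n} M (A , basis , A≥0) J J↗ = *-cancel-nonNeg 0<detC
          (≤-cong refl (minor-A J) (A≥0 J J↗))
    where
    B : Matrix n (n ℕ.+ n)
    B = block M
    C D : Matrix n n
    C i = proj₁ (IsBasis.members basis i)
    D i = proj₁ (IsBasis.spanning basis {B i} (identity i , row-combination B i))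
    minor-A : ∀ J → minor A J ≈ det C * minor B J
    minor-A J = trans (det-cong (λ i j → proj₂ (IsBasis.members basis i) (J j))) (minor-* C B J)
    minor-left : minor A (_↑ˡ n) ≈ det C
    minor-left = trans (minor-A (_↑ˡ n)) (trans (*-congˡ (minor-block-identity M)) (*-identityʳ _))
    detD*detC≈1 : det D * det C ≈ 1#
    detD*detC≈1 = begin
      det D * det C            ≈⟨ *-congˡ minor-left ⟨
      det D * minor A (_↑ˡ n)  ≈⟨ minor-* D A (_↑ˡ n) ⟨
      minor (λ i → combination (D i) A) (_↑ˡ n)
        ≈⟨ det-cong (λ i j → proj₂ (IsBasis.spanning basis {B i} (identity i , row-combination B i)) (j ↑ˡ n)) ⟨
      minor B (_↑ˡ n)          ≈⟨ minor-block-identity M ⟩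
      1# ∎
    0<detC : 0# < det C
    0<detC = ≤-cong refl minor-left (A≥0 (_↑ˡ n) (↑ˡ-strict n)) ,
      λ 0≈detC → 0≉1 (trans (sym (zeroʳ (det D))) (trans (*-congˡ 0≈detC) detD*detC≈1))

  σ∈Gr≥0⇔tnn : ∀ {n} (M : Matrix n n) → Gr≥0 (σ M) ⇔ TotallyNonnegative M
  σ∈Gr≥0⇔tnn M = mk⇔
    (λ X≥0 → block-nonNeg⇒tnn M (σ-nonNeg⇒block-nonNeg M X≥0))
    (λ M≥0 → block M , self-basis (block M) ([I∣′]-independent M) , tnn⇒block-nonNeg M M≥0)

  -- The form R

  sum-unit : ∀ {n} (f : Vector Carrier n) i → sum (λ k → f k * identity i k) ≈ f i
  sum-unit {n} f i = trans (sum-cong-≋ {n} (λ k → *-congˡ (identity-comm i k)))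
    (combination-identity f identity i i (λ _ → refl))

  module _ {n : ℕ} where

    R-cong : ∀ {x x′ y y′} → (∀ j → x j ≈ x′ j) → (∀ j → y j ≈ y′ j) → R n x y ≈ R n x′ y′
    R-cong ex ey = sum-cong-≋ {n} λ i →
      *-congˡ (+-cong (*-cong (ex _) (ey _)) (-‿cong (*-cong (ex _) (ey _))))

    R-antisym : ∀ x y → R n x y ≈ - R n y x
    R-antisym x y = begin
      R n x y
        ≈⟨ sum-cong-≋ {n} (λ i → solve 5 (λ s a b c d → s :* (a :* b :- c :* d) := :- con (ℤ.+ 1) :*
                (s :* (d :* c :- b :* a))) refl
             ((- 1#) ^ toℕ i) (x (i ↑ˡ n)) (y (n ↑ʳ i)) (x (n ↑ʳ i)) (y (i ↑ˡ n))) ⟩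
      sum (λ i → - 1# * ((- 1#) ^ toℕ i * (y (i ↑ˡ n) * x (n ↑ʳ i) - y (n ↑ʳ i) * x (i ↑ˡ n))))
        ≈⟨ *-distribˡ-sum {n} (- 1#) (λ i → (- 1#) ^ toℕ i *
                (y (i ↑ˡ n) * x (n ↑ʳ i) - y (n ↑ʳ i) * x (i ↑ˡ n))) ⟨
      - 1# * R n y x
        ≈⟨ -1*x≈-x _ ⟩
      - R n y x ∎

    R-linear : ∀ a {x y z} w → (∀ j → x j ≈ a * y j + z j) → R n x w ≈ a * R n y w + R n z w
    R-linear a {x} {y} {z} w e = begin
      R n x w
        ≈⟨ R-cong {y = w} e (λ _ → refl) ⟩
      R n (λ j → a * y j + z j) w
        ≈⟨ sum-cong-≋ {n} (λ i → solve 8 (λ s a y y′ z z′ w w′ →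
               s :* ((a :* y :+ z) :* w′ :- (a :* y′ :+ z′) :* w) :=
               a :* (s :* (y :* w′ :- y′ :* w)) :+ s :* (z :* w′ :- z′ :* w)) refl
             ((- 1#) ^ toℕ i) a (y (i ↑ˡ n)) (y (n ↑ʳ i)) (z (i ↑ˡ n)) (z (n ↑ʳ i)) (w (i ↑ˡ n)) (w (n ↑ʳ i))) ⟩
      sum (λ i → a * term y i + term z i)
        ≈⟨ ∑-distrib-+ {n} (λ i → a * term y i) (term z) ⟩
      sum (λ i → a * term y i) + R n z w
        ≈⟨ +-congʳ (*-distribˡ-sum {n} a (term y)) ⟨
      a * R n y w + R n z w ∎
      where
      term : Vector Carrier (n ℕ.+ n) → Vector Carrier n
      term x i = (- 1#) ^ toℕ i * (x (i ↑ˡ n) * w (n ↑ʳ i) - x (n ↑ʳ i) * w (i ↑ˡ n))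

    R-zero : ∀ {x} w → (∀ j → x j ≈ 0#) → R n x w ≈ 0#
    R-zero {x} w e = x≈x+x⇒x≈0 (trans
      (R-linear 1# {x} {x} {x} w λ j → trans (e j)
              (sym (trans (+-cong (trans (*-identityˡ _) (e j)) (e j)) (+-identityˡ 0#))))
      (+-congʳ (*-identityˡ _)))

    R-combination : ∀ {m} (c : Vector Carrier m) A w → (∀ i → R n (A i) w ≈ 0#) → R n (combination c A) w ≈ 0#
    R-combination {zero}  c A w e = R-zero w (λ _ → refl)
    R-combination {suc m} c A w e = trans (R-linear (c zero) {combination c A} {A zero}
            {combination (c ∘ suc) (A ∘ suc)} w (λ j → refl))
      (trans (+-cong (trans (*-congˡ (e zero)) (zeroʳ _)) (R-combination (c ∘ suc) (A ∘ suc) w (e ∘ suc)))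
              (+-identityˡ 0#))

    Isotropic : ∀ {m} → Matrix m (n ℕ.+ n) → Set
    Isotropic A = ∀ i j → R n (A i) (A j) ≈ 0#

    isotropic-span : ∀ {m} (A : Matrix m (n ℕ.+ n)) → Isotropic A → ∀ c d → R n (combination c A)
            (combination d A) ≈ 0#
    isotropic-span A iso c d = R-combination c A (combination d A) λ i → begin
      R n (A i) (combination d A)   ≈⟨ R-antisym (A i) (combination d A) ⟩
      - R n (combination d A) (A i) ≈⟨ -‿cong (R-combination d A (A i) (λ j → iso j i)) ⟩
      - 0#                          ≈⟨ -0#≈0# ⟩
      0# ∎

    identity-↑ˡ : ∀ (i j : Fin n) → identity (i ↑ˡ n) (j ↑ˡ n) ≈ identity i j
    identity-↑ˡ i j with i Finₚ.≟ j
    ... | yes ≡.refl = identity-≡ (i ↑ˡ n)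
    ... | no  i≢j    = identity-≢ (i≢j ∘ Finₚ.↑ˡ-injective n i j)

    identity-↑ʳ : ∀ (i j : Fin n) → identity (n ↑ʳ i) (n ↑ʳ j) ≈ identity i j
    identity-↑ʳ i j with i Finₚ.≟ j
    ... | yes ≡.refl = identity-≡ (n ↑ʳ i)
    ... | no  i≢j    = identity-≢ (i≢j ∘ Finₚ.↑ʳ-injective n i j)

    ↑ˡ≢↑ʳ : ∀ {i j : Fin n} → i ↑ˡ n ≢ n ↑ʳ j
    ↑ˡ≢↑ʳ {i} {j} e with () ← ≡.trans (≡.sym (Finₚ.splitAt-↑ˡ n i n))
            (≡.trans (≡.cong (splitAt n) e) (Finₚ.splitAt-↑ʳ n n j))

    R-unit-left : ∀ i y → R n (identity (i ↑ˡ n)) y ≈ (- 1#) ^ toℕ i * y (n ↑ʳ i)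
    R-unit-left i y = trans
      (sum-cong-≋ {n} λ k → begin
        (- 1#) ^ toℕ k * (identity (i ↑ˡ n) (k ↑ˡ n) * y (n ↑ʳ k) - identity (i ↑ˡ n) (n ↑ʳ k) * y (k ↑ˡ n))
          ≈⟨ *-congˡ {(- 1#) ^ toℕ k} (+-cong (*-congʳ (identity-↑ˡ i k))
                  (-‿cong (*-congʳ (identity-≢ (↑ˡ≢↑ʳ {i} {k}))))) ⟩
        (- 1#) ^ toℕ k * (identity i k * y (n ↑ʳ k) - 0# * y (k ↑ˡ n))
          ≈⟨ solve 4 (λ s e y y′ → s :* (e :* y :- con (ℤ.+ 0) :* y′) := s :* y :* e) refl
               ((- 1#) ^ toℕ k) (identity i k) (y (n ↑ʳ k)) (y (k ↑ˡ n)) ⟩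
        (- 1#) ^ toℕ k * y (n ↑ʳ k) * identity i k ∎)
      (sum-unit {n} (λ k → (- 1#) ^ toℕ k * y (n ↑ʳ k)) i)

    R-unit-right : ∀ i y → R n (identity (n ↑ʳ i)) y ≈ - (- 1#) ^ toℕ i * y (i ↑ˡ n)
    R-unit-right i y = trans
      (sum-cong-≋ {n} λ k → begin
        (- 1#) ^ toℕ k * (identity (n ↑ʳ i) (k ↑ˡ n) * y (n ↑ʳ k) - identity (n ↑ʳ i) (n ↑ʳ k) * y (k ↑ˡ n))
          ≈⟨ *-congˡ {(- 1#) ^ toℕ k} (+-cong (*-congʳ (identity-≢ (↑ˡ≢↑ʳ {k} {i} ∘ ≡.sym)))
                  (-‿cong (*-congʳ (identity-↑ʳ i k)))) ⟩
        (- 1#) ^ toℕ k * (0# * y (n ↑ʳ k) - identity i k * y (k ↑ˡ n))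
          ≈⟨ solve 4 (λ s e y y′ → s :* (con (ℤ.+ 0) :* y :- e :* y′) := (:- s) :* y′ :* e) refl
               ((- 1#) ^ toℕ k) (identity i k) (y (n ↑ʳ k)) (y (k ↑ˡ n)) ⟩
        - (- 1#) ^ toℕ k * y (k ↑ˡ n) * identity i k ∎)
      (sum-unit {n} (λ k → - (- 1#) ^ toℕ k * y (k ↑ˡ n)) i)

    -- The numbers n - 1 - i and n - 1 + i have the same parity. Splitting off the sign that does
    -- not depend on i gives both terms in `R-rows` the same factor.
    opposite-sgn : ∀ (i : Fin n) → (- 1#) ^ (n ℕ.∸ suc (toℕ i)) ≈ (- 1#) ^ ℕ.pred n * (- 1#) ^ toℕ i
    opposite-sgn i = begin
      t                        ≈⟨ *-identityʳ t ⟨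
      t * 1#                   ≈⟨ *-congˡ (sgn-square (toℕ i)) ⟨
      t * (s * s)              ≈⟨ *-assoc _ _ _ ⟨
      (t * s) * s              ≈⟨ *-congʳ (^-homo-* (- 1#) (n ℕ.∸ suc (toℕ i)) (toℕ i)) ⟨
      (- 1#) ^ (n ℕ.∸ suc (toℕ i) ℕ.+ toℕ i) * s
        ≡⟨ ≡.cong (λ k → (- 1#) ^ k * s) (≡.cong ℕ.pred
                (≡.trans (≡.sym (ℕₚ.+-suc _ (toℕ i))) (ℕₚ.m∸n+n≡m (Finₚ.toℕ<n i)))) ⟩
      (- 1#) ^ ℕ.pred n * s ∎
      where
      s = (- 1#) ^ toℕ i
      t = (- 1#) ^ (n ℕ.∸ suc (toℕ i))

    R-rows : ∀ (M : Matrix n n) i j → R n (block M i) (block M j) ≈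
             (- 1#) ^ ℕ.pred n * ((- 1#) ^ toℕ i * (- 1#) ^ toℕ j) * (M (opposite j) i - M (opposite i) j)
    R-rows M i j = begin
      R n (block M i) (block M j)
        ≈⟨ sum-cong-≋ {n} (λ k → begin
             s k * (block M i (k ↑ˡ n) * block M j (n ↑ʳ k) - block M i (n ↑ʳ k) * block M j (k ↑ˡ n))
               ≡⟨ ≡.cong (s k *_) (≡.cong₂ _-_ (≡.cong₂ _*_ (block-left M i k) (block-right M j k))
                       (≡.cong₂ _*_ (block-right M i k) (block-left M j k))) ⟩
             s k * (identity i k * M′ j k - M′ i k * identity j k)
               ≈⟨ solve 5 (λ s d m m′ e → s :* (d :* m :- m′ :* e) := s :* m :* d :+
                       (:- (s :* m′)) :* e) refl (s k) (identity i k) (M′ j k) (M′ i k) (identity j k) ⟩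
             s k * M′ j k * identity i k + - (s k * M′ i k) * identity j k ∎) ⟩
      sum (λ k → s k * M′ j k * identity i k + - (s k * M′ i k) * identity j k)
        ≈⟨ ∑-distrib-+ {n} (λ k → s k * M′ j k * identity i k) (λ k → - (s k * M′ i k) * identity j k) ⟩
      sum (λ k → s k * M′ j k * identity i k) + sum (λ k → - (s k * M′ i k) * identity j k)
        ≈⟨ +-cong (sum-unit {n} (λ k → s k * M′ j k) i) (sum-unit {n} (λ k → - (s k * M′ i k)) j) ⟩
      s i * M′ j i - s j * M′ i j
        ≈⟨ +-cong (*-congˡ (*-congʳ (opposite-sgn j))) (-‿cong (*-congˡ (*-congʳ (opposite-sgn i)))) ⟩
      s i * (e * s j * M (opposite j) i) - s j * (e * s i * M (opposite i) j)
        ≈⟨ solve 5 (λ a b e x y → a :* (e :* b :* x) :- b :* (e :* a :* y) := e :* (a :* b) :* (x :- y)) refl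
             (s i) (s j) e (M (opposite j) i) (M (opposite i) j) ⟩
      e * (s i * s j) * (M (opposite j) i - M (opposite i) j) ∎
      where
      e = (- 1#) ^ ℕ.pred n
      s : Fin n → Carrier
      s k = (- 1#) ^ toℕ k
      M′ : Matrix n n
      M′ = signReverse M

  x-y≈0⇒x≈y : ∀ {x y} → x - y ≈ 0# → x ≈ y
  x-y≈0⇒x≈y {x} {y} e = trans (solve 2 (λ x y → x := (x :- y) :+ y) refl x y) (x≈0⇒x+y≈y e)

  x≈y⇒x-y≈0 : ∀ {x y} → x ≈ y → x - y ≈ 0#
  x≈y⇒x-y≈0 e = trans (+-congʳ e) (-‿inverseʳ _)

  sgn≉0 : ∀ k → ¬ (- 1#) ^ k ≈ 0#
  sgn≉0 k e = 0≉1 (trans (sym (zeroˡ _)) (trans (*-congʳ (sym e)) (sgn-square k)))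

  σ∈LG⇔symmetric : ∀ {n} (M : Matrix n n) → LG (σ M) ⇔ AntidiagonalSymmetric M
  σ∈LG⇔symmetric {n} M = mk⇔ to from
    where
    to : LG (σ M) → AntidiagonalSymmetric M
    -- Rows `j` and `opposite i` are the pair for which `R-rows` compares the entry at (i, j) with
    -- its mirror image.
    to X i j = trans
      (reflexive (≡.cong (λ k → M k j) (≡.sym (Finₚ.opposite-involutive i))))
      (x-y≈0⇒x≈y (x*y≈0⇒y≈0 (sgn≉0 (toℕ j)) (x*y≈0⇒y≈0 (sgn≉0 (toℕ (opposite i))) (x*y≈0⇒y≈0 (sgn≉0 (ℕ.pred n))
        (trans (solve 4 (λ e a b x → e :* (b :* (a :* x)) := e :* (a :* b) :* x) refl
                 ((- 1#) ^ ℕ.pred n) ((- 1#) ^ toℕ j) ((- 1#) ^ toℕ (opposite i)) _)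
          (trans (sym (R-rows M j (opposite i)))
            (X _ _ (identity j , row-combination (block M) j)
                    (identity (opposite i) , row-combination (block M) (opposite i)))))))))
    from : AntidiagonalSymmetric M → LG (σ M)
    from symmetric x y (c , x≈) (d , y≈) = trans (R-cong {n} x≈ y≈) (isotropic-span {n} (block M)
      (λ i j → trans (R-rows M i j) (trans (*-congˡ (x≈y⇒x-y≈0
        (trans (symmetric (opposite j) i) (reflexive
                (≡.cong (M (opposite i)) (Finₚ.opposite-involutive j)))))) (zeroʳ _))) c d)

  -- Column operations

  strict⇒injective : ∀ {k n} {J : Fin k → Fin n} → StrictlyIncreasing J → ∀ {i j} → J i ≡ J j → i ≡ j
  strict⇒injective J↗ {i} {j} e with ℕₚ.<-cmp (toℕ i) (toℕ j)
  ... | tri< i<j _ _ = ⊥-elim (ℕₚ.<⇒≢ (J↗ i<j) (≡.cong toℕ e))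
  ... | tri≈ _ i≡j _ = Finₚ.toℕ-injective i≡j
  ... | tri> _ _ j<i = ⊥-elim (ℕₚ.<⇒≢ (J↗ j<i) (≡.cong toℕ (≡.sym e)))

  strict-cong : ∀ {k n} {J K : Fin k → Fin n} → (∀ i → J i ≡ K i) → StrictlyIncreasing J → StrictlyIncreasing K
  strict-cong e J↗ i<j = ≡.subst₂ Fin._<_ (e _) (e _) (J↗ i<j)

  insertAt-strict : ∀ {k n} (K : Fin k → Fin n) p x → StrictlyIncreasing K →
                    (∀ i → toℕ i ℕ.< toℕ p → K i Fin.< x) → (∀ i → toℕ p ℕ.≤ toℕ i → x Fin.< K i) →
                    StrictlyIncreasing (insertAt K p x)
  insertAt-strict K zero x K↗ below above =
    strict-cong {J = x ∷ K} (λ { zero → ≡.refl ; (suc i) → ≡.refl }) (∷-strict (λ i → above i ℕ.z≤n) K↗)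
  insertAt-strict {suc k} K (suc p) x K↗ below above =
    strict-cong {J = K zero ∷ insertAt (K ∘ suc) p x} (λ { zero → ≡.refl ; (suc i) → ≡.refl })
      (∷-strict first (insertAt-strict (K ∘ suc) p x (λ i<j → K↗ (ℕ.s≤s i<j))
        (λ i i<p → below (suc i) (ℕ.s≤s i<p)) (λ i p≤i → above (suc i) (ℕ.s≤s p≤i))))
    where
    first : ∀ i → K zero Fin.< insertAt (K ∘ suc) p x i
    first i with around p i
    ... | at     = ≡.subst (K zero Fin.<_) (≡.sym (insertAt-at (K ∘ suc) p x)) (below zero (ℕ.s≤s ℕ.z≤n))
    ... | away j = ≡.subst (K zero Fin.<_) (≡.sym (insertAt-away (K ∘ suc) p x j)) (K↗ (ℕ.s≤s ℕ.z≤n))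

  columns : ∀ {m n k} → Matrix m n → (Fin k → Fin n) → Matrix k m
  columns A J j i = A i (J j)

  minor-insertAt : ∀ {k n} (A : Matrix (suc k) n) (K : Fin k → Fin n) p x →
                   minor A (insertAt K p x) ≈ (- 1#) ^ toℕ p * minor A (x ∷ K)
  minor-insertAt {k} A K p x = begin
    minor A (insertAt K p x)
      ≈⟨ det-cong {suc k} (λ i j → reflexive (≡.sym (eq i j))) ⟩
    det (λ i j → insertAt (columns A K) p (λ i → A i x) j i)
      ≈⟨ insertAt-sign (transpose-det-alternating (suc k)) (columns A K) p (λ i → A i x) ⟩
    (- 1#) ^ toℕ p * det (λ i j → ((λ i → A i x) ∷ columns A K) j i)
      ≈⟨ *-congˡ (det-cong {suc k} {λ i j → ((λ i → A i x) ∷ columns A K) j i} {λ i j → A i ((x ∷ K) j)} λ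
              { i zero → refl ; i (suc j) → refl }) ⟩
    (- 1#) ^ toℕ p * minor A (x ∷ K) ∎
    where
    eq : ∀ i j → insertAt (columns A K) p (λ i → A i x) j i ≡ A i (insertAt K p x j)
    eq i j with around p j
    ... | at      = ≡.trans (≡.cong (λ r → r i) (insertAt-at (columns A K) p (λ i → A i x)))
                            (≡.cong (A i) (≡.sym (insertAt-at K p x)))
    ... | away j′ = ≡.trans (≡.cong (λ r → r i) (insertAt-away (columns A K) p (λ i → A i x) j′))
                            (≡.cong (A i) (≡.sym (insertAt-away K p x j′)))

  minor-repeated : ∀ {m n} (A : Matrix m n) J {p q} → p ≢ q → J p ≡ J q → minor A J ≈ 0#
  minor-repeated {m} A J p≢q e =
    repeated (transpose-det-alternating m) {columns A J} p≢q (λ i → reflexive (≡.cong (A i) e))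

  infixl 6 _[_≔_]
  _[_≔_] : ∀ {k n} → (Fin k → Fin n) → Fin k → Fin n → Fin k → Fin n
  J [ p ≔ s ] = updateAt J p (λ _ → s)

  ≔-at : ∀ {k n} (J : Fin k → Fin n) p s → (J [ p ≔ s ]) p ≡ s
  ≔-at J p s = VFₚ.updateAt-updates p J

  ≔-away : ∀ {k n} (J : Fin k → Fin n) {p i} s → i ≢ p → (J [ p ≔ s ]) i ≡ J i
  ≔-away J {p} {i} s i≢p = VFₚ.updateAt-minimal i p J i≢p

  -- Right multiplication by an elementary matrix. Writing it with `identity d` presents each new
  -- row as a multiple of a unit vector plus the old row, the shape to which `R-linear` applies.
  addColumn : ∀ {m n} → Fin n → Fin n → Carrier → Matrix m n → Matrix m n
  addColumn d s c A i l = c * A i s * identity d l + A i l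

  addColumn-at : ∀ {m n} d s c (A : Matrix m n) i → addColumn d s c A i d ≈ c * A i s + A i d
  addColumn-at d s c A i = +-congʳ (trans (*-congˡ (identity-≡ d)) (*-identityʳ _))

  addColumn-away : ∀ {m n} d s c (A : Matrix m n) i {l} → l ≢ d → addColumn d s c A i l ≈ A i l
  addColumn-away d s c A i l≢d = x≈0⇒x+y≈y (trans (*-congˡ (identity-≢ (l≢d ∘ ≡.sym))) (zeroʳ _))

  minor-addColumn-at : ∀ {m n} d s c (A : Matrix m n) J p → J p ≡ d → (∀ i → i ≢ p → J i ≢ d) →
                       minor (addColumn d s c A) J ≈ c * minor A (J [ p ≔ s ]) + minor A J
  minor-addColumn-at {m} d s c A J p ≡.refl J≢d = transpose-det-alternating m .linear p c
    {columns (addColumn d s c A) J} {columns A (J [ p ≔ s ])} {columns A J}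
    (λ i → trans (addColumn-at d s c A i) (+-congʳ (*-congˡ (reflexive (≡.cong (A i) (≡.sym (≔-at J p s)))))))
    (λ j j≢p i → trans (addColumn-away d s c A i (J≢d j j≢p))
            (reflexive (≡.cong (A i) (≡.sym (≔-away J s j≢p)))))
    (λ j j≢p i → addColumn-away d s c A i (J≢d j j≢p))

  minor-addColumn-away : ∀ {m n} d s c (A : Matrix m n) J → (∀ i → J i ≢ d) → minor
          (addColumn d s c A) J ≈ minor A J
  minor-addColumn-away d s c A J J≢d = det-cong (λ i j → addColumn-away d s c A i (J≢d j))

  infix 4 _≼_
  -- Nonnegativity alone would not suffice: the minor made positive by the first column operation
  -- has to stay positive under the compensating one.
  _≼_ : ∀ {m n} → Matrix m n → Matrix m n → Set
  A ≼ B = ∀ J → StrictlyIncreasing J → minor A J ≤ minor B J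

  ≼-nonNeg : ∀ {m n} {A B : Matrix m n} → A ≼ B → MaximalMinorsNonnegative A → MaximalMinorsNonnegative B
  ≼-nonNeg A≼B A≥0 J J↗ = ≤-trans (A≥0 J J↗) (A≼B J J↗)

  addColumn-≼ : ∀ {m n} d s c (A : Matrix m n) →
                (∀ J → StrictlyIncreasing J → ∀ p → J p ≡ d → 0# ≤ c * minor A (J [ p ≔ s ])) →
                A ≼ addColumn d s c A
  addColumn-≼ d s c A h J J↗ with Finₚ.any? (λ p → J p Finₚ.≟ d)
  ... | yes (p , Jp≡d) = ≤-cong (+-identityˡ _)
          (sym (minor-addColumn-at d s c A J p Jp≡d λ i i≢p Ji≡d → i≢p
                  (strict⇒injective J↗ (≡.trans Ji≡d (≡.sym Jp≡d)))))
          (+-monoˡ-≤ _ (h J J↗ p Jp≡d))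
  ... | no  d∉J = ≤-reflexive (sym (minor-addColumn-away d s c A J λ i e → d∉J (i , e)))

  Adjacent : ∀ {n} → Fin n → Fin n → Set
  Adjacent d s = toℕ s ≡ suc (toℕ d) ⊎ toℕ d ≡ suc (toℕ s)

  -- No index lies strictly between neighbours, so exchanging one for the other does not disturb the
  -- order.
  ≔-strict : ∀ {k n} (J : Fin k → Fin n) p s → StrictlyIncreasing J → Adjacent (J p) s → (∀ i → J i ≢ s) →
             StrictlyIncreasing (J [ p ≔ s ])
  ≔-strict J p s J↗ adj s∉J {i} {j} i<j with i Finₚ.≟ p | j Finₚ.≟ p
  ... | yes ≡.refl | yes ≡.refl = ⊥-elim (ℕₚ.<-irrefl ≡.refl i<j)
  ... | no i≢p     | no j≢p     = ≡.subst₂ Fin._<_ (≡.sym (≔-away J s i≢p)) (≡.sym (≔-away J s j≢p)) (J↗ i<j)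
  ... | yes ≡.refl | no j≢p     = ≡.subst₂ Fin._<_ (≡.sym (≔-at J p s)) (≡.sym (≔-away J s j≢p)) (below adj)
    where
    below : Adjacent (J p) s → s Fin.< J j
    below (inj₁ s≡1+) = ℕₚ.≤∧≢⇒< (≡.subst (ℕ._≤ toℕ (J j)) (≡.sym s≡1+) (J↗ i<j))
            (s∉J j ∘ ≡.sym ∘ Finₚ.toℕ-injective)
    below (inj₂ 1+s≡) = ℕₚ.<-trans (ℕₚ.≤-reflexive (≡.sym 1+s≡)) (J↗ i<j)
  ... | no i≢p     | yes ≡.refl = ≡.subst₂ Fin._<_ (≡.sym (≔-away J s i≢p)) (≡.sym (≔-at J p s)) (above adj)
    where
    above : Adjacent (J p) s → J i Fin.< s
    above (inj₁ s≡1+) = ℕₚ.<-trans (J↗ i<j) (ℕₚ.≤-reflexive (≡.sym s≡1+))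
    above (inj₂ 1+s≡) = ℕₚ.≤∧≢⇒< (ℕ.s≤s⁻¹ (≡.subst (toℕ (J i) ℕ.<_) 1+s≡ (J↗ i<j))) (s∉J i ∘ Finₚ.toℕ-injective)

  Adjacent⇒≢ : ∀ {n} {d s : Fin n} → Adjacent d s → d ≢ s
  Adjacent⇒≢ (inj₁ e) ≡.refl = ℕₚ.1+n≢n (≡.sym e)
  Adjacent⇒≢ (inj₂ e) ≡.refl = ℕₚ.1+n≢n (≡.sym e)

  -- The term added to a minor has two equal columns if `s` is already selected; otherwise it is c
  -- times another maximal minor, with its columns already in increasing order and hence without a
  -- sign.
  adjacent-≼ : ∀ {m n} {d s : Fin n} {c} → Adjacent d s → 0# ≤ c → (A : Matrix m n) →
          MaximalMinorsNonnegative A →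
               A ≼ addColumn d s c A
  adjacent-≼ {d = d} {s} {c} adj 0≤c A A≥0 = addColumn-≼ d s c A replaced
    where
    replaced : ∀ J → StrictlyIncreasing J → ∀ p → J p ≡ d → 0# ≤ c * minor A (J [ p ≔ s ])
    replaced J J↗ p ≡.refl with Finₚ.any? (λ q → J q Finₚ.≟ s)
    ... | no  s∉J = *-nonNeg 0≤c (A≥0 _ (≔-strict J p s J↗ adj (λ i e → s∉J (i , e))))
    ... | yes (q , Jq≡s) = ≤-reflexive (sym (trans (*-congˡ (minor-repeated A (J [ p ≔ s ]) (q≢p ∘ ≡.sym)
            (≡.trans (≔-at J p s) (≡.sym (≡.trans (≔-away J s q≢p) Jq≡s))))) (zeroʳ c)))
      where
      q≢p : q ≢ p
      q≢p ≡.refl = Adjacent⇒≢ adj Jq≡s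

  -- The sign moves the last column, put in first place, past the other m columns.
  cyclic-≼ : ∀ {m n} {d s : Fin n} {c} → (∀ x → d Fin.≤ x) → (∀ x → x Fin.≤ s) → d ≢ s → 0# ≤ c →
             (A : Matrix (suc m) n) → MaximalMinorsNonnegative A → A ≼ addColumn d s (c * (- 1#) ^ m) A
  cyclic-≼ {m} {n} {d} {s} {c} d≤ ≤s d≢s 0≤c A A≥0 = addColumn-≼ d s (c * (- 1#) ^ m) A replaced
    where
    replaced : ∀ J → StrictlyIncreasing J → ∀ p → J p ≡ d → 0# ≤ c * (- 1#) ^ m * minor A (J [ p ≔ s ])
    replaced J J↗ (suc p) ≡.refl = ⊥-elim (ℕₚ.<⇒≱ (J↗ {zero} {suc p} (ℕ.s≤s ℕ.z≤n)) (d≤ (J zero)))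
    replaced J J↗ zero Jp≡d with Finₚ.any? (λ q → J (suc q) Finₚ.≟ s)
    ... | yes (q , Jq≡s) = ≤-reflexive (sym (trans
            (*-congˡ (minor-repeated A (J [ zero ≔ s ]) {zero} {suc q} (λ ())
            (≡.sym Jq≡s))) (zeroʳ _)))
    ... | no  s∉J = ≤-cong refl (sym (begin
        c * (- 1#) ^ m * minor A (J [ zero ≔ s ])
          ≈⟨ *-congˡ (minor-cong A {J [ zero ≔ s ]} {s ∷ (J ∘ suc)} λ { zero → ≡.refl ; (suc i) → ≡.refl }) ⟩
        c * (- 1#) ^ m * minor A (s ∷ (J ∘ suc))
          ≈⟨ trans (*-assoc _ _ _) (*-congˡ (*-congʳ
                  (reflexive (≡.cong ((- 1#) ^_) (≡.sym (Finₚ.toℕ-fromℕ m)))))) ⟩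
        c * ((- 1#) ^ toℕ (fromℕ m) * minor A (s ∷ (J ∘ suc)))
          ≈⟨ *-congˡ (minor-insertAt A (J ∘ suc) (fromℕ m) s) ⟨
        c * minor A (insertAt (J ∘ suc) (fromℕ m) s) ∎))
        (*-nonNeg 0≤c (A≥0 _ (insertAt-strict (J ∘ suc) (fromℕ m) s (λ i<j → J↗ (ℕ.s≤s i<j))
          (λ i _ → ℕₚ.≤∧≢⇒< (≤s (J (suc i))) (λ e → s∉J (i , Finₚ.toℕ-injective e)))
          (λ i m≤i → ⊥-elim (ℕₚ.<⇒≱ (Finₚ.toℕ<n i) (≡.subst (ℕ._≤ toℕ i) (Finₚ.toℕ-fromℕ m) m≤i))))))

  weight : ∀ {k n} → (Fin k → Fin n) → ℕ
  weight J = ℕΣ.sum (λ i → toℕ (J i))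

  -- `K` is `J` with `s` replaced by `d`. Its new minor is c times the positive minor at `J` plus
  -- the old, nonnegative minor at `K`.
  addColumn-descends : ∀ {m n} {d s : Fin n} {c} → toℕ s ≡ suc (toℕ d) → 0# < c →
                       (A : Matrix m n) → MaximalMinorsNonnegative A →
                       ∀ J → StrictlyIncreasing J → 0# < minor A J → ∀ p → J p ≡ s → (∀ i → J i ≢ d) →
                       ∃[ K ] StrictlyIncreasing K × 0# < minor (addColumn d s c A) K × weight K ℕ.< weight J
  addColumn-descends {suc m} {d = d} {s} {c} s≡1+d 0<c A A≥0 J J↗ 0<J p ≡.refl d∉J =
    K , K↗ , <-≤-trans (*-pos 0<c 0<J) (≤-cong (+-identityʳ _) (sym minor-K) (+-mono-≤ ≤-refl (A≥0 K K↗))) ,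
            weight-<
    where
    K : Fin (suc m) → Fin _
    K = J [ p ≔ d ]
    K↗ : StrictlyIncreasing K
    K↗ = ≔-strict J p d J↗ (inj₂ s≡1+d) d∉J
    restore : ∀ i → (K [ p ≔ s ]) i ≡ J i
    restore i with i Finₚ.≟ p
    ... | yes ≡.refl = ≔-at K p s
    ... | no  i≢p    = ≡.trans (≔-away K s i≢p) (≔-away J d i≢p)
    minor-K : minor (addColumn d s c A) K ≈ c * minor A J + minor A K
    minor-K = trans
      (minor-addColumn-at d s c A K p (≔-at J p d) (λ i i≢p e → d∉J i (≡.trans (≡.sym (≔-away J d i≢p)) e)))
      (+-congʳ (*-congˡ (minor-cong A {K [ p ≔ s ]} {J} restore)))
    weight-< : weight K ℕ.< weight J
    weight-< = ≡.subst₂ ℕ._<_ (≡.sym (ℕΣ.sum-remove {i = p} (λ i → toℕ (K i))))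
            (≡.sym (ℕΣ.sum-remove {i = p} (λ i → toℕ (J i))))
      (ℕₚ.+-mono-<-≤ (≡.subst₂ ℕ._<_ (≡.cong toℕ (≡.sym (≔-at J p d))) ≡.refl (ℕₚ.≤-reflexive (≡.sym s≡1+d)))
        (ℕₚ.≤-reflexive (ℕΣ.sum-cong-≗ {m} (λ i → ≡.cong toℕ (≔-away J d (Finₚ.punchInᵢ≢i p i))))))

  -- Perturbing a nonnegative isotropic matrix

  position : ∀ {k n} (K : Fin k → Fin n) x → StrictlyIncreasing K → (∀ i → K i ≢ x) →
             ∃[ p ] (∀ i → toℕ i ℕ.< toℕ {suc k} p → K i Fin.< x) × (∀ i → toℕ p ℕ.≤ toℕ i → x Fin.< K i)
  position {zero}  K x K↗ x∉K = zero , (λ ()) , (λ ())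
  position {suc k} K x K↗ x∉K with ℕₚ.<-cmp (toℕ x) (toℕ (K zero))
  ... | tri≈ _ x≡K0 _ = ⊥-elim (x∉K zero (Finₚ.toℕ-injective (≡.sym x≡K0)))
  ... | tri< x<K0 _ _ = zero , (λ _ ()) ,
        λ { zero _ → x<K0 ; (suc i) _ → ℕₚ.<-trans x<K0 (K↗ (ℕ.s≤s ℕ.z≤n)) }
  ... | tri> _ _ K0<x =
    let p , below , above = position (K ∘ suc) x (λ i<j → K↗ (ℕ.s≤s i<j)) (x∉K ∘ suc) in
    suc p , (λ { zero _ → K0<x ; (suc i) (ℕ.s≤s i<p) → below i i<p }) ,
            (λ { (suc i) (ℕ.s≤s p≤i) → above i p≤i })

  -- If every minor A (l ∷ J) vanished, the cofactors along column l, which do not depend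
  -- on l, would be a linear relation between the rows of A.
  nonzero-minor : ∀ {m n} (A : Matrix m n) → LinearlyIndependent A →
                  ∃[ J ] StrictlyIncreasing J × ¬ minor A J ≈ 0#
  nonzero-minor {zero}  A ind = (λ ()) , (λ { {()} }) , (0≉1 ∘ sym)
  nonzero-minor {suc m} {n} A ind = insertAt J p l , insertAt-strict J p l J↗ below above ,
      λ e → l∷J≉0 (x*y≈0⇒y≈0 (sgn≉0 (toℕ p)) (trans (sym (minor-insertAt A J p l)) e))
    where
    tail-independent : LinearlyIndependent (A ∘ suc)
    tail-independent c e i = ind (0# ∷ c) (λ j → trans (+-cong (zeroˡ _) (e j)) (+-identityˡ 0#)) (suc i)
    rest = nonzero-minor (A ∘ suc) tail-independent
    J : Fin m → Fin n
    J = proj₁ rest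
    J↗ : StrictlyIncreasing J
    J↗ = proj₁ (proj₂ rest)
    cofactor : Vector Carrier (suc m)
    cofactor i = (- 1#) ^ toℕ i * minor (λ a → A (punchIn i a)) J
    expand : ∀ l → minor A (l ∷ J) ≈ combination cofactor A l
    expand l = trans (sym (det-transpose (λ a b → A a ((l ∷ J) b))))
      (sum-cong-≋ {suc m} λ i → trans
        (*-congˡ (det-transpose (λ a b → A (punchIn i a) (J b))))
        (solve 3 (λ s x d → s :* x :* d := (s :* d) :* x) refl ((- 1#) ^ toℕ i) (A i l)
                (minor (λ a → A (punchIn i a)) J)))
    -- The relation is nontrivial: its coefficient at row zero is the minor of the remaining rows
    -- that induction made nonzero.
    not-all-zero : ¬ (∀ l → minor A (l ∷ J) ≈ 0#)
    not-all-zero h = proj₂ (proj₂ rest) (trans (sym (*-identityˡ _))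
            (ind cofactor (λ l → trans (sym (expand l)) (h l)) zero))
    found : ∃[ l ] ¬ minor A (l ∷ J) ≈ 0#
    found = Finₚ.¬∀⟶∃¬ n (λ l → minor A (l ∷ J) ≈ 0#) (λ l → minor A (l ∷ J) ≈? 0#) not-all-zero
    l : Fin n
    l = proj₁ found
    l∷J≉0 : ¬ minor A (l ∷ J) ≈ 0#
    l∷J≉0 = proj₂ found
    l∉J : ∀ i → J i ≢ l
    l∉J i e = l∷J≉0 (minor-repeated A (l ∷ J) {zero} {suc i} (λ ()) (≡.sym e))
    pos = position J l J↗ l∉J
    p = proj₁ pos
    below = proj₁ (proj₂ pos)
    above = proj₂ (proj₂ pos)

  -- The bound `b` rises by one with every entry that attains it. The first entry to exceed its
  -- bound has a free predecessor: later entries are larger still, and `b ℕ.≤ toℕ d` keeps the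
  -- earlier ones away from `d`.
  descent : ∀ {k n} (J : Fin k → Fin n) → StrictlyIncreasing J → ∀ b → (∀ i → b ℕ.≤ toℕ (J i)) →
            (∀ i → toℕ (J i) ≡ b ℕ.+ toℕ i) ⊎
            ∃[ p ] ∃[ d ] b ℕ.≤ toℕ d × toℕ (J p) ≡ suc (toℕ d) × (∀ i → J i ≢ d)
  descent {zero}  J J↗ b b≤J = inj₁ (λ ())
  descent {suc k} J J↗ b b≤J with toℕ (J zero) ℕₚ.≟ b
  ... | yes e with descent (J ∘ suc) (λ i<j → J↗ (ℕ.s≤s i<j)) (suc b)
                     (λ i → ≡.subst (ℕ._< toℕ (J (suc i))) e (J↗ (ℕ.s≤s ℕ.z≤n)))
  ...   | inj₁ h = inj₁ λ { zero → ≡.trans e (≡.sym (ℕₚ.+-identityʳ b))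
                          ; (suc i) → ≡.trans (h i) (≡.sym (ℕₚ.+-suc b (toℕ i))) }
  ...   | inj₂ (p , d , b<d , e′ , d∉J) = inj₂ (suc p , d , ℕₚ.<⇒≤ b<d , e′ ,
            λ { zero J0≡d → ℕₚ.<⇒≢ b<d (≡.trans (≡.sym e) (≡.cong toℕ J0≡d)) ; (suc i) → d∉J i })
  descent {suc k} J J↗ b b≤J | no b≢J0 = inj₂ (zero , from (J zero) ≡.refl)
    where
    b<J0 : b ℕ.< toℕ (J zero)
    b<J0 = ℕₚ.≤∧≢⇒< (b≤J zero) (b≢J0 ∘ ≡.sym)
    J0≤ : ∀ i → toℕ (J zero) ℕ.≤ toℕ (J i)
    J0≤ zero    = ℕₚ.≤-refl
    J0≤ (suc i) = ℕₚ.<⇒≤ (J↗ (ℕ.s≤s ℕ.z≤n))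
    from : ∀ x → J zero ≡ x → ∃[ d ] b ℕ.≤ toℕ d × toℕ (J zero) ≡ suc (toℕ d) × (∀ i → J i ≢ d)
    from zero    e = ⊥-elim (ℕₚ.n≮0 (≡.subst (b ℕ.<_) (≡.cong toℕ e) b<J0))
    from (suc x) e = inject₁ x , ≡.subst (b ℕ.≤_) (≡.sym (Finₚ.toℕ-inject₁ x))
            (ℕ.s≤s⁻¹ (≡.subst (b ℕ.<_) (≡.cong toℕ e) b<J0)) ,
      J0≡ , λ i Ji≡d → ℕₚ.<⇒≱ (ℕₚ.≤-reflexive (≡.sym J0≡))
              (≡.subst (toℕ (J zero) ℕ.≤_) (≡.cong toℕ Ji≡d) (J0≤ i))
      where
      J0≡ : toℕ (J zero) ≡ suc (toℕ (inject₁ x))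
      J0≡ = ≡.trans (≡.cong toℕ e) (≡.cong suc (≡.sym (Finₚ.toℕ-inject₁ x)))

  -- Encodes |x| ≤ b by two inequalities, so that bounds on sums and products can be combined
  -- without cases on the signs of the factors.
  Bounded : Carrier → Carrier → Set
  Bounded b x = x ≤ b × - x ≤ b

  ∣_∣-spec : ∀ x → ∃[ a ] 0# ≤ a × Bounded a x × (∀ {c} → Bounded c x → a ≤ c)
  ∣ x ∣-spec with total 0# x
  ... | inj₁ 0≤x = x , 0≤x , (≤-refl , ≤-trans (≤-cong refl -0#≈0# (neg-mono-≤ 0≤x)) 0≤x) , proj₁
  ... | inj₂ x≤0 = - x , ≤0⇒0≤- x≤0 , (≤-trans x≤0 (≤0⇒0≤- x≤0) , ≤-refl) , proj₂

  Bounded-weaken : ∀ {b c x} → b ≤ c → Bounded b x → Bounded c x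
  Bounded-weaken b≤c (p , q) = ≤-trans p b≤c , ≤-trans q b≤c

  -- The sum of the nonnegative individual bounds stands in for their maximum.
  uniform-bound : ∀ {n} (P : Fin n → Carrier → Set) → (∀ i {b c} → b ≤ c → P i b → P i c) →
                  (∀ i → ∃[ b ] 0# ≤ b × P i b) → ∃[ b ] 0# ≤ b × ∀ i → P i b
  uniform-bound {zero}  P mono h = 0# , ≤-refl , λ ()
  uniform-bound {suc n} P mono h =
    let b , 0≤b , Pb = h zero
        c , 0≤c , Pc = uniform-bound (P ∘ suc) (mono ∘ suc) (h ∘ suc)
    in b + c , +-nonNeg 0≤b 0≤c ,
       λ { zero    → mono zero (≤-cong (+-identityʳ b) refl (+-mono-≤ ≤-refl 0≤c)) Pb
         ; (suc i) → mono (suc i) (≤-cong (+-identityˡ c) refl (+-mono-≤ 0≤b ≤-refl)) (Pc i) }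

  matrix-bound : ∀ {m n} (A : Matrix m n) → ∃[ b ] 0# ≤ b × ∀ i j → Bounded b (A i j)
  matrix-bound A = uniform-bound (λ i b → ∀ j → Bounded b (A i j)) (λ i b≤c h j → Bounded-weaken b≤c (h j))
    λ i → uniform-bound (λ j b → Bounded b (A i j)) (λ j → Bounded-weaken)
            (λ j → let b , 0≤b , A≤b , _ = ∣ A i j ∣-spec in b , 0≤b , A≤b)

  ≤⇒<+ : ∀ {x y t ε} → x ≤ y → 0# < t → y + t ≈ ε → x < ε
  ≤⇒<+ {x} {y} {t} x≤y (0≤t , 0≉t) e =
    ≤-cong (+-identityʳ x) e (+-mono-≤ x≤y 0≤t) ,
    λ x≈ε → 0≉t (antisym 0≤t (≤-cong
      (trans (+-congˡ (-‿cong (refl {y}))) (trans (+-congʳ (trans x≈ε (sym e)))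
              (solve 2 (λ y t → (y :+ t) :- y := t) refl y t)))
      (-‿inverseʳ y) (+-monoˡ-≤ (- y) x≤y)))

  perturb : ∀ {m n} {O : Matrix m n → Set} → TopologicalSpace.IsOpen (matrixSpace m n) O →
            ∀ A → O A → (E : Matrix m n) →
            ∃[ t ] 0# < t × (∀ B → (∀ i j → B i j ≈ t * E i j + A i j) → O B)
  perturb open-O A OA E =
    let ε , 0<ε , ball = open-O A OA
        b , 0≤b , E≤b = matrix-bound E
        -- The choice is t = ε / (b + 1). The added 1 allows b = 0, and it makes the bound t b
        -- strictly smaller than ε, by exactly t.
        y , 0<y , e = inverse-pos (<-≤-trans 0<1 (≤-cong (+-identityˡ 1#) refl (+-monoˡ-≤ 1# 0≤b)))
        t = ε * y
        0<t = *-pos 0<ε 0<y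
        tb+t≈ε : t * b + t ≈ ε
        tb+t≈ε = trans (solve 3 (λ ε y b → ε :* y :* b :+ ε :* y := ε :* ((b :+ con (ℤ.+ 1)) :* y)) refl ε y b)
                       (trans (*-congˡ e) (*-identityʳ ε))
    in t , 0<t , λ B B≈ → ball B λ i j →
         ≤⇒<+ (≤-cong (trans (solve 3 (λ t e a → t :* (:- e) := a :- (t :* e :+ a)) refl t (E i j) (A i j))
                 (+-congˡ (-‿cong (sym (B≈ i j)))))
                refl (*-monoˡ-≤ (proj₁ 0<t) (proj₂ (E≤b i j)))) 0<t tb+t≈ε ,
         ≤⇒<+ (≤-cong (trans (solve 3 (λ t e a → t :* e := (t :* e :+ a) :- a) refl t (E i j) (A i j))
                 (+-congʳ (sym (B≈ i j))))
                refl (*-monoˡ-≤ (proj₁ 0<t) (proj₁ (E≤b i j)))) 0<t tb+t≈ε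

  -- I + t (E_{s,d} + ε E_{g,f}) preserves R: the terms linear in t cancel by ω ≈ ε * ω′, and
  -- those quadratic in t by the distinctness of the indices.
  record Move {n} (d s : Fin (n ℕ.+ n)) : Set where
    field
      f g      : Fin (n ℕ.+ n)
      ε ω ω′   : Carrier
      R-d      : ∀ y → R n (identity d) y ≈ ω * y g
      R-f      : ∀ y → R n (identity f) y ≈ ω′ * y s
      balanced : ω ≈ ε * ω′
      g≢d      : g ≢ d
      g≢f      : g ≢ f
      s≢d      : s ≢ d
      s≢f      : s ≢ f
      ascends  : ∀ {t} → 0# ≤ t → (A : Matrix n (n ℕ.+ n)) → MaximalMinorsNonnegative A → A ≼ addColumn f g
              (t * ε) A

    perform : Carrier → Matrix n (n ℕ.+ n) → Matrix n (n ℕ.+ n)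
    perform t A = addColumn f g (t * ε) (addColumn d s t A)

    -- As `g` differs from `d`, the second operation reads an unchanged column. The result is
    -- therefore affine in `t`, as `perturb` requires.
    perform-≈ : ∀ t A i l → perform t A i l ≈ t * (A i s * identity d l + ε * A i g * identity f l) + A i l
    perform-≈ t A i l = trans
      (+-congʳ (*-congʳ (*-congˡ (addColumn-away d s t A i g≢d))))
      (solve 7 (λ t e x u y v a → t :* e :* y :* v :+ (t :* x :* u :+ a) := t :*
              (x :* u :+ e :* y :* v) :+ a) refl
        t ε (A i s) (identity d l) (A i g) (identity f l) (A i l))

    perform-isotropic : ∀ t A → Isotropic {n} A → Isotropic {n} (perform t A)
    perform-isotropic t A iso i j = begin
      R n (B i) (B j)
        ≈⟨ image i (B j) ⟩
      t * ε * A i g * (ω′ * B j s) + (t * A i s * (ω * B j g) + R n (A i) (B j))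
        ≈⟨ +-cong (*-congˡ (*-congˡ (B-s j))) (+-cong (*-congˡ (*-cong balanced (B-g j)))
             (trans (R-antisym {n} (A i) (B j)) (-‿cong
                     (trans (image j (A i)) (+-congˡ (+-cong (*-congˡ (*-congʳ balanced)) (iso j i))))))) ⟩
      t * ε * A i g * (ω′ * A j s) + (t * A i s * (ε * ω′ * A j g) +
        - (t * ε * A j g * (ω′ * A i s) + (t * A j s * (ε * ω′ * A i g) + 0#)))
        ≈⟨ solve 7 (λ t e w a b c d → t :* e :* a :* (w :* d) :+ (t :* b :* (e :* w :* c) :+
               :- (t :* e :* c :* (w :* b) :+ (t :* d :* (e :* w :* a) :+ con (ℤ.+ 0)))) := con (ℤ.+ 0)) refl
             t ε ω′ (A i g) (A i s) (A j g) (A j s) ⟩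
      0# ∎
      where
      B = perform t A
      B-s : ∀ j → B j s ≈ A j s
      B-s j = trans (addColumn-away f g (t * ε) (addColumn d s t A) j s≢f) (addColumn-away d s t A j s≢d)
      B-g : ∀ j → B j g ≈ A j g
      B-g j = trans (addColumn-away f g (t * ε) (addColumn d s t A) j g≢f) (addColumn-away d s t A j g≢d)
      image : ∀ i w → R n (B i) w ≈ t * ε * A i g * (ω′ * w s) + (t * A i s * (ω * w g) + R n (A i) w)
      image i w = begin
        R n (B i) w
          ≈⟨ R-linear {n} (t * ε * addColumn d s t A i g) {B i} {identity f} {addColumn d s t A i} w
                  (λ _ → refl) ⟩
        t * ε * addColumn d s t A i g * R n (identity f) w + R n (addColumn d s t A i) w
          ≈⟨ +-cong (*-cong (*-congˡ (addColumn-away d s t A i g≢d)) (R-f w))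
                    (R-linear {n} (t * A i s) {addColumn d s t A i} {identity d} {A i} w (λ _ → refl)) ⟩
        t * ε * A i g * (ω′ * w s) + (t * A i s * R n (identity d) w + R n (A i) w)
          ≈⟨ +-congˡ (+-congʳ (*-congˡ (R-d w))) ⟩
        t * ε * A i g * (ω′ * w s) + (t * A i s * (ω * w g) + R n (A i) w) ∎

  module _ {n : ℕ} where

    toℕ-left : ∀ (i : Fin n) → toℕ (i ↑ˡ n) ≡ toℕ i
    toℕ-left i = Finₚ.toℕ-↑ˡ i n

    toℕ-right : ∀ (i : Fin n) → toℕ (n ↑ʳ i) ≡ n ℕ.+ toℕ i
    toℕ-right i = Finₚ.toℕ-↑ʳ n i

    sgn-suc : ∀ {i j : Fin n} → toℕ j ≡ suc (toℕ i) → (- 1#) ^ toℕ i ≈ - (- 1#) ^ toℕ j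
    sgn-suc {i} {j} e = trans
      (solve 1 (λ s → s := :- (:- con (ℤ.+ 1) :* s)) refl ((- 1#) ^ toℕ i))
      (-‿cong (reflexive (≡.cong ((- 1#) ^_) (≡.sym e))))

  suc⇒≢ : ∀ {n} {d s : Fin n} → toℕ s ≡ suc (toℕ d) → s ≢ d
  suc⇒≢ e ≡.refl = ℕₚ.1+n≢n (≡.sym e)

  -- The index `g` is the partner of `d` under R, and `f` is that of `s`. If `d` and `s` lie in the
  -- same block, `f` is the right neighbour of `g` in the other block: the compensating operation
  -- runs in the opposite direction, which `adjacent-≼` also permits.
  move : ∀ {n} {d s : Fin (n ℕ.+ n)} → toℕ s ≡ suc (toℕ d) → Move {n} d s
  move {n} {d} {s} s≡1+d with column n d | column n s
  ... | left i | left j = record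
    { f = n ↑ʳ j ; g = n ↑ʳ i ; ε = 1# ; ω = (- 1#) ^ toℕ i ; ω′ = - (- 1#) ^ toℕ j
    ; R-d = R-unit-left i ; R-f = R-unit-right j
    ; balanced = trans (sgn-suc {n} {i} {j} j≡1+i) (sym (*-identityˡ _))
    ; g≢d = ↑ˡ≢↑ʳ {n} {i} {i} ∘ ≡.sym ; g≢f = suc⇒≢ j≡1+i ∘ ≡.sym ∘ Finₚ.↑ʳ-injective n i j
    ; s≢d = suc⇒≢ s≡1+d ; s≢f = ↑ˡ≢↑ʳ {n} {j} {j}
    ; ascends = λ 0≤t → adjacent-≼ (inj₂ (≡.trans (toℕ-right j) (≡.trans (≡.cong (n ℕ.+_) j≡1+i)
        (≡.trans (ℕₚ.+-suc n (toℕ i)) (≡.cong suc (≡.sym (toℕ-right i))))))) (*-nonNeg 0≤t 0≤1)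
    }
    where
    j≡1+i : toℕ j ≡ suc (toℕ i)
    j≡1+i = ≡.trans (≡.sym (toℕ-left j)) (≡.trans s≡1+d (≡.cong suc (toℕ-left i)))
  ... | right i | right j = record
    { f = j ↑ˡ n ; g = i ↑ˡ n ; ε = 1# ; ω = - (- 1#) ^ toℕ i ; ω′ = (- 1#) ^ toℕ j
    ; R-d = R-unit-right i ; R-f = R-unit-left j
    ; balanced = trans (-‿cong (sgn-suc {n} {i} {j} j≡1+i)) (trans (-‿involutive _) (sym (*-identityˡ _)))
    ; g≢d = ↑ˡ≢↑ʳ {n} {i} {i} ; g≢f = suc⇒≢ j≡1+i ∘ ≡.sym ∘ Finₚ.↑ˡ-injective n i j
    ; s≢d = suc⇒≢ s≡1+d ; s≢f = ↑ˡ≢↑ʳ {n} {j} {j} ∘ ≡.sym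
    ; ascends = λ 0≤t → adjacent-≼ (inj₂ (≡.trans (toℕ-left j)
            (≡.trans j≡1+i (≡.cong suc (≡.sym (toℕ-left i))))))
        (*-nonNeg 0≤t 0≤1)
    }
    where
    j≡1+i : toℕ j ≡ suc (toℕ i)
    j≡1+i = ℕₚ.+-cancelˡ-≡ n _ _ (≡.trans (≡.sym (toℕ-right j)) (≡.trans s≡1+d
      (≡.trans (≡.cong suc (toℕ-right i)) (≡.sym (ℕₚ.+-suc n (toℕ i))))))
  ... | right i | left j = ⊥-elim (ℕₚ.<⇒≱ (Finₚ.toℕ<n j)
      (ℕₚ.≤-trans (ℕₚ.m≤n⇒m≤1+n (ℕₚ.m≤m+n n (toℕ i)))
        (ℕₚ.≤-reflexive (≡.trans (≡.cong suc (≡.sym (toℕ-right i))) (≡.trans (≡.sym s≡1+d) (toℕ-left j))))))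
  -- Here `d` ends the left block and `s` begins the right one, so `f` is the first column and `g`
  -- the last. The balancing sign (-1)^m agrees with the one in `cyclic-≼`. For a single row `f` and
  -- `g` are `d` and `s` again, which is compatible with the distinctness conditions, since these
  -- only separate sources from targets.
  move {suc m} s≡1+d | left i | right j = record
    { f = j ↑ˡ suc m ; g = suc m ↑ʳ i ; ε = (- 1#) ^ m ; ω = (- 1#) ^ toℕ i ; ω′ = (- 1#) ^ toℕ j
    ; R-d = R-unit-left i ; R-f = R-unit-left j
    ; balanced = trans (reflexive (≡.cong ((- 1#) ^_) i≡m))
        (sym (trans (*-congˡ (reflexive (≡.cong ((- 1#) ^_) j≡0))) (*-identityʳ _)))
    ; g≢d = ↑ˡ≢↑ʳ {suc m} {i} {i} ∘ ≡.sym ; g≢f = ↑ˡ≢↑ʳ {suc m} {j} {i} ∘ ≡.sym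
    ; s≢d = suc⇒≢ s≡1+d ; s≢f = ↑ˡ≢↑ʳ {suc m} {j} {j} ∘ ≡.sym
    ; ascends = λ 0≤t → cyclic-≼ first last (↑ˡ≢↑ʳ {suc m} {j} {i}) 0≤t
    }
    where
    n = suc m
    e : n ℕ.+ toℕ j ≡ suc (toℕ i)
    e = ≡.trans (≡.sym (toℕ-right j)) (≡.trans s≡1+d (≡.cong suc (toℕ-left i)))
    j≡0 : toℕ j ≡ 0
    j≡0 = ℕₚ.n≤0⇒n≡0 (ℕₚ.+-cancelˡ-≤ n _ _ (≡.subst₂ ℕ._≤_ (≡.sym e) (≡.sym (ℕₚ.+-identityʳ n)) (Finₚ.toℕ<n i)))
    i≡m : toℕ i ≡ m
    i≡m = ℕₚ.suc-injective (≡.trans (≡.sym e) (≡.trans (≡.cong (n ℕ.+_) j≡0) (ℕₚ.+-identityʳ n)))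
    first : ∀ x → (j ↑ˡ n) Fin.≤ x
    first x = ≡.subst (ℕ._≤ toℕ x) (≡.sym (≡.trans (toℕ-left j) j≡0)) ℕ.z≤n
    last : ∀ x → x Fin.≤ (n ↑ʳ i)
    last x = ≡.subst (toℕ x ℕ.≤_) (≡.trans (≡.trans (ℕₚ.+-suc m m) (≡.cong (n ℕ.+_) (≡.sym i≡m)))
            (≡.sym (toℕ-right i)))
      (ℕ.s≤s⁻¹ (Finₚ.toℕ<n x))

  record Positive {n} (O : Matrix n (n ℕ.+ n) → Set) (J : Fin n → Fin (n ℕ.+ n)) : Set where
    field
      matrix    : Matrix n (n ℕ.+ n)
      inside    : O matrix
      nonNeg    : MaximalMinorsNonnegative matrix
      isotropic : Isotropic {n} matrix
      strict    : StrictlyIncreasing J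
      positive  : 0# < minor matrix J

  -- `w` bounds the weight strictly and drives the recursion. Every move chooses its own t from the
  -- openness of `O` at the current matrix, so no total size of the perturbation has to be fixed
  -- beforehand.
  reach-left-block : ∀ {n} {O} → TopologicalSpace.IsOpen (matrixSpace n (n ℕ.+ n)) O →
                     ∀ w J → weight J ℕ.< w → Positive {n} O J → Positive {n} O (_↑ˡ n)
  reach-left-block {n} {O} open-O (suc w) J (ℕ.s≤s J≤w) A
    with descent J (Positive.strict A) 0 (λ _ → ℕ.z≤n)
  ... | inj₁ J≡ = record
      { matrix = A.matrix ; inside = A.inside ; nonNeg = A.nonNeg ; isotropic = A.isotropic ; strict = ↑ˡ-strict n
      ; positive = <-≤-trans A.positive (≤-reflexive (minor-cong A.matrix λ i →
          Finₚ.toℕ-injective (≡.trans (J≡ i) (≡.sym (Finₚ.toℕ-↑ˡ i n))))) }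
    where module A = Positive A
  ... | inj₂ (p , d , _ , Jp≡1+d , d∉J) =
    let t , 0<t , inside = perturb open-O A.matrix A.inside
          (λ i l → A.matrix i (J p) * identity d l + M.ε * A.matrix i M.g * identity M.f l)
        A₁ = addColumn d (J p) t A.matrix
        A≼A₁ = adjacent-≼ (inj₁ Jp≡1+d) (proj₁ 0<t) A.matrix A.nonNeg
        A₁≥0 = ≼-nonNeg {A = A.matrix} {A₁} A≼A₁ A.nonNeg
        A₁≼A₂ = M.ascends (proj₁ 0<t) A₁ A₁≥0
        K , K↗ , 0<K , K<J = addColumn-descends Jp≡1+d 0<t A.matrix A.nonNeg J A.strict A.positive p ≡.refl d∉J
    in reach-left-block open-O w K (ℕₚ.<-≤-trans K<J J≤w) (record
         { matrix    = M.perform t A.matrix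
         ; inside    = inside _ (M.perform-≈ t A.matrix)
         ; nonNeg    = ≼-nonNeg {A = A₁} {M.perform t A.matrix} A₁≼A₂ A₁≥0
         ; isotropic = M.perform-isotropic t A.matrix A.isotropic
         ; strict    = K↗
         ; positive  = <-≤-trans 0<K (A₁≼A₂ K K↗)
         })
    where
    module A = Positive A
    module M = Move (move {n} {d} {J p} Jp≡1+d)

  -- Local Lipschitz estimates

  -- Made total, with value 0 at zero, so that `chart` is a function of all matrices; the estimates
  -- on it are made at matrices where its argument is nonzero.
  recip : Carrier → Carrier
  recip x with x ≈? 0#
  ... | yes _   = 0#
  ... | no  x≉0 = proj₁ (inverse x x≉0)

  recip-inverse : ∀ {x} → ¬ x ≈ 0# → x * recip x ≈ 1#
  recip-inverse {x} x≉0 with x ≈? 0#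
  ... | yes x≈0  = ⊥-elim (x≉0 x≈0)
  ... | no  x≉0′ = proj₂ (inverse x x≉0′)

  Bounded-cong : ∀ {b c x y} → b ≈ c → x ≈ y → Bounded b x → Bounded c y
  Bounded-cong b≈c x≈y (p , q) = ≤-cong x≈y b≈c p , ≤-cong (-‿cong x≈y) b≈c q

  Bounded-+ : ∀ {b c x y} → Bounded b x → Bounded c y → Bounded (b + c) (x + y)
  Bounded-+ {x = x} {y} (p , q) (p′ , q′) = +-mono-≤ p p′ ,
    ≤-cong (solve 2 (λ x y → :- x :+ :- y := :- (x :+ y)) refl x y) refl (+-mono-≤ q q′)

  0≤x+x⇒0≤x : ∀ {x} → 0# ≤ x + x → 0# ≤ x
  0≤x+x⇒0≤x {x} 0≤x+x with total 0# x
  ... | inj₁ 0≤x = 0≤x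
  ... | inj₂ x≤0 = ≤-trans 0≤x+x (≤-cong refl (+-identityʳ x) (+-mono-≤ ≤-refl x≤0))

  -- 2 (bc ∓ xy) = (b ∓ x)(c + y) + (b ± x)(c - y).
  Bounded-* : ∀ {b c x y} → Bounded b x → Bounded c y → Bounded (b * c) (x * y)
  Bounded-* {b} {c} {x} {y} (p , q) (p′ , q′) =
    0≤y-x⇒x≤y (0≤x+x⇒0≤x (≤-cong refl
      (solve 4 (λ b c x y → (b :- x) :* (c :- :- y) :+ (b :- :- x) :* (c :- y) := (b :* c :- x :* y) :+
              (b :* c :- x :* y)) refl b c x y)
      (+-nonNeg (*-nonNeg 0≤b-x 0≤c+y) (*-nonNeg 0≤b+x 0≤c-y)))) ,
    0≤y-x⇒x≤y (0≤x+x⇒0≤x (≤-cong refl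
      (solve 4 (λ b c x y → (b :- x) :* (c :- y) :+ (b :- :- x) :* (c :- :- y) := (b :* c :- :- (x :* y)) :+
              (b :* c :- :- (x :* y))) refl b c x y)
      (+-nonNeg (*-nonNeg 0≤b-x 0≤c-y) (*-nonNeg 0≤b+x 0≤c+y))))
    where
    0≤b-x = x≤y⇒0≤y-x p
    0≤b+x = x≤y⇒0≤y-x q
    0≤c-y = x≤y⇒0≤y-x p′
    0≤c+y = x≤y⇒0≤y-x q′

  Near : ∀ {m n} → Matrix m n → (Matrix m n → Set) → Set
  Near A P = ∃[ δ ] 0# < δ × (∀ B → Close δ A B → P B)

  near-× : ∀ {m n} {A : Matrix m n} {P Q} → Near A P → Near A Q → Near A (λ B → P B × Q B)
  near-× (δ , 0<δ , p) (η , 0<η , q) =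
    let ζ , 0<ζ , ζ≤δ , ζ≤η = min-positive 0<δ 0<η
    in ζ , 0<ζ , λ B c → p B (Close-weaken ζ≤δ c) , q B (Close-weaken ζ≤η c)

  near-∀ : ∀ {k m n} {A : Matrix m n} {P : Fin k → Matrix m n → Set} →
           (∀ i → Near A (P i)) → Near A (λ B → ∀ i → P i B)
  near-∀ {zero}  h = 1# , 0<1 , λ _ _ ()
  near-∀ {suc k} {A = A} {P} h =
    let δ , 0<δ , p = near-× {P = P zero} {λ B → ∀ i → P (suc i) B} (h zero) (near-∀ (h ∘ suc))
    in δ , 0<δ , λ { B c zero → proj₁ (p B c) ; B c (suc i) → proj₂ (p B c) i }

  -- A linear bound at the single point `A`, for all small radii at once. Unlike an ε-δ statement it
  -- passes through sums and products without splitting an ε.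
  LipschitzAt : ∀ {m n} → Matrix m n → (Matrix m n → Carrier) → Set
  LipschitzAt A f = ∃[ K ] 0# ≤ K × ∃[ δ₀ ] 0# < δ₀ ×
    (∀ δ → 0# < δ → δ ≤ δ₀ → ∀ B → Close δ A B → Bounded (K * δ) (f B - f A))

  module _ {m n} {A : Matrix m n} where

    lipschitz-const : ∀ c → LipschitzAt A (λ _ → c)
    lipschitz-const c = 0# , ≤-refl , 1# , 0<1 , λ δ _ _ B _ →
      ≤-reflexive (trans (-‿inverseʳ c) (sym (zeroˡ δ))) ,
      ≤-reflexive (trans (-‿cong (-‿inverseʳ c)) (trans -0#≈0# (sym (zeroˡ δ))))

    lipschitz-entry : ∀ i j → LipschitzAt A (λ B → B i j)
    lipschitz-entry i j = 1# , 0≤1 , 1# , 0<1 , λ δ _ _ B c → Bounded-cong (sym (*-identityˡ δ)) refl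
      (proj₁ (proj₂ (c i j)) ,
       ≤-cong (solve 2 (λ x y → x :- y := :- (y :- x)) refl (A i j) (B i j)) refl (proj₁ (proj₁ (c i j))))

    lipschitz-+ : ∀ {f g} → LipschitzAt A f → LipschitzAt A g → LipschitzAt A (λ B → f B + g B)
    lipschitz-+ {f} {g} (K , 0≤K , δ₀ , 0<δ₀ , hf) (L , 0≤L , η₀ , 0<η₀ , hg) =
      let ζ , 0<ζ , ζ≤δ₀ , ζ≤η₀ = min-positive 0<δ₀ 0<η₀ in
      K + L , +-nonNeg 0≤K 0≤L , ζ , 0<ζ , λ δ 0<δ δ≤ζ B c →
        Bounded-cong (sym (distribʳ δ K L))
          (solve 4 (λ a b c d → (a :- b) :+ (c :- d) := (a :+ c) :- (b :+ d)) refl (f B) (f A) (g B) (g A))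
          (Bounded-+ (hf δ 0<δ (≤-trans δ≤ζ ζ≤δ₀) B c) (hg δ 0<δ (≤-trans δ≤ζ ζ≤η₀) B c))

    -- The change of a product is df dg + df g(A) + f(A) dg. The quadratic term K L δ² is at most K
    -- L ζ δ for δ ≤ ζ, whence the constant.
    lipschitz-* : ∀ {f g} → LipschitzAt A f → LipschitzAt A g → LipschitzAt A (λ B → f B * g B)
    lipschitz-* {f} {g} (K , 0≤K , δ₀ , 0<δ₀ , hf) (L , 0≤L , η₀ , 0<η₀ , hg) =
      let ζ , 0<ζ , ζ≤δ₀ , ζ≤η₀ = min-positive 0<δ₀ 0<η₀
          a , 0≤a , f≤a , _ = ∣ f A ∣-spec
          b , 0≤b , g≤b , _ = ∣ g A ∣-spec
          0≤KL = *-nonNeg 0≤K 0≤L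
      in K * L * ζ + (K * b + a * L) ,
         +-nonNeg (*-nonNeg 0≤KL (proj₁ 0<ζ)) (+-nonNeg (*-nonNeg 0≤K 0≤b) (*-nonNeg 0≤a 0≤L)) ,
         ζ , 0<ζ , λ δ 0<δ δ≤ζ B c →
           let df = hf δ 0<δ (≤-trans δ≤ζ ζ≤δ₀) B c
               dg = hg δ 0<δ (≤-trans δ≤ζ ζ≤η₀) B c
           in Bounded-weaken
                (≤-cong (solve 6 (λ K L b a δ ε → K :* L :* δ :* ε :+ (K :* b :+ a :* L) :* δ :=
                                   K :* δ :* (L :* ε) :+ (K :* δ :* b :+ a :* (L :* δ))) refl K L b a δ δ)
                        (sym (distribʳ δ _ _))
                        (+-monoˡ-≤ _ (≤-cong (*-comm _ _) (*-comm _ _)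
                                (*-monoˡ-≤ (proj₁ 0<δ) (*-monoˡ-≤ 0≤KL δ≤ζ)))))
                (Bounded-cong refl
                  (solve 4 (λ x y u v → (x :- u) :* (y :- v) :+
                          ((x :- u) :* v :+ u :* (y :- v)) := x :* y :- u :* v) refl (f B) (g B) (f A) (g A))
                  (Bounded-+ (Bounded-* df dg) (Bounded-+ (Bounded-* df g≤b) (Bounded-* f≤a dg))))

    lipschitz-sum : ∀ {k} {f : Fin k → Matrix m n → Carrier} → (∀ i → LipschitzAt A (f i)) →
                    LipschitzAt A (λ B → sum (λ i → f i B))
    lipschitz-sum {zero}  h = lipschitz-const 0#
    lipschitz-sum {suc k} {f} h = lipschitz-+ {f zero} {λ B → sum (λ i → f (suc i) B)} (h zero)
            (lipschitz-sum (h ∘ suc))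

    lipschitz-det : ∀ {k} {F : Matrix m n → Matrix k k} → (∀ i j → LipschitzAt A (λ B → F B i j)) →
                    LipschitzAt A (λ B → det (F B))
    lipschitz-det {zero}  h = lipschitz-const 1#
    lipschitz-det {suc k} {F} h = lipschitz-sum {suc k}
            {λ j B → (- 1#) ^ toℕ j * F B zero j * det (λ i → removeAt (F B (suc i)) j)} λ j →
      lipschitz-* {λ B → (- 1#) ^ toℕ j * F B zero j} {λ B → det (λ i → removeAt (F B (suc i)) j)}
        (lipschitz-* {λ _ → (- 1#) ^ toℕ j} {λ B → F B zero j} (lipschitz-const ((- 1#) ^ toℕ j)) (h zero j))
        (lipschitz-det {k} {λ B i → removeAt (F B (suc i)) j} (λ i l → h (suc i) (punchIn j l)))

    lipschitz-cramer : ∀ {k} {F : Matrix m n → Matrix k k} {q : Matrix m n → Vector Carrier k} →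
                       (∀ i j → LipschitzAt A (λ B → F B i j)) → (∀ i → LipschitzAt A (λ B → q B i)) →
                       ∀ i → LipschitzAt A (λ B → cramer (F B) (q B) i)
    lipschitz-cramer {suc k} {F} {q} hF hq i =
      lipschitz-* {λ _ → (- 1#) ^ toℕ i} {λ B → det (λ b → q B b ∷ removeAt (F B b) i)}
        (lipschitz-const ((- 1#) ^ toℕ i))
        (lipschitz-det {suc k} {λ B b → q B b ∷ removeAt (F B b) i} λ
                { b zero → hq b ; b (suc j) → hF b (punchIn i j) })

    module _ {f : Matrix m n → Carrier} (f-lipschitz : LipschitzAt A f) (fA≉0 : ¬ f A ≈ 0#) where

      private
        K   = proj₁ f-lipschitz
        0≤K = proj₁ (proj₂ f-lipschitz)
        δ₀  = proj₁ (proj₂ (proj₂ f-lipschitz))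
        y₀ = recip (f A)
        β   = proj₁ ∣ y₀ ∣-spec
        0≤β = proj₁ (proj₂ ∣ y₀ ∣-spec)
        y₀≤β = proj₁ (proj₂ (proj₂ ∣ y₀ ∣-spec))
        h : Carrier → Carrier
        h δ = β * (K * δ)
        2βK = β * K + β * K
        -- Taking r at most 1 / (2βK + 1) keeps the relative error of `f` within one half, which is
        -- expressed as `h δ + h δ ≤ 1#` to avoid dividing by two.
        radius : ∃[ r ] 0# < r × r ≤ δ₀ × (∀ {δ} → δ ≤ r → h δ + h δ ≤ 1#)
        radius =
          let 0≤2βK = +-nonNeg (*-nonNeg 0≤β 0≤K) (*-nonNeg 0≤β 0≤K)
              y , 0<y , e = inverse-pos (<-≤-trans 0<1 (≤-cong (+-identityˡ 1#) refl (+-monoˡ-≤ 1# 0≤2βK)))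
              r , 0<r , r≤δ₀ , r≤y = min-positive (proj₁ (proj₂ (proj₂ (proj₂ f-lipschitz)))) 0<y
          in r , 0<r , r≤δ₀ , λ {δ} δ≤r → ≤-trans
               (≤-cong (solve 3 (λ b k d → (b :* k :+ b :* k) :* d := b :* (k :* d) :+ b :*
                       (k :* d)) refl β K δ) refl
                 (*-monoˡ-≤ 0≤2βK (≤-trans δ≤r r≤y)))
               (≤-cong (+-identityʳ _) (trans (solve 2 (λ x y → x :* y :+ y :=
                       (x :+ con (ℤ.+ 1)) :* y) refl 2βK y) e)
                 (+-mono-≤ ≤-refl (proj₁ 0<y)))

        relative : Matrix m n → Carrier
        relative B = y₀ * (f B - f A)

        relative-bounded : ∀ δ → 0# < δ → δ ≤ proj₁ radius → ∀ B → Close δ A B → Bounded (h δ) (relative B)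
        relative-bounded δ 0<δ δ≤r B c = Bounded-* y₀≤β
          (proj₂ (proj₂ (proj₂ (proj₂ f-lipschitz))) δ 0<δ (≤-trans δ≤r (proj₁ (proj₂ (proj₂ radius)))) B c)

        y₀*fB : ∀ B → y₀ * f B ≈ 1# + relative B
        y₀*fB B = trans (solve 3 (λ y x a → y :* x := a :* y :+ y :* (x :- a)) refl y₀ (f B) (f A))
                (+-congʳ (recip-inverse fA≉0))

        nonzero : ∀ δ → 0# < δ → δ ≤ proj₁ radius → ∀ B → Close δ A B → ¬ f B ≈ 0#
        nonzero δ 0<δ δ≤r B c fB≈0 = 0≉1 (antisym 0≤1 1≤0)
          where
          -- If `f B` vanished, its relative error would be -1, although it is bounded by one half.
          1≤h : 1# ≤ h δ
          1≤h = ≤-cong (trans (solve 1 (λ u → :- u := con (ℤ.+ 1) :- (con (ℤ.+ 1) :+ u)) refl (relative B))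
                   (trans (+-congˡ (trans (-‿cong (trans (sym (y₀*fB B))
                           (trans (*-congˡ fB≈0) (zeroʳ y₀)))) -0#≈0#)) (+-identityʳ 1#)))
                 refl (proj₂ (relative-bounded δ 0<δ δ≤r B c))
          1≤0 : 1# ≤ 0#
          1≤0 = ≤-cong (solve 1 (λ x → (x :+ x) :- x := x) refl 1#) (-‿inverseʳ 1#)
                  (+-monoˡ-≤ (- 1#) (≤-trans (+-mono-≤ 1≤h 1≤h) (proj₂ (proj₂ (proj₂ radius)) δ≤r)))

      near-nonzero : Near A (λ B → ¬ f B ≈ 0#)
      near-nonzero = proj₁ radius , proj₁ (proj₂ radius) , nonzero (proj₁ radius) (proj₁ (proj₂ radius)) ≤-refl

      -- With y = recip (f B) one has y - y₀ = - y u for u = relative B, and |u| ≤ 1/2 forces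
      -- |y| ≤ 2 |y₀|.
      lipschitz-recip : LipschitzAt A (λ B → recip (f B))
      lipschitz-recip = (β + β) * (β * K) , *-nonNeg (+-nonNeg 0≤β 0≤β) (*-nonNeg 0≤β 0≤K) ,
        proj₁ radius , proj₁ (proj₂ radius) , estimate
        where
        estimate : ∀ δ → 0# < δ → δ ≤ proj₁ radius → ∀ B → Close δ A B →
                   Bounded ((β + β) * (β * K) * δ) (recip (f B) - recip (f A))
        estimate δ 0<δ δ≤r B c = Bounded-weaken
            (≤-cong refl (solve 3 (λ b k d → (b :+ b) :* (b :* (k :* d)) := (b :+ b) :*
                    (b :* k) :* d) refl β K δ)
              (≤-cong (*-comm _ _) (*-comm _ _) (*-monoˡ-≤ 0≤h a≤2β)))
            (Bounded-cong refl (sym y-y₀) (Bounded-* -y≤a u≤h))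
          where
          y = recip (f B)
          u = relative B
          u≤h = relative-bounded δ 0<δ δ≤r B c
          0≤h : 0# ≤ h δ
          0≤h = *-nonNeg 0≤β (*-nonNeg 0≤K (proj₁ 0<δ))
          a = proj₁ ∣ y ∣-spec
          0≤a = proj₁ (proj₂ ∣ y ∣-spec)
          y≤a = proj₁ (proj₂ (proj₂ ∣ y ∣-spec))
          -y≤a : Bounded a (- y)
          -y≤a = proj₂ y≤a , ≤-cong (sym (-‿involutive y)) refl (proj₁ y≤a)
          y-y₀ : y - y₀ ≈ - y * u
          y-y₀ = begin
            y - y₀
              ≈⟨ solve 3 (λ y z u → y :- z := (y :* (con (ℤ.+ 1) :+ u) :- z) :+ :- y :* u) refl y y₀ u ⟩
            (y * (1# + u) - y₀) + - y * u
              ≈⟨ +-congʳ (+-congʳ (trans (*-congˡ (sym (y₀*fB B)))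
                   (trans (solve 3 (λ y z x → y :* (z :* x) := z :* (x :* y)) refl y y₀ (f B))
                     (trans (*-congˡ (recip-inverse (nonzero δ 0<δ δ≤r B c))) (*-identityʳ y₀))))) ⟩
            (y₀ - y₀) + - y * u
              ≈⟨ x≈0⇒x+y≈y (-‿inverseʳ y₀) ⟩
            - y * u ∎
          a≤β+ah : a ≤ β + a * h δ
          a≤β+ah = proj₂ (proj₂ (proj₂ ∣ y ∣-spec)) (Bounded-cong refl
            (trans (+-congˡ (sym y-y₀)) (solve 2 (λ y z → z :+ (y :- z) := y) refl y y₀))
                    (Bounded-+ y₀≤β (Bounded-* -y≤a u≤h)))
          -- Doubling `a≤β+ah` and using `h δ + h δ ≤ 1#` gives 2a ≤ 2β + a, from which a is
          -- cancelled.
          a≤2β : a ≤ β + β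
          a≤2β = ≤-cong (solve 1 (λ a → (a :+ a) :- a := a) refl a)
                  (solve 2 (λ b a → (b :+ b :+ a) :- a := b :+ b) refl β a)
            (+-monoˡ-≤ (- a) (≤-trans (+-mono-≤ a≤β+ah a≤β+ah)
              (≤-cong (solve 3 (λ b a h → (b :+ b) :+ a :* (h :+ h) := (b :+ a :* h) :+
                      (b :+ a :* h)) refl β a (h δ))
                (+-congˡ (*-identityʳ a))
                (+-mono-≤ ≤-refl (*-monoˡ-≤ 0≤a (proj₂ (proj₂ (proj₂ radius)) δ≤r))))))

    lipschitz-near : ∀ {f} → LipschitzAt A f → ∀ {ε} → 0# < ε →
                     Near A (λ B → (f A - f B < ε) × (f B - f A < ε))
    lipschitz-near {f} (K , 0≤K , δ₀ , 0<δ₀ , hf) {ε} 0<ε =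
      -- As in `perturb`, η = ε / (K + 1) leaves a positive margin η below ε and allows K = 0.
      let y , 0<y , e = inverse-pos (<-≤-trans 0<1 (≤-cong (+-identityˡ 1#) refl (+-monoˡ-≤ 1# 0≤K)))
          0<η = *-pos 0<ε 0<y
          δ , 0<δ , δ≤δ₀ , δ≤η = min-positive 0<δ₀ 0<η
          Kδ≤Kη = *-monoˡ-≤ 0≤K δ≤η
          Kη+η≈ε = trans (solve 3 (λ k ε y → k :* (ε :* y) :+ ε :* y := ε :*
                  ((k :+ con (ℤ.+ 1)) :* y)) refl K ε y)
                     (trans (*-congˡ e) (*-identityʳ ε))
      in δ , 0<δ , λ B c → let p , q = hf δ 0<δ δ≤δ₀ B c in
           ≤⇒<+ (≤-trans (≤-cong (solve 2 (λ x y → :- (y :- x) := x :- y) refl (f A)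
                   (f B)) refl q) Kδ≤Kη) 0<η Kη+η≈ε ,
           ≤⇒<+ (≤-trans p Kδ≤Kη) 0<η Kη+η≈ε

  -- The affine chart

  -- Definitionally the members of `rowSpan A`, but available without a proof of independence.
  Span : ∀ {m n} → Matrix m n → Vector Carrier n → Set
  Span A v = ∃[ c ] (∀ j → v j ≈ combination c A j)

  row∈Span : ∀ {m n} (A : Matrix m n) i → Span A (A i)
  row∈Span A i = identity i , row-combination A i

  Span-⊆ : ∀ {k m n} {A : Matrix k n} {B : Matrix m n} → (∀ i → Span B (A i)) → Span A ⊆ Span B
  Span-⊆ {A = A} {B} rows {v} (c , e) = combination c C , λ j → begin
    v j                                           ≈⟨ e j ⟩
    combination c A j                             ≈⟨ combination-cong {c = c} (λ _ → refl)
            (λ i → proj₂ (rows i)) j ⟩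
    combination c (λ i → combination (C i) B) j   ≈⟨ combination-assoc c C B j ⟨
    combination (combination c C) B j ∎
    where C = λ i → proj₁ (rows i)

  Span-resp : ∀ {m n} (A : Matrix m n) {v w} → (∀ j → v j ≈ w j) → Span A v → Span A w
  Span-resp A e (c , f) = c , λ j → trans (sym (e j)) (f j)

  Span-cong : ∀ {m n} {A B : Matrix m n} → (∀ i j → A i j ≈ B i j) → Span A ≐ Span B
  Span-cong {A = A} {B} e =
    Span-⊆ {A = A} {B} (λ i → Span-resp B (λ j → sym (e i j)) (row∈Span B i)) ,
    Span-⊆ {A = B} {A} (λ i → Span-resp A (e i) (row∈Span A i))

  Span-factor : ∀ {m n} (P : Matrix m m) → ¬ det P ≈ 0# → {A B : Matrix m n} →
                (∀ i j → A i j ≈ combination (P i) B j) → Span A ≐ Span B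
  Span-factor P det≉0 {A} {B} e = Span-⊆ {A = A} {B} (λ i → P i , e i) , Span-⊆ {A = B} {A} λ i → D i ,
          λ j → begin
    B i j                                           ≈⟨ row-combination B i j ⟩
    combination (identity i) B j                    ≈⟨ combination-cong {A = B} (proj₂ inv i) (λ _ _ → refl) j ⟨
    combination (combination (D i) P) B j           ≈⟨ combination-assoc (D i) P B j ⟩
    combination (D i) (λ a → combination (P a) B) j ≈⟨ combination-cong {c = D i} (λ _ → refl) e j ⟨
    combination (D i) A j ∎
    where
    inv = left-inverse P det≉0
    D = proj₁ inv

  leftBlock rightBlock : ∀ {n} → Matrix n (n ℕ.+ n) → Matrix n n
  leftBlock {n} B i j = B i (j ↑ˡ n)
  rightBlock {n} B i j = B i (n ↑ʳ j)

  module _ {n : ℕ} where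

    rowSign : Fin n → Carrier
    rowSign i = (- 1#) ^ (n ℕ.∸ suc (toℕ i))

    rowSign-square : ∀ i → rowSign i * rowSign i ≈ 1#
    rowSign-square i = sgn-square (n ℕ.∸ suc (toℕ i))

    -- P⁻¹ Q for B = (P ∣ Q), by Cramer's rule, with signReverse undone.
    chart : Matrix n (n ℕ.+ n) → Matrix n n
    chart B i j = rowSign (opposite i) * (recip (det (leftBlock B)) * cramer (leftBlock B)
            (λ a → rightBlock B a j) (opposite i))

    signReverse-chart : ∀ B i j → signReverse (chart B) i j ≈
                        recip (det (leftBlock B)) * cramer (leftBlock B) (λ a → rightBlock B a j) i
    signReverse-chart B i j = trans (sym (*-assoc _ _ _)) (trans
      (*-cong (trans (*-congˡ (reflexive (≡.cong rowSign (Finₚ.opposite-involutive i)))) (rowSign-square i))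
              (*-congˡ (reflexive (≡.cong (cramer (leftBlock B) (λ a → rightBlock B a j))
                      (Finₚ.opposite-involutive i)))))
      (*-identityˡ _))

    signReverse-injective : ∀ {M N : Matrix n n} → (∀ i j → signReverse M i j ≈ signReverse N i j) → ∀ i j →
            M i j ≈ N i j
    signReverse-injective {M} {N} e i j = begin
      M i j                              ≡⟨ ≡.cong (λ k → M k j) (Finₚ.opposite-involutive i) ⟨
      M (opposite o) j                   ≈⟨ undo M ⟩
      rowSign o * signReverse M o j      ≈⟨ *-congˡ (e o j) ⟩
      rowSign o * signReverse N o j      ≈⟨ undo N ⟨
      N (opposite o) j                   ≡⟨ ≡.cong (λ k → N k j) (Finₚ.opposite-involutive i) ⟩
      N i j ∎
      where
      o = opposite i
      undo : ∀ M → M (opposite o) j ≈ rowSign o * signReverse M o j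
      undo M = sym (trans (sym (*-assoc _ _ _)) (trans (*-congʳ (rowSign-square o)) (*-identityˡ _)))

    combination-block-left : ∀ c (M : Matrix n n) j → combination c (block M) (j ↑ˡ n) ≈ c j
    combination-block-left c M j = combination-identity c (block M) j (j ↑ˡ n)
            (λ i → reflexive (block-left M i j))

    combination-block-right : ∀ c (M : Matrix n n) j → combination c (block M) (n ↑ʳ j) ≈ combination c
            (signReverse M) j
    combination-block-right c M j = sum-cong-≋ {n} (λ i → *-congˡ (reflexive (block-right M i j)))

    chart-factors : ∀ B → ¬ det (leftBlock B) ≈ 0# → ∀ i j → B i j ≈ combination (leftBlock B i)
            (block (chart B)) j
    chart-factors B det≉0 i y with column n y
    ... | left j  = sym (combination-block-left (leftBlock B i) (chart B) j)
    ... | right j = sym (begin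
      combination (P i) (block (chart B)) (n ↑ʳ j)
        ≈⟨ combination-block-right (P i) (chart B) j ⟩
      sum (λ a → P i a * signReverse (chart B) a j)
        ≈⟨ sum-cong-≋ {n} (λ a → trans (*-congˡ (signReverse-chart B a j))
             (solve 3 (λ p r c → p :* (r :* c) := r :* (p :* c)) refl (P i a) (recip (det P)) _)) ⟩
      sum (λ a → recip (det P) * (P i a * cramer P (λ a → rightBlock B a j) a))
        ≈⟨ *-distribˡ-sum {n} (recip (det P)) (λ a → P i a * cramer P (λ a → rightBlock B a j) a) ⟨
      recip (det P) * sum (λ a → P i a * cramer P (λ a → rightBlock B a j) a)
        ≈⟨ *-congˡ (cramer-solves P (λ a → rightBlock B a j) i) ⟩
      recip (det P) * (det P * rightBlock B i j)
        ≈⟨ trans (solve 3 (λ r d x → r :* (d :* x) := (d :* r) :* x) refl (recip (det P)) (det P)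
                (rightBlock B i j))
             (trans (*-congʳ (recip-inverse det≉0)) (*-identityˡ _)) ⟩
      rightBlock B i j ∎)
      where P = leftBlock B

    chart-span : ∀ B → ¬ det (leftBlock B) ≈ 0# → Span B ≐ Span (block (chart B))
    chart-span B det≉0 = Span-factor (leftBlock B) det≉0 (chart-factors B det≉0)

    -- If D expresses the rows of `block M` through those of `B`, comparing left blocks gives det D
    -- times the left minor of `B` equal to 1.
    span-block⇒det≉0 : ∀ B (M : Matrix n n) → Span B ≐ Span (block M) → ¬ det (leftBlock B) ≈ 0#
    span-block⇒det≉0 B M (_ , M⊆B) det≈0 = 0≉1 (begin
      0#                                          ≈⟨ zeroʳ (det D) ⟨
      det D * 0#                                  ≈⟨ *-congˡ det≈0 ⟨
      det D * minor B (_↑ˡ n)                     ≈⟨ minor-* D B (_↑ˡ n) ⟨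
      minor (λ i → combination (D i) B) (_↑ˡ n)   ≈⟨ det-cong
              (λ i j → proj₂ (M⊆B (row∈Span (block M) i)) (j ↑ˡ n)) ⟨
      minor (block M) (_↑ˡ n)                     ≈⟨ minor-block-identity M ⟩
      1# ∎)
      where
      D : Matrix n n
      D i = proj₁ (M⊆B (row∈Span (block M) i))

    -- The rows of B = (P ∣ Q) are combinations of those of `block M`, and the identity columns show
    -- that the coefficients are the entries of P. Thus Q is P times the twist of `M`, and by
    -- `chart-factors` also P times the twist of `chart B`; the invertible P cancels.
    chart-unique : ∀ B (M : Matrix n n) → Span B ≐ Span (block M) → ∀ i j → chart B i j ≈ M i j
    chart-unique B M B≐M@(B⊆M , _) = signReverse-injective λ i j → begin
      signReverse (chart B) i j
        ≈⟨ cancel (signReverse (chart B)) i j ⟩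
      combination (D i) (λ a → combination (P a) (signReverse (chart B))) j
        ≈⟨ combination-cong {c = D i} (λ _ → refl) products j ⟩
      combination (D i) (λ a → combination (P a) (signReverse M)) j
        ≈⟨ cancel (signReverse M) i j ⟨
      signReverse M i j ∎
      where
      P = leftBlock B
      det≉0 = span-block⇒det≉0 B M B≐M
      inv = left-inverse P det≉0
      D = proj₁ inv
      cancel : ∀ X i j → X i j ≈ combination (D i) (λ a → combination (P a) X) j
      cancel X i j = begin
        X i j                                            ≈⟨ row-combination X i j ⟩
        combination (identity i) X j                     ≈⟨ combination-cong {A = X} (proj₂ inv i)
                (λ _ _ → refl) j ⟨
        combination (combination (D i) P) X j            ≈⟨ combination-assoc (D i) P X j ⟩
        combination (D i) (λ a → combination (P a) X) j ∎
      products : ∀ a j → combination (P a) (signReverse (chart B)) j ≈ combination (P a) (signReverse M) j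
      products a j = begin
        combination (P a) (signReverse (chart B)) j   ≈⟨ combination-block-right (P a) (chart B) j ⟨
        combination (P a) (block (chart B)) (n ↑ʳ j)  ≈⟨ chart-factors B det≉0 a (n ↑ʳ j) ⟨
        B a (n ↑ʳ j)                                  ≈⟨ proj₂ row (n ↑ʳ j) ⟩
        combination (proj₁ row) (block M) (n ↑ʳ j)    ≈⟨ combination-cong {A = block M} (λ i → trans
                                                           (sym (combination-block-left (proj₁ row) M i))
                                                                   (sym (proj₂ row (i ↑ˡ n))))
                                                           (λ _ _ → refl) (n ↑ʳ j) ⟩
        combination (P a) (block M) (n ↑ʳ j)          ≈⟨ combination-block-right (P a) M j ⟩
        combination (P a) (signReverse M) j ∎
        where row = B⊆M (row∈Span B a)

    σ-injective : ∀ {M N : Matrix n n} → Span (block M) ≐ Span (block N) → ∀ i j → M i j ≈ N i j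
    σ-injective {M} {N} M≐N i j =
      trans (sym (chart-unique (block M) M ((λ v → v) , (λ v → v)) i j)) (chart-unique (block M) N M≐N i j)

    block-cong : ∀ {M N : Matrix n n} → (∀ i j → M i j ≈ N i j) → ∀ i j → block M i j ≈ block N i j
    block-cong {M} {N} e i y with column n y
    ... | left j  = reflexive (≡.trans (block-left M i j) (≡.sym (block-left N i j)))
    ... | right j = trans (reflexive (block-right M i j))
                      (trans (*-congˡ (e (opposite i) j)) (reflexive (≡.sym (block-right N i j))))

    sgn-cases : ∀ k → (- 1#) ^ k ≈ 1# ⊎ (- 1#) ^ k ≈ - 1#
    sgn-cases zero = inj₁ refl
    sgn-cases (suc k) with sgn-cases k
    ... | inj₁ e = inj₂ (trans (*-congˡ e) (*-identityʳ _))
    ... | inj₂ e = inj₁ (trans (*-congˡ e) (solve 0 (:- con (ℤ.+ 1) :* :- con (ℤ.+ 1) := con (ℤ.+ 1)) refl))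

    <-cong : ∀ {x y ε} → x ≈ y → x < ε → y < ε
    <-cong x≈y (x≤ε , x≉ε) = ≤-cong x≈y refl x≤ε , λ y≈ε → x≉ε (trans x≈y y≈ε)

    sgn-close : ∀ {s x y ε} → s ≈ 1# ⊎ s ≈ - 1# → (x - y < ε) × (y - x < ε) → s * x - s * y < ε
    sgn-close {s} {x} {y} (inj₁ e) (p , _) = <-cong (sym (trans
      (+-cong (*-congʳ e) (-‿cong (*-congʳ e)))
              (solve 2 (λ x y → con (ℤ.+ 1) :* x :- con (ℤ.+ 1) :* y := x :- y) refl x y))) p
    sgn-close {s} {x} {y} (inj₂ e) (_ , q) = <-cong (sym (trans
      (+-cong (*-congʳ e) (-‿cong (*-congʳ e)))
              (solve 2 (λ x y → :- con (ℤ.+ 1) :* x :- :- con (ℤ.+ 1) :* y := y :- x) refl x y))) q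

    block-close : ∀ {ε} {M N : Matrix n n} → 0# < ε → Close ε M N → Close ε (block M) (block N)
    block-close {ε} {M} {N} 0<ε c i y with column n y
    ... | left j = ≈-diff 0<ε e , ≈-diff 0<ε (sym e)
      where
      e : block M i (j ↑ˡ n) ≈ block N i (j ↑ˡ n)
      e = reflexive (≡.trans (block-left M i j) (≡.sym (block-left N i j)))
    ... | right j =
      <-cong (+-cong (reflexive (≡.sym (block-right M i j))) (-‿cong (reflexive (≡.sym (block-right N i j)))))
        (sgn-close (sgn-cases (n ℕ.∸ suc (toℕ i))) (c (opposite i) j)) ,
      <-cong (+-cong (reflexive (≡.sym (block-right N i j))) (-‿cong (reflexive (≡.sym (block-right M i j)))))
        (sgn-close (sgn-cases (n ℕ.∸ suc (toℕ i))) (proj₂ (c (opposite i) j) , proj₁ (c (opposite i) j)))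

    -- Continuity of the chart on its open domain, in the form that the quotient topology asks for:
    -- a set of subspaces is open when the matrices spanning its members form an open set.
    chart-preimage-open : ∀ {U} → TopologicalSpace.IsOpen (matrixSpace n n) U →
                          TopologicalSpace.IsOpen (matrixSpace n (n ℕ.+ n))
                                  (λ B → ¬ det (leftBlock B) ≈ 0# × U (chart B))
    chart-preimage-open {U} open-U B (det≉0 , u) =
      let ε , 0<ε , ball = open-U (chart B) u
          δ , 0<δ , h = near-× {P = λ C → ¬ det (leftBlock C) ≈ 0#} {Close ε (chart B) ∘ chart}
            (near-nonzero {f = λ C → det (leftBlock C)} det-lipschitz det≉0)
            (near-∀ λ i → near-∀ λ j → lipschitz-near {f = λ C → chart C i j} (chart-lipschitz i j) 0<ε)
      in δ , 0<δ , λ C c → proj₁ (h C c) , ball (chart C) (proj₂ (h C c))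
      where
      det-lipschitz : LipschitzAt B (λ C → det (leftBlock C))
      det-lipschitz = lipschitz-det {F = leftBlock} (λ i j → lipschitz-entry i (j ↑ˡ n))
      chart-lipschitz : ∀ i j → LipschitzAt B (λ C → chart C i j)
      chart-lipschitz i j = lipschitz-* {f = λ _ → rowSign (opposite i)}
        (lipschitz-const (rowSign (opposite i)))
        (lipschitz-* {f = λ C → recip (det (leftBlock C))}
                {λ C → cramer (leftBlock C) (λ a → rightBlock C a j) (opposite i)}
          (lipschitz-recip {f = λ C → det (leftBlock C)} det-lipschitz det≉0)
          (lipschitz-cramer {F = leftBlock} {λ C a → rightBlock C a j}
            (λ i j → lipschitz-entry i (j ↑ˡ n)) (λ a → lipschitz-entry a (n ↑ʳ j)) (opposite i)))

    -- The restriction of σ: embedding and density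

    combination-closed : ∀ {m k} {V : Vector Carrier k → Set} → IsSubspace V → (A : Matrix m k) →
            (∀ i → V (A i)) →
                         ∀ c → V (combination c A)
    combination-closed {zero}  sub A A∈V c = IsSubspace.zero-mem sub
    combination-closed {suc m} sub A A∈V c =
      IsSubspace.+-closed sub (IsSubspace.*-closed sub (c zero) (A∈V zero))
              (combination-closed sub (A ∘ suc) (A∈V ∘ suc) (c ∘ suc))

    basis-span : ∀ {m k} (X : Gr m k) {A : Matrix m k} → IsBasis A (Gr.members X) → Span A ≐ Gr.members X
    basis-span X {A} basis =
      (λ (c , e) → IsSubspace.resp (Gr.isSubspace X) (λ j → sym (e j))
                     (combination-closed (Gr.isSubspace X) A (IsBasis.members basis) c)) ,
      IsBasis.spanning basis

    into : ∀ (M : Matrix n n) → TotallyNonnegative M → AntidiagonalSymmetric M → LG≥0 (σ M)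
    into M M≥0 symmetric = Equivalence.from (σ∈LG⇔symmetric M) symmetric , Equivalence.from (σ∈Gr≥0⇔tnn M) M≥0

    restriction : TopologicalSpace.Point (symmetricTNNSpace n) → TopologicalSpace.Point (LG≥0-space n)
    restriction (M , M≥0 , symmetric) = σ M , into M M≥0 symmetric

    restriction-injective : IsInjection (TopologicalSpace._≈_ (symmetricTNNSpace n))
            (TopologicalSpace._≈_ (LG≥0-space n)) restriction
    restriction-injective = record
      { isCongruent = record
        { cong           = λ {x} {y} M≈N → Span-cong (block-cong {proj₁ x} {proj₁ y} M≈N)
        ; isEquivalence₁ = TopologicalSpace.points (symmetricTNNSpace n) .Setoid.isEquivalence
        ; isEquivalence₂ = TopologicalSpace.points (LG≥0-space n) .Setoid.isEquivalence
        }
      ; injective = λ {x} {y} → σ-injective {proj₁ x} {proj₁ y}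
      }

    restriction-continuous : IsContinuous (symmetricTNNSpace n) (LG≥0-space n) restriction
    restriction-continuous V (W , (_ , O , open-O , W⊆O , O⊆W) , V⊆W , W⊆V) =
      -- The map `block` lifts σ to matrices and preserves entrywise closeness, so the open set `O`
      -- of matrices behind `V` is simply pulled back along it.
      (λ M → O (block M)) ,
      (λ M o → let ε , 0<ε , ball = open-O (block M) o in ε , 0<ε , λ N c → ball (block N)
              (block-close 0<ε c)) ,
      (λ { {M , _} v → W⊆O {block M , [I∣′]-independent M} (V⊆W v) }) ,
              (λ { {M , _} o → W⊆V (O⊆W {block M , [I∣′]-independent M} o) })

    -- The open set in the target consists of the spans of (I ∣ M ′) for all M in the ambient open
    -- set `U′`, with no condition of nonnegativity or symmetry. Intersecting it with the image
    -- returns the image of `U`, because σ is injective on all matrices.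
    restriction-openOntoImage : ∀ U → TopologicalSpace.IsOpen (symmetricTNNSpace n) U →
      ∃[ V ] TopologicalSpace.IsOpen (LG≥0-space n) V ×
             Image (symmetricTNNSpace n) (LG≥0-space n) restriction U ≐
             (V ∩ Image (symmetricTNNSpace n) (LG≥0-space n) restriction Whole)
    restriction-openOntoImage U (U′ , open-U′ , U⊆U′ , U′⊆U) =
      (λ (X , _) → W X) ,
      (W , ((λ {X} {Y} → W-resp {X} {Y}) , (λ B → ¬ det (leftBlock B) ≈ 0# × U′ (chart B)) ,
              chart-preimage-open open-U′ ,
        (λ { {B , _} (M , u , M⊆B , B⊆M) → span-block⇒det≉0 B M (B⊆M , M⊆B) ,
               TopologicalSpace.open-resp-≈ (matrixSpace n n) open-U′
                       (λ i j → sym (chart-unique B M (B⊆M , M⊆B) i j)) u }) ,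
        (λ { {B , _} (det≉0 , u) → let B⊆ , ⊆B = chart-span B det≉0 in chart B , u , ⊆B , B⊆ })) ,
       (λ w → w) , (λ w → w)) ,
      (λ { {Y , _} ((M , M≥0 , symmetric) , u , M≈Y) → (M , U⊆U′ u , M≈Y) ,
              ((M , M≥0 , symmetric) , _ , M≈Y) }) ,
      (λ { {Y , _} ((N , u , N⊆Y , Y⊆N) , ((M , M≥0 , symmetric) , _ , M⊆Y , Y⊆M)) →
             (M , M≥0 , symmetric) ,
             U′⊆U (TopologicalSpace.open-resp-≈ (matrixSpace n n) open-U′
               (σ-injective ((λ v → Y⊆M (N⊆Y v)) , (λ v → Y⊆N (M⊆Y v)))) u) ,
             M⊆Y , Y⊆M })
      where
      W : Gr n (n ℕ.+ n) → Set
      -- Phrased by existence of M rather than through the chart of a basis, so independence of the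
      -- basis is immediate; the chart enters only to show that the preimage among matrices is open.
      W X = ∃[ M ] U′ M × (Span (block M) ≐ Gr.members X)
      W-resp : ∀ {X Y} → Gr.members X ≐ Gr.members Y → W X → W Y
      W-resp (X⊆Y , Y⊆X) (M , u , M⊆X , X⊆M) = M , u , (λ v → X⊆Y (M⊆X v)) , (λ v → X⊆M (Y⊆X v))

    restriction-embedding : IsEmbedding (symmetricTNNSpace n) (LG≥0-space n) restriction
    restriction-embedding = record
      { isInjection   = restriction-injective
      ; isContinuous  = restriction-continuous
      ; openOntoImage = restriction-openOntoImage
      }

    restriction-dense : IsDense (LG≥0-space n) (Image (symmetricTNNSpace n) (LG≥0-space n) restriction Whole)
    restriction-dense U (W , (W-resp , O , open-O , W⊆O , O⊆W) , U⊆W , W⊆U) ((X , lg , A , basis , A≥0) , u) =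
      restriction (M , M≥0 , symmetric) , W⊆U WM , ((M , M≥0 , symmetric) , _ , (λ v → v) , (λ v → v))
      where
      A≐X = basis-span X basis
      A-independent = IsBasis.independent basis
      OA : O A
      OA = W⊆O {A , A-independent} (W-resp {X} {rowSpan A A-independent} (proj₂ A≐X , proj₁ A≐X) (U⊆W u))
      initial = nonzero-minor A A-independent
      J = proj₁ initial
      J↗ : StrictlyIncreasing J
      J↗ = proj₁ (proj₂ initial)
      reached : Positive {n} O (_↑ˡ n)
      reached = reach-left-block open-O (suc (weight J)) J (ℕₚ.n<1+n _) (record
        { matrix = A ; inside = OA ; nonNeg = A≥0
        ; isotropic = λ i j → lg _ _ (IsBasis.members basis i) (IsBasis.members basis j)
        ; strict = J↗ ; positive = A≥0 J J↗ , λ e → proj₂ (proj₂ initial) (sym e) })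
      open Positive reached using (inside; isotropic; nonNeg; positive) renaming (matrix to B)
      det≉0 : ¬ det (leftBlock B) ≈ 0#
      det≉0 = pos⇒≉0 positive
      -- `O` describes the preimage of `W` only among matrices of full rank, so independence is
      -- recovered from the positive minor before returning to `W`.
      B-independent : LinearlyIndependent B
      B-independent = minor≉0⇒independent B (_↑ˡ n) det≉0
      M : Matrix n n
      M = chart B
      B≐M = chart-span B det≉0
      WM : W (σ M)
      WM = W-resp {rowSpan B B-independent} {σ M} B≐M (O⊆W {B , B-independent} inside)
      M≥0 : TotallyNonnegative M
      M≥0 = Equivalence.to (σ∈Gr≥0⇔tnn M) (B , record
        { members = λ i → proj₁ B≐M (row∈Span B i) ; independent = B-independent ; spanning = proj₂ B≐M } ,
                nonNeg)
      symmetric : AntidiagonalSymmetric M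
      symmetric = Equivalence.to (σ∈LG⇔symmetric M) λ x y x∈ y∈ →
        let c , x≈ = proj₂ B≐M x∈
            d , y≈ = proj₂ B≐M y∈
        in trans (R-cong {n} x≈ y≈) (isotropic-span {n} B isotropic c d)

open import Data.Nat.Base using (_+_)

proposition3p12 :
  (ℝ : RealNumbers) → let open Real ℝ in
  (n : ℕ) .{{_ : NonZero n}} →
  (∀ (M : Matrix n n) → σ M ∈ LG ⇔ M ∈ AntidiagonalSymmetric)
  × (∀ (M : Matrix n n) → σ M ∈ Gr≥0 ⇔ M ∈ TotallyNonnegative)
  × (Σ[ into ∈ (∀ (M : Matrix n n) → M ∈ TotallyNonnegative → M ∈ AntidiagonalSymmetric → σ M ∈ LG≥0) ]
      let restriction = λ ((M , tnn , sym) : TopologicalSpace.Point (symmetricTNNSpace n)) →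
                          (σ M , into M tnn sym)
      in IsEmbedding (symmetricTNNSpace n) (LG≥0-space n) restriction
         × IsDense (LG≥0-space n) (Image (symmetricTNNSpace n) (LG≥0-space n) restriction Whole))
proposition3p12 ℝ n =
  σ∈LG⇔symmetric , σ∈Gr≥0⇔tnn , into , restriction-embedding , restriction-dense
  where open Proof ℝ
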